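{- Let $0<\delta<1/2$ be a constant. There is a constant $C$, depending only on $\delta$, such that for all sufficiently large $n$, every integer $m$ with $\delta\binom n2\le m\le(1-\delta)\binom n2$, and every positive integer $k\le\frac{\log n}{8}$, $$\mathbb E[X_{n,m}^k]\le C^k\,(\mathbb E[X_{n,m}])^k,$$ where $X_{n,m}$ is the number of Hamilton cycles in $G(n,m)$.
   Context: $G(n,m)$ is the random graph chosen uniformly at random from the set of all graphs on vertex set $[n]=\{1,\dots,n\}$ with exactly $m$ edges. Hamilton cycles are counted as (undirected) subgraphs. $\log$ is the natural logarithm. -}

module Defs where

open import Data.Fin as Fin using (Fin; toℕ)
open import Data.Fin.Properties as Finₚ using ()
open import Data.Fin.Subset using (Subset; inside; outside; ∣_∣; _∈_)
open import Data.Fin.Subset.Properties using (_∈?_; _⊆?_)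
open import Data.Integer as ℤ using (+_)
open import Data.List as List using (List; []; _∷_; _++_; map; filter; cartesianProduct; allFin; upTo; length; foldr)
open import Data.Nat as ℕ using (ℕ; zero; suc; _!)
open import Data.Nat.ListAction using (sum)
open import Data.Nat.DivMod using (_mod_)
open import Data.Nat.Properties using (_!≢0)
open import Data.Product using (∃; ∃-syntax; _×_; _,_; proj₁; proj₂)
open import Data.Product.Properties using (≡-dec)
open import Data.Rational as ℚ using (ℚ; 0ℚ; 1ℚ; _/_)
open import Data.Rational.Properties as ℚₚ using ()
open import Data.Sum as Sum using (_⊎_)
open import Data.Vec using (Vec; []; _∷_; lookup)
open import Data.Vec.Relation.Unary.AllPairs using (allPairs?)
open import Data.Vec.Relation.Unary.Unique.Propositional using (Unique)
open import Function using (_∘_; _⇔_; mk⇔; Equivalence)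
open import Relation.Binary.PropositionalEquality using (_≡_; sym; cong; subst; module ≡-Reasoning)
open import Relation.Nullary using (¬_; Dec)
open import Relation.Nullary.Decidable using (map′; ¬?; _×-dec_; _⊎-dec_; _→-dec_)
open import Relation.Unary using (Decidable)

import Algebra.Definitions.RawSemiring as RawSemiring

open RawSemiring ℚ.+-*-rawSemiring public using () renaming (_^_ to _^ℚ_)

fromℕ : ℕ → ℚ
fromℕ n = + n / 1

------------------------------------------------------------------------
-- Real numbers

-- Dedekind reals: `lower x q` means q < x and `upper x q` means x < q.
record ℝ : Set₁ where
  field
    lower upper     : ℚ → Set
    lower-inhabited : ∃ lower
    upper-inhabited : ∃ upper
    lower-closed    : ∀ {p q} → p ℚ.< q → lower q → lower p
    upper-closed    : ∀ {p q} → p ℚ.< q → upper p → upper q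
    lower-open      : ∀ {p} → lower p → ∃[ q ] (p ℚ.< q × lower q)
    upper-open      : ∀ {q} → upper q → ∃[ p ] (p ℚ.< q × upper p)
    disjoint        : ∀ {q} → lower q → ¬ upper q
    located         : ∀ {p q} → p ℚ.< q → lower p ⊎ upper q

open ℝ public using (lower; upper)

private
  flip-involutive : ∀ q → 1ℚ ℚ.- (1ℚ ℚ.- q) ≡ q
  flip-involutive q = begin
    1ℚ ℚ.+ ℚ.- (1ℚ ℚ.+ ℚ.- q)          ≡⟨ cong (1ℚ ℚ.+_) (ℚₚ.neg-distrib-+ 1ℚ (ℚ.- q)) ⟩
    1ℚ ℚ.+ (ℚ.- 1ℚ ℚ.+ ℚ.- (ℚ.- q))    ≡⟨ sym (ℚₚ.+-assoc 1ℚ (ℚ.- 1ℚ) (ℚ.- (ℚ.- q))) ⟩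
    0ℚ ℚ.+ ℚ.- (ℚ.- q)                 ≡⟨ ℚₚ.+-identityˡ (ℚ.- (ℚ.- q)) ⟩
    ℚ.- (ℚ.- q)                        ≡⟨ neg-involutive q ⟩
    q                                  ∎
    where
    open ≡-Reasoning
    open import Algebra.Properties.Group ℚₚ.+-0-group using ()
      renaming (⁻¹-involutive to neg-involutive)

  flip-< : ∀ {p q} → p ℚ.< q → 1ℚ ℚ.- q ℚ.< 1ℚ ℚ.- p
  flip-< p<q = ℚₚ.+-monoʳ-< 1ℚ (ℚₚ.neg-antimono-< p<q)

1-_ : ℝ → ℝ
1- x = record
  { lower           = λ q → upper x (1ℚ ℚ.- q)
  ; upper           = λ q → lower x (1ℚ ℚ.- q)
  ; lower-inhabited = let q , u = X.upper-inhabited in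
                      1ℚ ℚ.- q , subst X.upper (sym (flip-involutive q)) u
  ; upper-inhabited = let q , l = X.lower-inhabited in
                      1ℚ ℚ.- q , subst X.lower (sym (flip-involutive q)) l
  ; lower-closed    = λ p<q → X.upper-closed (flip-< p<q)
  ; upper-closed    = λ p<q → X.lower-closed (flip-< p<q)
  ; lower-open      = λ {p} u → let q , q<1-p , u′ = X.upper-open u in
                      1ℚ ℚ.- q ,
                      subst (ℚ._< 1ℚ ℚ.- q) (flip-involutive p) (flip-< q<1-p) ,
                      subst X.upper (sym (flip-involutive q)) u′
  ; upper-open      = λ {p} l → let q , 1-p<q , l′ = X.lower-open l in
                      1ℚ ℚ.- q ,
                      subst (1ℚ ℚ.- q ℚ.<_) (flip-involutive p) (flip-< 1-p<q) ,
                      subst X.lower (sym (flip-involutive q)) l′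
  ; disjoint        = λ u l → X.disjoint l u
  ; located         = λ p<q → Sum.swap (X.located (flip-< p<q))
  }
  where module X = ℝ x

-- x · c ≤ m.  Since c is non-negative, x · c is the supremum of the q · c
-- over the rationals q < x, and the infimum of the q · c over those q > x.
_·_≲_ : ℝ → ℕ → ℕ → Set
x · c ≲ m = ∀ q → lower x q → q ℚ.* fromℕ c ℚ.≤ fromℕ m

-- m ≤ x · c.
_≲_·_ : ℕ → ℝ → ℕ → Set
m ≲ x · c = ∀ q → upper x q → fromℕ m ℚ.≤ q ℚ.* fromℕ c

-- The partial sum  Σ_{i<N} xⁱ / i!  of the exponential series.
expPartial : ℕ → ℕ → ℚ
expPartial x N = foldr ℚ._+_ 0ℚ (map (λ i → _/_ (+ (x ℕ.^ i)) (i !) {{i !≢0}}) (upTo N))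

-- x ≤ log n for the natural logarithm, the inverse of exp: eˣ ≤ n.  For
-- x ≥ 0 the number eˣ is the supremum of the partial sums of its series.
_≤log_ : ℕ → ℕ → Set
x ≤log n = ∀ N → expPartial x N ℚ.≤ fromℕ n

------------------------------------------------------------------------
-- Finite searches

subsets : ∀ N → List (Subset N)
subsets zero    = [] ∷ []
subsets (suc N) = map (outside ∷_) (subsets N) ++ map (inside ∷_) (subsets N)

anyVec? : ∀ {n} k {P : Vec (Fin n) k → Set} → Decidable P → Dec (∃ P)
anyVec? zero    P? = map′ ([] ,_) (λ { ([] , p) → p }) (P? [])
anyVec? (suc k) P? = map′ (λ { (x , xs , p) → x ∷ xs , p })
                          (λ { (x ∷ xs , p) → x , xs , p })
                          (Finₚ.any? λ x → anyVec? k (P? ∘ (x ∷_)))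

_⇔?_ : ∀ {A B : Set} → Dec A → Dec B → Dec (A ⇔ B)
a? ⇔? b? = map′ (λ (f , g) → mk⇔ f g) (λ e → Equivalence.to e , Equivalence.from e)
                ((a? →-dec b?) ×-dec (b? →-dec a?))

next : ∀ {n} → Fin n → Fin n
next {suc n} i = suc (toℕ i) mod suc n

-- The value at [] is irrelevant here: there is a graph on Fin n with exactly m
-- edges whenever m ≤ n C 2.
average : List ℕ → ℚ
average []         = 0ℚ
average ys@(_ ∷ _) = + sum ys / length ys

------------------------------------------------------------------------
-- Graphs on the vertex set Fin n

module _ (n : ℕ) where

  -- Each unordered pair {u , v} of distinct vertices is listed once, as u < v.
  pairs : List (Fin n × Fin n)
  pairs = filter (λ e → proj₁ e Fin.<? proj₂ e) (cartesianProduct (allFin n) (allFin n))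

  EdgeIndex : Set
  EdgeIndex = Fin (length pairs)

  endpoints : EdgeIndex → Fin n × Fin n
  endpoints = List.lookup pairs

  Graph : Set
  Graph = Subset (length pairs)

  Joins : EdgeIndex → Fin n → Fin n → Set
  Joins e a b = endpoints e ≡ (a , b) ⊎ endpoints e ≡ (b , a)

  -- The edge e joins two cyclically consecutive vertices of σ.
  OnCycle : Vec (Fin n) n → EdgeIndex → Set
  OnCycle σ e = ∃[ i ] Joins e (lookup σ i) (lookup σ (next i))

  -- H is an undirected, unrooted spanning cycle: for some cyclic arrangement σ of
  -- all the vertices, its edges are exactly those joining consecutive vertices.
  IsHamiltonCycle : Graph → Set
  IsHamiltonCycle H =
    3 ℕ.≤ n × ∃[ σ ] (Unique {n = n} σ × (∀ e → e ∈ H ⇔ OnCycle σ e))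

  joins? : ∀ e a b → Dec (Joins e a b)
  joins? e a b = (endpoints e ≟ (a , b)) ⊎-dec (endpoints e ≟ (b , a))
    where _≟_ = ≡-dec Finₚ._≟_ Finₚ._≟_

  onCycle? : ∀ σ e → Dec (OnCycle σ e)
  onCycle? σ e = Finₚ.any? λ i → joins? e (lookup σ i) (lookup σ (next i))

  isHamiltonCycle? : Decidable IsHamiltonCycle
  isHamiltonCycle? H =
    (3 ℕ.≤? n) ×-dec
    anyVec? n λ σ → allPairs? (λ x y → ¬? (x Finₚ.≟ y)) σ ×-dec
                    Finₚ.all? λ e → (e ∈? H) ⇔? onCycle? σ e

  hamiltonCycles : Graph → ℕ
  hamiltonCycles G =
    length (filter (λ H → (H ⊆? G) ×-dec isHamiltonCycle? H) (subsets (length pairs)))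

  graphs : ℕ → List Graph
  graphs m = filter (λ G → ∣ G ∣ ℕ.≟ m) (subsets (length pairs))

  -- The expectation of f (G(n,m)).
  𝔼 : ℕ → (Graph → ℕ) → ℚ
  𝔼 m f = average (map f (graphs m))

{-# OPTIONS --safe #-}
module Submission where

-- Conditionally on U ⊆ G(n,m), where U has at most kn edges, the expected number
-- of Hamilton cycles exceeds the unconditional one by at most a constant factor;
-- adding the k cycles of a k-tuple one at a time then gives the theorem.
-- Write N = n C 2, u = ∣U∣, s = m − u, w = N − m.  A cycle H sharing t edges with U
-- is present with conditional probability at most (s/(s+w))^(n−t), so the point is
-- to average (1 + w/s)^t over H.  Expanding this power over sets of arcs reduces it
-- to the number of Hamilton paths from a fixed vertex containing a prescribed set
-- of a arcs, which is at most (n−1−a)!.  The average is then at most a constant times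
-- (1 + w/(s(n−L)))^(2u), with L of order k, that is e^(2uw/(sn)) up to a constant;
-- and this is exactly what the drop of the edge density from m/N to s/(s+w) costs.

open import Defs
open import Algebra.Bundles using (CommutativeMonoid)
open import Data.Bool using (if_then_else_; true; false)
open import Data.Fin as Fin using (Fin; zero; suc; toℕ; inject₁; punchOut) renaming (fromℕ to top)
open import Data.Fin.Properties as Finₚ using ()
open import Data.Fin.Relation.Unary.Top using (view; ‵fromℕ; ‵inject₁)
open import Data.Fin.Subset using (Subset; inside; outside; ∣_∣; _∈_; _⊆_; _∪_; _∩_; _─_; ⊥)
open import Data.Fin.Subset.Properties using (_∈?_; _⊆?_; ∣⊥∣≡0; ⊥⊆; ∣p∣≤n; p⊆q⇒∣p∣≤∣q∣; p⊆p∪q; q⊆p∪q; x∈p∪q⁻; x∈p∩q⁻; x∈p∩q⁺; ⊆-trans; ⊆-antisym)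
open import Data.Integer as ℤ using ()
open import Data.Integer.Properties as ℤₚ using ()
open import Data.List as List using (List; []; _∷_; _++_; map; filter; foldr; length; allFin; cartesianProduct; cartesianProductWith)
import Data.List.Membership.DecPropositional as DecMembership
open import Data.List.Membership.Propositional using () renaming (_∈_ to _∈ˡ_; _∉_ to _∉ˡ_)
open import Data.List.Membership.Propositional.Properties using (∈-allFin; ∈-upTo⁺; ∈-cartesianProduct⁺; ∈-cartesianProductWith⁺; ∈-filter⁺; ∈-filter⁻; ∈-lookup; ∈-++⁺ˡ; ∈-++⁺ʳ; ∈-map⁺; ∈-map⁻)
open import Data.List.Properties using (length-map; length-tabulate; map-tabulate)
open import Data.List.Relation.Unary.All as All using (All; []; _∷_)
open import Data.List.Relation.Unary.All.Properties using (¬Any⇒All¬) renaming (map⁺ to All-map⁺)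
open import Data.List.Relation.Unary.AllPairs using ([]; _∷_)
open import Data.List.Relation.Unary.Any using (here; there; index)
open import Data.List.Relation.Unary.Any.Properties using (lookup-index)
open import Data.List.Relation.Unary.Unique.Propositional using () renaming (Unique to Uniqueˡ)
open import Data.List.Relation.Unary.Unique.Propositional.Properties using (allFin⁺; cartesianProduct⁺; cartesianProductWith⁺; filter⁺; ++⁺; map⁺)
open import Data.Nat
open import Data.Nat.Combinatorics using (_C_; nC1≡n; nCn≡1; nCk≡nC[n∸k]; nCk+nC[k+1]≡[n+1]C[k+1]; k>n⇒nCk≡0)
open import Data.Nat.DivMod using (m<n⇒m%n≡m; n%n≡0)
open import Data.Nat.Divisibility using (∣⇒≤; m≤n⇒m!∣n!)
open import Data.Nat.ListAction using (sum)
open import Data.Nat.Properties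
open import Data.Nat.Tactic.RingSolver using (solve-∀)
open import Data.Product using (∃-syntax; _×_; _,_; proj₁; proj₂)
open import Data.Product.Properties using (≡-dec; ,-injective)
open import Data.Rational as ℚ using (ℚ; mkℚ; 0ℚ; 1ℚ; ½; toℚᵘ)
open import Data.Rational.Properties as ℚₚ using ()
open import Data.Rational.Unnormalised as ℚᵘ using (mkℚᵘ; *≡*; *≤*)
open import Data.Rational.Unnormalised.Properties as ℚᵘₚ using ()
open import Data.Sum using (_⊎_; inj₁; inj₂; [_,_]′)
open import Data.Unit using (⊤; tt)
open import Data.Vec using (Vec; []; _∷_; lookup; head; tabulate)
open import Data.Vec.Properties using (lookup⇒[]=; []=⇒lookup; lookup∘tabulate; tabulate∘lookup; tabulate-cong; ∷-injective; ∷-injectiveʳ)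
import Data.Vec.Relation.Unary.All as Allᵛ
open import Data.Vec.Relation.Unary.AllPairs using ([]; _∷_)
open import Data.Vec.Relation.Unary.Unique.Propositional using (Unique)
open import Data.Vec.Relation.Unary.Unique.Propositional.Properties using (lookup-injective; tabulate⁺)
open import Function using (_∘_; id; _⇔_; mk⇔; Equivalence)
open import Relation.Binary.Definitions using (tri<; tri≈; tri>)
open import Relation.Binary.PropositionalEquality
open import Relation.Nullary using (¬_; Dec; does; yes; no; contradiction)
open import Relation.Nullary.Decidable using (_×-dec_; _→-dec_; ¬?; dec-true; dec-false)
open import Relation.Unary using (Decidable)
open import Algebra.Properties.CommutativeSemigroup (CommutativeMonoid.commutativeSemigroup ℚₚ.*-1-commutativeMonoid) using (interchange; xy∙z≈xz∙y)

-- The gain from overlaps and the loss of edge density are each exponential in k, so the two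
-- exponents must match up to O(1); estimating either of them up to a constant factor would be too
-- weak. For fixed δ their difference is O(k²/n), and the bound on k is used in the form k⁴ ≤ n to
-- make this small. The obstacle is the factor (n-1-a)!/(n-1)!, which is close to n^(-a) only while
-- a is small against n. The estimate is therefore split at a = L. Up to L, each factor of the
-- quotient (n-1)!/(n-1-a)! is at least M = n - L, and M is close enough to n for the exponents to
-- match. Beyond L, the crude bound (8/n)^a is weakened to (64/n)^a / 8^L, and the factor 8^(-L)
-- pays for the whole tail of the expansion. No real exponential occurs: all estimates compare
-- natural numbers with denominators cleared, and powers of 8 take the place of powers of e.

private variable
  𝒜 ℬ : Set
  𝒫 𝒬 : Set

-- Indicators and finite sums over lists

⟦_⟧ : Dec 𝒫 → ℕ
⟦ p? ⟧ = if does p? then 1 else 0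

⟦⟧-yes : (p? : Dec 𝒫) → 𝒫 → ⟦ p? ⟧ ≡ 1
⟦⟧-yes p? p = cong (if_then 1 else 0) (dec-true p? p)

⟦⟧-no : (p? : Dec 𝒫) → ¬ 𝒫 → ⟦ p? ⟧ ≡ 0
⟦⟧-no p? ¬p = cong (if_then 1 else 0) (dec-false p? ¬p)

⟦⟧≤1 : (p? : Dec 𝒫) → ⟦ p? ⟧ ≤ 1
⟦⟧≤1 (yes _) = ≤-refl
⟦⟧≤1 (no _)  = z≤n

⟦⟧-holds : (p? : Dec 𝒫) → ⟦ p? ⟧ ≢ 0 → 𝒫
⟦⟧-holds (yes p) _  = p
⟦⟧-holds (no _)  ≢0 = contradiction refl ≢0

⟦⟧-mono : (p? : Dec 𝒫) (q? : Dec 𝒬) → (𝒫 → 𝒬) → ⟦ p? ⟧ ≤ ⟦ q? ⟧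
⟦⟧-mono (yes p) q? f = ≤-reflexive (sym (⟦⟧-yes q? (f p)))
⟦⟧-mono (no _)  q? f = z≤n

⟦⟧-cong : (p? : Dec 𝒫) (q? : Dec 𝒬) → (𝒫 → 𝒬) → (𝒬 → 𝒫) → ⟦ p? ⟧ ≡ ⟦ q? ⟧
⟦⟧-cong p? q? f g = ≤-antisym (⟦⟧-mono p? q? f) (⟦⟧-mono q? p? g)

⟦⟧-× : (p? : Dec 𝒫) (q? : Dec 𝒬) → ⟦ p? ×-dec q? ⟧ ≡ ⟦ p? ⟧ * ⟦ q? ⟧
⟦⟧-× (yes p) (yes q) = refl
⟦⟧-× (yes p) (no ¬q) = refl
⟦⟧-× (no ¬p) q?      = refl

⟦⟧-⊎ : {R : Set} (p? : Dec 𝒫) (q? : Dec 𝒬) (r? : Dec R) → (𝒫 → 𝒬 ⊎ R) → ⟦ p? ⟧ ≤ ⟦ q? ⟧ + ⟦ r? ⟧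
⟦⟧-⊎ (no _)  q? r? f = z≤n
⟦⟧-⊎ (yes p) q? r? f with f p
... | inj₁ q = ≤-trans (≤-reflexive (sym (⟦⟧-yes q? q))) (m≤m+n _ _)
... | inj₂ r = ≤-trans (≤-reflexive (sym (⟦⟧-yes r? r))) (m≤n+m _ ⟦ q? ⟧)

∑ : List 𝒜 → (𝒜 → ℕ) → ℕ
∑ xs f = sum (map f xs)

syntax ∑ xs (λ x → e) = ∑[ x ← xs ] e

∑-mono-∈ : {f g : 𝒜 → ℕ} (xs : List 𝒜) → (∀ {x} → x ∈ˡ xs → f x ≤ g x) → ∑ xs f ≤ ∑ xs g
∑-mono-∈ []       f≤g = z≤n
∑-mono-∈ (x ∷ xs) f≤g = +-mono-≤ (f≤g (here refl)) (∑-mono-∈ xs (f≤g ∘ there))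

∑-mono : {f g : 𝒜 → ℕ} (xs : List 𝒜) → (∀ x → f x ≤ g x) → ∑ xs f ≤ ∑ xs g
∑-mono xs f≤g = ∑-mono-∈ xs λ {x} _ → f≤g x

∑-cong : {f g : 𝒜 → ℕ} (xs : List 𝒜) → (∀ x → f x ≡ g x) → ∑ xs f ≡ ∑ xs g
∑-cong xs f≡g = ≤-antisym (∑-mono xs (≤-reflexive ∘ f≡g)) (∑-mono xs (≤-reflexive ∘ sym ∘ f≡g))

∑-++ : {f : 𝒜 → ℕ} (xs ys : List 𝒜) → ∑ (xs ++ ys) f ≡ ∑ xs f + ∑ ys f
∑-++     []       ys = refl
∑-++ {f = f} (x ∷ xs) ys = trans (cong (f x +_) (∑-++ xs ys)) (sym (+-assoc (f x) (∑ xs f) (∑ ys f)))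

∑-map : {g : ℬ → ℕ} (f : 𝒜 → ℬ) (xs : List 𝒜) → ∑ (map f xs) g ≡ ∑ xs (g ∘ f)
∑-map f []       = refl
∑-map {g = g} f (x ∷ xs) = cong (g (f x) +_) (∑-map f xs)

∑-+ : {f g : 𝒜 → ℕ} (xs : List 𝒜) → ∑ xs (λ x → f x + g x) ≡ ∑ xs f + ∑ xs g
∑-+ []       = refl
∑-+ {f = f} {g} (x ∷ xs) = trans (cong (f x + g x +_) (∑-+ xs)) (identity (f x) (g x) (∑ xs f) (∑ xs g))
  where
  identity : ∀ a b c d → a + b + (c + d) ≡ a + c + (b + d)
  identity = solve-∀

∑-*ˡ : {f : 𝒜 → ℕ} (c : ℕ) (xs : List 𝒜) → ∑ xs (λ x → c * f x) ≡ c * ∑ xs f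
∑-*ˡ c []       = sym (*-zeroʳ c)
∑-*ˡ {f = f} c (x ∷ xs) = trans (cong (c * f x +_) (∑-*ˡ c xs)) (sym (*-distribˡ-+ c (f x) (∑ xs f)))

∑-*ʳ : {f : 𝒜 → ℕ} (c : ℕ) (xs : List 𝒜) → ∑ xs (λ x → f x * c) ≡ ∑ xs f * c
∑-*ʳ {f = f} c xs = trans (∑-cong xs λ x → *-comm (f x) c) (trans (∑-*ˡ c xs) (*-comm c (∑ xs f)))

∑-const : (c : ℕ) (xs : List 𝒜) → ∑ xs (λ _ → c) ≡ length xs * c
∑-const c []       = refl
∑-const c (x ∷ xs) = cong (c +_) (∑-const c xs)

∑-zero : (xs : List 𝒜) → ∑ xs (λ _ → 0) ≡ 0
∑-zero xs = trans (∑-const 0 xs) (*-zeroʳ (length xs))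

∑-swap : {f : 𝒜 → ℬ → ℕ} (xs : List 𝒜) (ys : List ℬ) →
         ∑[ x ← xs ] ∑ ys (f x) ≡ ∑[ y ← ys ] ∑[ x ← xs ] f x y
∑-swap []       ys = sym (∑-zero ys)
∑-swap {f = f} (x ∷ xs) ys = trans (cong (∑ ys (f x) +_) (∑-swap xs ys)) (sym (∑-+ ys))

∑-filter : {S : 𝒜 → Set} (S? : Decidable S) {f : 𝒜 → ℕ} (xs : List 𝒜) →
           ∑ (filter S? xs) f ≡ ∑[ x ← xs ] (⟦ S? x ⟧ * f x)
∑-filter S? []       = refl
∑-filter S? {f} (x ∷ xs) with does (S? x)
... | true  = cong₂ _+_ (sym (*-identityˡ (f x))) (∑-filter S? xs)
... | false = ∑-filter S? xs

length-filter : {S : 𝒜 → Set} (S? : Decidable S) (xs : List 𝒜) →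
                length (filter S? xs) ≡ ∑[ x ← xs ] ⟦ S? x ⟧
length-filter S? []       = refl
length-filter S? (x ∷ xs) with does (S? x)
... | true  = cong suc (length-filter S? xs)
... | false = length-filter S? xs

∑-cartesianProduct : {f : 𝒜 × ℬ → ℕ} (xs : List 𝒜) (ys : List ℬ) →
                     ∑ (cartesianProduct xs ys) f ≡ ∑[ x ← xs ] ∑[ y ← ys ] f (x , y)
∑-cartesianProduct []       ys = refl
∑-cartesianProduct (x ∷ xs) ys =
  trans (∑-++ (map (x ,_) ys) _) (cong₂ _+_ (∑-map (x ,_) ys) (∑-cartesianProduct xs ys))

∑-member : {f : 𝒜 → ℕ} {x : 𝒜} {xs : List 𝒜} → x ∈ˡ xs → f x ≤ ∑ xs f
∑-member {f = f} {x} {_ ∷ xs} (here refl) = m≤m+n (f x) (∑ xs f)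
∑-member {f = f} {x} {y ∷ xs} (there x∈)  = ≤-trans (∑-member x∈) (m≤n+m (∑ xs f) (f y))

∑-none : {S : 𝒜 → Set} (S? : Decidable S) {xs : List 𝒜} → All (¬_ ∘ S) xs → ∑[ x ← xs ] ⟦ S? x ⟧ ≡ 0
∑-none S? []          = refl
∑-none S? {x ∷ _} (¬s ∷ none) = cong₂ _+_ (⟦⟧-no (S? x) ¬s) (∑-none S? none)

∑-unique≤1 : {S : 𝒜 → Set} (S? : Decidable S) {xs : List 𝒜} → Uniqueˡ xs →
             (∀ {x y} → S x → S y → x ≡ y) → ∑[ x ← xs ] ⟦ S? x ⟧ ≤ 1
∑-unique≤1 S? []  _    = z≤n
∑-unique≤1 S? {x ∷ xs} (x∉ ∷ uniq) same with S? x
... | yes s = ≤-reflexive (cong suc (∑-none S? (All.map (λ x≢ s′ → x≢ (same s s′)) x∉)))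
... | no _  = ∑-unique≤1 S? uniq same

∑-unique≡1 : {S : 𝒜 → Set} (S? : Decidable S) {xs : List 𝒜} → Uniqueˡ xs →
             (∀ {x y} → S x → S y → x ≡ y) → ∀ {x} → x ∈ˡ xs → S x → ∑[ x ← xs ] ⟦ S? x ⟧ ≡ 1
∑-unique≡1 S? uniq same {x} x∈ s = ≤-antisym (∑-unique≤1 S? uniq same)
  (≤-trans (≤-reflexive (sym (⟦⟧-yes (S? x) s))) (∑-member x∈))

∑-nonzero : {f : 𝒜 → ℕ} (xs : List 𝒜) → ∑ xs f ≢ 0 → ∃[ x ] f x ≢ 0
∑-nonzero         []       ≢0 = contradiction refl ≢0
∑-nonzero {f = f} (x ∷ xs) ≢0 with f x ≟ 0
... | yes fx≡0 = ∑-nonzero xs λ rest≡0 → ≢0 (cong₂ _+_ fx≡0 rest≡0)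
... | no  fx≢0 = x , fx≢0

-- Allows a bound such as `⟦ d ⟧` to be proved from a witness of `d`: a nonzero summand provides the
-- witness, and without one the sum is 0.
∑-bound : {f : 𝒜 → ℕ} {b : ℕ} (xs : List 𝒜) → (∀ x → f x ≢ 0 → ∑ xs f ≤ b) → ∑ xs f ≤ b
∑-bound {f = f} xs bound with ∑ xs f ≟ 0
... | yes ≡0 = ≤-trans (≤-reflexive ≡0) z≤n
... | no  ≢0 = let x , fx≢0 = ∑-nonzero xs ≢0 in bound x fx≢0

∑-allFin : ∀ {n} (f : Fin (suc n) → ℕ) → ∑ (allFin (suc n)) f ≡ f zero + ∑ (allFin n) (f ∘ suc)
∑-allFin {n} f = cong (λ ys → f zero + sum ys) (trans (map-tabulate suc f) (sym (map-tabulate id (f ∘ suc))))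

-- Rational arithmetic and the hypotheses of the theorem

toℚᵘ-/ : ∀ i d → toℚᵘ (i ℚ./ suc d) ℚᵘ.≃ mkℚᵘ i d
toℚᵘ-/ i d = ℚₚ.toℚᵘ-fromℚᵘ (mkℚᵘ i d)

/-*-fromℕ : ∀ s d .{{_ : NonZero d}} → (ℤ.+ s ℚ./ d) ℚ.* fromℕ d ≡ fromℕ s
/-*-fromℕ s (suc d) = ℚₚ.toℚᵘ-injective (begin
  toℚᵘ ((ℤ.+ s ℚ./ suc d) ℚ.* fromℕ (suc d))            ≈⟨ ℚₚ.toℚᵘ-homo-* (ℤ.+ s ℚ./ suc d) (fromℕ (suc d)) ⟩
  toℚᵘ (ℤ.+ s ℚ./ suc d) ℚᵘ.* toℚᵘ (fromℕ (suc d))      ≈⟨ ℚᵘₚ.*-cong (toℚᵘ-/ (ℤ.+ s) d) (toℚᵘ-/ (ℤ.+ suc d) 0) ⟩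
  mkℚᵘ (ℤ.+ s) d ℚᵘ.* mkℚᵘ (ℤ.+ suc d) 0                ≈⟨ *≡* (trans (ℤₚ.*-identityʳ (ℤ.+ s ℤ.* ℤ.+ suc d)) (cong (λ z → ℤ.+ s ℤ.* ℤ.+ suc z) (sym (*-identityʳ d)))) ⟩
  mkℚᵘ (ℤ.+ s) 0                                      ≈⟨ toℚᵘ-/ (ℤ.+ s) 0 ⟨
  toℚᵘ (fromℕ s)                                    ∎)
  where open ℚᵘₚ.≃-Reasoning

fromℕ-* : ∀ x y → fromℕ (x * y) ≡ fromℕ x ℚ.* fromℕ y
fromℕ-* x y = ℚₚ.toℚᵘ-injective (begin
  toℚᵘ (fromℕ (x * y))                     ≈⟨ toℚᵘ-/ (ℤ.+ (x * y)) 0 ⟩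
  mkℚᵘ (ℤ.+ (x * y)) 0                       ≈⟨ *≡* (cong (ℤ._* (ℤ.+ 1)) (ℤₚ.pos-* x y)) ⟩
  mkℚᵘ (ℤ.+ x) 0 ℚᵘ.* mkℚᵘ (ℤ.+ y) 0           ≈⟨ ℚᵘₚ.*-cong (toℚᵘ-/ (ℤ.+ x) 0) (toℚᵘ-/ (ℤ.+ y) 0) ⟨
  toℚᵘ (fromℕ x) ℚᵘ.* toℚᵘ (fromℕ y)       ≈⟨ ℚₚ.toℚᵘ-homo-* (fromℕ x) (fromℕ y) ⟨
  toℚᵘ (fromℕ x ℚ.* fromℕ y)               ∎)
  where open ℚᵘₚ.≃-Reasoning

fromℕ-^ : ∀ x k → fromℕ (x ^ k) ≡ fromℕ x ^ℚ k
fromℕ-^ x zero    = refl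
fromℕ-^ x (suc k) = trans (fromℕ-* x (x ^ k)) (cong (fromℕ x ℚ.*_) (fromℕ-^ x k))

^ℚ-distrib-* : ∀ p q k → (p ℚ.* q) ^ℚ k ≡ (p ^ℚ k) ℚ.* (q ^ℚ k)
^ℚ-distrib-* p q zero    = refl
^ℚ-distrib-* p q (suc k) = trans (cong (p ℚ.* q ℚ.*_) (^ℚ-distrib-* p q k)) (interchange p q (p ^ℚ k) (q ^ℚ k))

fromℕ-mono-≤ : ∀ {x y} → x ≤ y → fromℕ x ℚ.≤ fromℕ y
fromℕ-mono-≤ {x} {y} x≤y = ℚₚ.toℚᵘ-cancel-≤ (begin
  toℚᵘ (fromℕ x)   ≃⟨ toℚᵘ-/ (ℤ.+ x) 0 ⟩
  mkℚᵘ (ℤ.+ x) 0     ≤⟨ *≤* (ℤₚ.*-monoʳ-≤-nonNeg (ℤ.+ 1) (ℤ.+≤+ x≤y)) ⟩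
  mkℚᵘ (ℤ.+ y) 0     ≃⟨ toℚᵘ-/ (ℤ.+ y) 0 ⟨
  toℚᵘ (fromℕ y)   ∎)
  where open ℚᵘₚ.≤-Reasoning

fromℕ-cancel-≤ : ∀ {x y} → fromℕ x ℚ.≤ fromℕ y → x ≤ y
fromℕ-cancel-≤ {x} {y} x≤y with ℚᵘₚ.≤-respˡ-≃ (toℚᵘ-/ (ℤ.+ x) 0) (ℚᵘₚ.≤-respʳ-≃ (toℚᵘ-/ (ℤ.+ y) 0) (ℚₚ.toℚᵘ-mono-≤ x≤y))
... | *≤* x*1≤y*1 = ℤ.drop‿+≤+ (subst₂ ℤ._≤_ (ℤₚ.*-identityʳ (ℤ.+ x)) (ℤₚ.*-identityʳ (ℤ.+ y)) x*1≤y*1)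

fromℕ-positive : ∀ n .{{_ : NonZero n}} → ℚ.Positive (fromℕ n)
fromℕ-positive n = ℚₚ.normalize-pos n 1

/-nonNegative : ∀ s d .{{_ : NonZero d}} → 0ℚ ℚ.≤ ℤ.+ s ℚ./ d
/-nonNegative s d = ℚₚ.nonNegative⁻¹ _ {{ℚₚ.normalize-nonNeg s d}}

average-* : ∀ ys → average ys ℚ.* fromℕ (length ys) ≡ fromℕ (sum ys)
average-* []           = refl
average-* (y ∷ ys)     = /-*-fromℕ (sum (y ∷ ys)) (suc (length ys))

-- Multiplication by `length xs ^ k * length xs` clears every denominator, so that from here on the
-- moment inequality is one between natural numbers.
average-^-≤ : ∀ {A : Set} (f : A → ℕ) xs K k → 1 ≤ k →
  ∑[ x ← xs ] (f x ^ k) * length xs ^ k ≤ (K * ∑ xs f) ^ k * length xs →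
  average (map (λ x → f x ^ k) xs) ℚ.≤ (fromℕ K ^ℚ k) ℚ.* (average (map f xs) ^ℚ k)
-- The default value 0 of an empty average makes both sides 0, because `k` is positive.
average-^-≤ f [] K k@(suc k-1) _ _ = ℚₚ.≤-reflexive (sym (trans (cong ((fromℕ K ^ℚ k) ℚ.*_) (ℚₚ.*-zeroˡ (0ℚ ^ℚ k-1))) (ℚₚ.*-zeroʳ (fromℕ K ^ℚ k))))
average-^-≤ f xs@(_ ∷ _) K k _ hyp = ℚₚ.*-cancelʳ-≤-pos (fromℕ (len ^ k * len)) {{fromℕ-positive (len ^ k * len) {{m*n≢0 (len ^ k) len {{m^n≢0 len k}}}}}} (begin
  a ℚ.* fromℕ (len ^ k * len)                          ≡⟨ cong (a ℚ.*_) (trans (fromℕ-* (len ^ k) len) (ℚₚ.*-comm (fromℕ (len ^ k)) (fromℕ len))) ⟩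
  a ℚ.* (fromℕ len ℚ.* fromℕ (len ^ k))                ≡⟨ ℚₚ.*-assoc a (fromℕ len) (fromℕ (len ^ k)) ⟨
  a ℚ.* fromℕ len ℚ.* fromℕ (len ^ k)                  ≡⟨ cong (ℚ._* fromℕ (len ^ k)) (scaled (λ x → f x ^ k)) ⟩
  fromℕ S′ ℚ.* fromℕ (len ^ k)                         ≡⟨ fromℕ-* S′ (len ^ k) ⟨
  fromℕ (S′ * len ^ k)                                 ≤⟨ fromℕ-mono-≤ hyp ⟩
  fromℕ ((K * S) ^ k * len)                            ≡⟨ fromℕ-* ((K * S) ^ k) len ⟩
  fromℕ ((K * S) ^ k) ℚ.* fromℕ len                    ≡⟨ cong (ℚ._* fromℕ len) power ⟩
  (fromℕ K ^ℚ k) ℚ.* (b ^ℚ k) ℚ.* fromℕ (len ^ k) ℚ.* fromℕ len ≡⟨ ℚₚ.*-assoc ((fromℕ K ^ℚ k) ℚ.* (b ^ℚ k)) (fromℕ (len ^ k)) (fromℕ len) ⟩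
  (fromℕ K ^ℚ k) ℚ.* (b ^ℚ k) ℚ.* (fromℕ (len ^ k) ℚ.* fromℕ len) ≡⟨ cong ((fromℕ K ^ℚ k) ℚ.* (b ^ℚ k) ℚ.*_) (fromℕ-* (len ^ k) len) ⟨
  (fromℕ K ^ℚ k) ℚ.* (b ^ℚ k) ℚ.* fromℕ (len ^ k * len) ∎)
  where
  open ℚₚ.≤-Reasoning
  len = length xs
  S = ∑ xs f
  S′ = ∑[ x ← xs ] (f x ^ k)
  a = average (map (λ x → f x ^ k) xs)
  b = average (map f xs)
  scaled : ∀ g → average (map g xs) ℚ.* fromℕ len ≡ fromℕ (∑ xs g)
  scaled g = trans (cong (λ z → average (map g xs) ℚ.* fromℕ z) (sym (length-map g xs))) (average-* (map g xs))
  power : fromℕ ((K * S) ^ k) ≡ (fromℕ K ^ℚ k) ℚ.* (b ^ℚ k) ℚ.* fromℕ (len ^ k)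
  power = begin-equality
    fromℕ ((K * S) ^ k)                                 ≡⟨ trans (fromℕ-^ (K * S) k) (cong (_^ℚ k) (fromℕ-* K S)) ⟩
    (fromℕ K ℚ.* fromℕ S) ^ℚ k                          ≡⟨ cong (λ z → (fromℕ K ℚ.* z) ^ℚ k) (scaled f) ⟨
    (fromℕ K ℚ.* (b ℚ.* fromℕ len)) ^ℚ k                ≡⟨ trans (^ℚ-distrib-* (fromℕ K) _ k) (cong ((fromℕ K ^ℚ k) ℚ.*_) (^ℚ-distrib-* b (fromℕ len) k)) ⟩
    (fromℕ K ^ℚ k) ℚ.* ((b ^ℚ k) ℚ.* (fromℕ len ^ℚ k))  ≡⟨ ℚₚ.*-assoc (fromℕ K ^ℚ k) (b ^ℚ k) (fromℕ len ^ℚ k) ⟨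
    (fromℕ K ^ℚ k) ℚ.* (b ^ℚ k) ℚ.* (fromℕ len ^ℚ k)    ≡⟨ cong ((fromℕ K ^ℚ k) ℚ.* (b ^ℚ k) ℚ.*_) (fromℕ-^ len k) ⟨
    (fromℕ K ^ℚ k) ℚ.* (b ^ℚ k) ℚ.* fromℕ (len ^ k)     ∎

-- The denominator of `q` serves as `d`: the product is the numerator, hence at least 1.
positive-clears : ∀ q → 0ℚ ℚ.< q → ∃[ d ] (1 ≤ d × 1ℚ ℚ.≤ q ℚ.* fromℕ d)
positive-clears q@(mkℚ (ℤ.+ suc p) d-1 _) _ = suc d-1 , s≤s z≤n ,
  subst (1ℚ ℚ.≤_) (trans (sym (/-*-fromℕ (suc p) (suc d-1))) (cong (ℚ._* fromℕ (suc d-1)) (ℚₚ.↥p/↧p≡p q))) (fromℕ-mono-≤ {1} {suc p} (s≤s z≤n))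
positive-clears (mkℚ (ℤ.+ zero) _ _) (ℚ.*<* (ℤ.+<+ ()))
positive-clears (mkℚ ℤ.-[1+ _ ] _ _) (ℚ.*<* ())

-- Openness of the lower cut gives a rational strictly between 0 and `δ`, and `D` is its
-- denominator. The later estimates see `δ` only through `D`.
density-positive : ∀ δ → lower δ 0ℚ → ∃[ D ] (1 ≤ D × (∀ c m → δ · c ≲ m → c ≤ D * m))
density-positive δ 0<δ with ℝ.lower-open δ 0<δ
... | q , 0<q , q<δ with positive-clears q 0<q
...   | d , 1≤d , 1≤qd = d , 1≤d , λ c m δc≤m → fromℕ-cancel-≤ (begin
  fromℕ c                            ≡⟨ ℚₚ.*-identityˡ (fromℕ c) ⟨
  1ℚ ℚ.* fromℕ c                     ≤⟨ ℚₚ.*-monoʳ-≤-nonNeg (fromℕ c) {{ℚₚ.normalize-nonNeg c 1}} 1≤qd ⟩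
  q ℚ.* fromℕ d ℚ.* fromℕ c          ≡⟨ xy∙z≈xz∙y q (fromℕ d) (fromℕ c) ⟩
  q ℚ.* fromℕ c ℚ.* fromℕ d          ≤⟨ ℚₚ.*-monoʳ-≤-nonNeg (fromℕ d) {{ℚₚ.normalize-nonNeg d 1}} (δc≤m q q<δ) ⟩
  fromℕ m ℚ.* fromℕ d                ≡⟨ fromℕ-* m d ⟨
  fromℕ (m * d)                      ≡⟨ cong fromℕ (*-comm m d) ⟩
  fromℕ (d * m)                      ∎)
  where open ℚₚ.≤-Reasoning

-- 1 lies in the upper cut of 1 - δ, because `1ℚ - 1ℚ` computes to 0, which lies in the lower cut of
-- `δ`.
density-≤1 : ∀ δ → lower δ 0ℚ → ∀ c m → m ≲ (1- δ) · c → m ≤ c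
density-≤1 δ 0<δ c m m≤ = fromℕ-cancel-≤ (subst (fromℕ m ℚ.≤_) (ℚₚ.*-identityˡ (fromℕ c)) (m≤ 1ℚ 0<δ))

summand-≤ : ∀ (f : ℕ → ℚ) → (∀ i → 0ℚ ℚ.≤ f i) → ∀ {i is} → i ∈ˡ is → f i ℚ.≤ foldr ℚ._+_ 0ℚ (map f is)
summand-≤ f 0≤f {i} {j ∷ is} i∈ = step i∈
  where
  rest : ℚ
  rest = foldr ℚ._+_ 0ℚ (map f is)
  rest-nonNegative : ∀ is → 0ℚ ℚ.≤ foldr ℚ._+_ 0ℚ (map f is)
  rest-nonNegative []       = ℚₚ.≤-refl
  rest-nonNegative (j ∷ is) = ℚₚ.+-mono-≤ {0ℚ} {f j} {0ℚ} {foldr ℚ._+_ 0ℚ (map f is)} (0≤f j) (rest-nonNegative is)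
  step : i ∈ˡ j ∷ is → f i ℚ.≤ f j ℚ.+ rest
  step (here refl) = subst (ℚ._≤ f j ℚ.+ rest) (ℚₚ.+-identityʳ (f j)) (ℚₚ.+-monoʳ-≤ (f j) (rest-nonNegative is))
  step (there i∈)  = subst (ℚ._≤ f j ℚ.+ rest) (ℚₚ.+-identityˡ (f i)) (ℚₚ.+-mono-≤ {0ℚ} {f j} {f i} {rest} (0≤f j) (summand-≤ f 0≤f i∈))

-- All terms of the exponential series are non-negative, so the single term x^i / i! is at most a
-- partial sum.
^-≤log : ∀ x n i → x ≤log n → x ^ i ≤ n * i !
^-≤log x n i x≤log = fromℕ-cancel-≤ (begin
  fromℕ (x ^ i)                ≡⟨ /-*-fromℕ (x ^ i) (i !) {{i !≢0}} ⟨
  term i ℚ.* fromℕ (i !)       ≤⟨ ℚₚ.*-monoʳ-≤-nonNeg (fromℕ (i !)) {{ℚₚ.normalize-nonNeg (i !) 1}} (ℚₚ.≤-trans summand (x≤log (suc i))) ⟩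
  fromℕ n ℚ.* fromℕ (i !)      ≡⟨ fromℕ-* n (i !) ⟨
  fromℕ (n * i !)              ∎)
  where
  open ℚₚ.≤-Reasoning
  term : ℕ → ℚ
  term j = (ℤ.+ (x ^ j) ℚ./ j !) {{j !≢0}}
  summand : term i ℚ.≤ expPartial x (suc i)
  summand = summand-≤ term (λ j → /-nonNegative (x ^ j) (j !) {{j !≢0}}) (∈-upTo⁺ (n<1+n i))

open ≤-Reasoning

-- Powers, factorials and the density estimate

-- Bernoulli's inequality (1 + w/X)^i ≥ 1 + iw/X, multiplied by X^(i+1).
bernoulli : ∀ X w i → X ^ i * (X + i * w) ≤ X * (X + w) ^ i
bernoulli X w zero    = ≤-reflexive (identity X)
  where
  identity : ∀ X → 1 * (X + 0) ≡ X * 1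
  identity = solve-∀
bernoulli X w (suc i) = begin
  X * X ^ i * (X + (w + i * w))               ≡⟨ lhs X (X ^ i) w i ⟩
  X ^ i * (X * X + X * w + i * w * X)         ≤⟨ *-monoʳ-≤ (X ^ i) (m≤m+n _ (i * w * w)) ⟩
  X ^ i * (X * X + X * w + i * w * X + i * w * w) ≡⟨ mid X (X ^ i) w i ⟩
  (X + w) * (X ^ i * (X + i * w))             ≤⟨ *-monoʳ-≤ (X + w) (bernoulli X w i) ⟩
  (X + w) * (X * (X + w) ^ i)                 ≡⟨ rhs X (X + w) ((X + w) ^ i) ⟩
  X * ((X + w) * (X + w) ^ i)                 ∎
  where
  lhs : ∀ X p w i → X * p * (X + (w + i * w)) ≡ p * (X * X + X * w + i * w * X)
  lhs = solve-∀
  mid : ∀ X p w i → p * (X * X + X * w + i * w * X + i * w * w) ≡ (X + w) * (p * (X + i * w))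
  mid = solve-∀
  rhs : ∀ X y p → y * (X * p) ≡ X * (y * p)
  rhs = solve-∀

-- The upper counterpart: with X = A + iw it reads (1 + w/X)^i ≤ 1/(1 - iw/X). The induction moves
-- one `w` into `A`, which keeps X fixed.
bernoulli-upper : ∀ A w i → (A + i * w + w) ^ i * A ≤ (A + i * w) ^ suc i
bernoulli-upper A w zero    = ≤-reflexive (identity A)
  where
  identity : ∀ A → 1 * A ≡ (A + 0) * 1
  identity = solve-∀
bernoulli-upper A w (suc i) = begin
  (X + w) * (X + w) ^ i * A      ≡⟨ rearrange ((X + w) ^ i) X w A ⟩
  (X + w) ^ i * (X * A + A * w)  ≤⟨ *-monoʳ-≤ ((X + w) ^ i) (+-monoʳ-≤ (X * A) (*-monoˡ-≤ w (m≤m+n A _))) ⟩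
  (X + w) ^ i * (X * A + X * w)  ≡⟨ rearrange′ ((X + w) ^ i) X w A ⟩
  X * ((X + w) ^ i * (A + w))    ≤⟨ *-monoʳ-≤ X IH ⟩
  X * X ^ suc i                  ∎
  where
  X = A + suc i * w
  shift : A + w + i * w ≡ X
  shift = +-assoc A w (i * w)
  IH : (X + w) ^ i * (A + w) ≤ X ^ suc i
  IH = subst (λ Y → (Y + w) ^ i * (A + w) ≤ Y ^ suc i) shift (bernoulli-upper (A + w) w i)
  rearrange : ∀ p X w A → (X + w) * p * A ≡ p * (X * A + A * w)
  rearrange = solve-∀
  rearrange′ : ∀ p X w A → p * (X * A + X * w) ≡ X * (p * (A + w))
  rearrange′ = solve-∀

*-^ : ∀ x y i → (x * y) ^ i ≡ x ^ i * y ^ i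
*-^ x y zero    = refl
*-^ x y (suc i) = trans (cong (x * y *_) (*-^ x y i)) (identity x y (x ^ i) (y ^ i))
  where
  identity : ∀ x y p q → x * y * (p * q) ≡ x * p * (y * q)
  identity = solve-∀

double-half : ∀ j → ∃[ i ] (i + i ≤ j × j ≤ suc (i + i))
double-half j = ⌊ j /2⌋ , lower-bound , upper-bound
  where
  split : ⌊ j /2⌋ + ⌈ j /2⌉ ≡ j
  split = ⌊n/2⌋+⌈n/2⌉≡n j
  lower-bound : ⌊ j /2⌋ + ⌊ j /2⌋ ≤ j
  lower-bound = ≤-trans (+-monoʳ-≤ ⌊ j /2⌋ (⌊n/2⌋≤⌈n/2⌉ j)) (≤-reflexive split)
  upper-bound : j ≤ suc (⌊ j /2⌋ + ⌊ j /2⌋)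
  upper-bound = ≤-trans (≤-reflexive (sym split))
    (≤-trans (+-monoʳ-≤ ⌊ j /2⌋ (⌊n/2⌋-mono (n≤1+n (suc j)))) (≤-reflexive (+-suc ⌊ j /2⌋ ⌊ j /2⌋)))

-- By `bernoulli-upper` with w = 1, (1 + 1/M)^i is at most M/(M - i), and this is at most 2 for i ≤
-- M/2.
suc-^-half : ∀ M i → i + i ≤ M → suc M ^ i ≤ 2 * M ^ i
suc-^-half zero    zero    _    = s≤s z≤n
suc-^-half M@(suc _) i 2i≤M = *-cancelʳ-≤ _ _ M (begin
  suc M ^ i * M            ≤⟨ *-monoʳ-≤ (suc M ^ i) M≤2A ⟩
  suc M ^ i * (2 * A)      ≡⟨ swap (suc M ^ i) 2 A ⟩
  2 * (suc M ^ i * A)      ≤⟨ *-monoʳ-≤ 2 estimate ⟩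
  2 * (M * M ^ i)          ≡⟨ swap′ 2 M (M ^ i) ⟩
  2 * M ^ i * M            ∎)
  where
  A = M ∸ i
  i≤M : i ≤ M
  i≤M = ≤-trans (m≤m+n i i) 2i≤M
  A+i≡M : A + i * 1 ≡ M
  A+i≡M = trans (cong (A +_) (*-identityʳ i)) (m∸n+n≡m i≤M)
  i≤A : i ≤ A
  i≤A = +-cancelʳ-≤ i i A (≤-trans 2i≤M (≤-reflexive (sym (m∸n+n≡m i≤M))))
  M≤2A : M ≤ 2 * A
  M≤2A = begin
    M            ≡⟨ m∸n+n≡m i≤M ⟨
    A + i        ≤⟨ +-monoʳ-≤ A i≤A ⟩
    A + A        ≡⟨ cong (A +_) (+-identityʳ A) ⟨
    2 * A        ∎
  estimate : suc M ^ i * A ≤ M * M ^ i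
  estimate = subst (λ Y → Y ^ i * A ≤ M * M ^ i) (+-comm M 1)
    (subst (λ Y → (Y + 1) ^ i * A ≤ Y ^ suc i) A+i≡M (bernoulli-upper A 1 i))
  swap : ∀ p c A → p * (c * A) ≡ c * (p * A)
  swap = solve-∀
  swap′ : ∀ c M p → c * (M * p) ≡ c * p * M
  swap′ = solve-∀

-- The exponent is padded to 2i + 1: both halves cost a factor of 2 by `suc-^-half`, and so does the
-- odd factor 1 + 1/M. The resulting 8 stands in for e throughout.
suc-^-≤ : ∀ M j → j ≤ M → suc M ^ j ≤ 8 * M ^ j
suc-^-≤ zero    zero _   = s≤s z≤n
suc-^-≤ M@(suc _) j j≤M with double-half j
... | i , 2i≤j , j≤2i+1 = *-cancelʳ-≤ _ _ (M ^ (suc (i + i) ∸ j)) {{m^n≢0 M (suc (i + i) ∸ j)}} (begin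
  suc M ^ j * M ^ d           ≤⟨ *-monoʳ-≤ (suc M ^ j) (^-monoˡ-≤ d (n≤1+n M)) ⟩
  suc M ^ j * suc M ^ d       ≡⟨ ^-distribˡ-+-* (suc M) j d ⟨
  suc M ^ (j + d)             ≡⟨ cong (suc M ^_) (m+[n∸m]≡n j≤2i+1) ⟩
  suc M * suc M ^ (i + i)     ≡⟨ cong (suc M *_) (^-distribˡ-+-* (suc M) i i) ⟩
  suc M * (suc M ^ i * suc M ^ i) ≤⟨ *-mono-≤ suc≤2* (*-mono-≤ half half) ⟩
  (2 * M) * (2 * M ^ i * (2 * M ^ i)) ≡⟨ collect M (M ^ i) ⟩
  8 * (M * (M ^ i * M ^ i))   ≡⟨ cong (λ z → 8 * (M * z)) (^-distribˡ-+-* M i i) ⟨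
  8 * M ^ suc (i + i)         ≡⟨ cong (λ z → 8 * M ^ z) (m+[n∸m]≡n j≤2i+1) ⟨
  8 * M ^ (j + d)             ≡⟨ cong (8 *_) (^-distribˡ-+-* M j d) ⟩
  8 * (M ^ j * M ^ d)         ≡⟨ *-assoc 8 (M ^ j) (M ^ d) ⟨
  8 * M ^ j * M ^ d           ∎)
  where
  d = suc (i + i) ∸ j
  half : suc M ^ i ≤ 2 * M ^ i
  half = suc-^-half M i (≤-trans 2i≤j j≤M)
  suc≤2* : suc M ≤ 2 * M
  suc≤2* = ≤-trans (+-monoˡ-≤ M (s≤s z≤n)) (≤-reflexive (cong (M +_) (sym (+-identityʳ M))))
  collect : ∀ M p → (2 * M) * (2 * p * (2 * p)) ≡ 8 * (M * (p * p))
  collect = solve-∀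

+-^-≤ : ∀ j κ → (j + κ) ^ j ≤ 8 ^ κ * j ^ j
+-^-≤ j zero    = ≤-reflexive (trans (cong (_^ j) (+-identityʳ j)) (sym (*-identityˡ (j ^ j))))
+-^-≤ j (suc κ) = begin
  (j + suc κ) ^ j       ≡⟨ cong (_^ j) (+-suc j κ) ⟩
  suc (j + κ) ^ j       ≤⟨ suc-^-≤ (j + κ) j (m≤m+n j κ) ⟩
  8 * (j + κ) ^ j       ≤⟨ *-monoʳ-≤ 8 (+-^-≤ j κ) ⟩
  8 * (8 ^ κ * j ^ j)   ≡⟨ *-assoc 8 (8 ^ κ) (j ^ j) ⟨
  8 ^ suc κ * j ^ j     ∎

-- The elementary form of (1 + c/A)^j ≤ e^(jc/A).
exp-bound : ∀ A c j κ → j * c ≤ κ * A → (A + c) ^ j ≤ 8 ^ κ * A ^ j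
exp-bound A c zero κ _ = *-monoˡ-≤ 1 (m^n>0 8 κ)
exp-bound A c j@(suc _) κ jc≤κA = *-cancelˡ-≤ (j ^ j) {{m^n≢0 j j}} (begin
  j ^ j * (A + c) ^ j        ≡⟨ *-^ j (A + c) j ⟨
  (j * (A + c)) ^ j          ≡⟨ cong (_^ j) (*-distribˡ-+ j A c) ⟩
  (j * A + j * c) ^ j        ≤⟨ ^-monoˡ-≤ j (+-monoʳ-≤ (j * A) jc≤κA) ⟩
  (j * A + κ * A) ^ j        ≡⟨ cong (_^ j) (*-distribʳ-+ A j κ) ⟨
  ((j + κ) * A) ^ j          ≡⟨ *-^ (j + κ) A j ⟩
  (j + κ) ^ j * A ^ j        ≤⟨ *-monoˡ-≤ (A ^ j) (+-^-≤ j κ) ⟩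
  8 ^ κ * j ^ j * A ^ j      ≡⟨ swap (8 ^ κ) (j ^ j) (A ^ j) ⟩
  j ^ j * (8 ^ κ * A ^ j)    ∎)
  where
  swap : ∀ x y z → x * y * z ≡ y * (x * z)
  swap = solve-∀

-- The falling factorial l!/(l - a)! is at least ((l + 1)/8)^a for every `a` up to `l`: each step of
-- the induction lowers the base by 1 in a power with at most that many factors, at a cost of 8.
^-falling : ∀ l a → a ≤ l → suc l ^ a * (l ∸ a) ! ≤ 8 ^ a * l !
^-falling l       zero    _         = ≤-refl
^-falling (suc l) (suc a) (s≤s a≤l) = begin
  suc (suc l) ^ suc a * (l ∸ a) !          ≤⟨ *-monoˡ-≤ ((l ∸ a) !) (suc-^-≤ (suc l) (suc a) (s≤s a≤l)) ⟩
  8 * (suc l * suc l ^ a) * (l ∸ a) !      ≡⟨ rearrange (suc l) (suc l ^ a) ((l ∸ a) !) ⟩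
  8 * suc l * (suc l ^ a * (l ∸ a) !)      ≤⟨ *-monoʳ-≤ (8 * suc l) (^-falling l a a≤l) ⟩
  8 * suc l * (8 ^ a * l !)                ≡⟨ rearrange′ (suc l) (8 ^ a) (l !) ⟩
  8 * 8 ^ a * (suc l * l !)                ∎
  where
  rearrange : ∀ x p f → 8 * (x * p) * f ≡ 8 * x * (p * f)
  rearrange = solve-∀
  rearrange′ : ∀ x p f → 8 * x * (p * f) ≡ 8 * p * (x * f)
  rearrange′ = solve-∀

-- While M + a ≤ l + 1, each of the `a` factors of l!/(l - a)! is at least `M`, with no constant
-- lost.
^-falling-shallow : ∀ M l a → a ≤ l → M + a ≤ suc l → M ^ a * (l ∸ a) ! ≤ l !
^-falling-shallow M l       zero    _         _  = ≤-reflexive (+-identityʳ (l !))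
^-falling-shallow M (suc l) (suc a) (s≤s a≤l) M+a≤l = begin
  M * M ^ a * (l ∸ a) !      ≡⟨ *-assoc M (M ^ a) ((l ∸ a) !) ⟩
  M * (M ^ a * (l ∸ a) !)    ≤⟨ *-mono-≤ M≤l (^-falling-shallow M l a a≤l M+a≤l′) ⟩
  suc l * l !                ∎
  where
  M+a≤l′ : M + a ≤ suc l
  M+a≤l′ = s≤s⁻¹ (≤-trans (≤-reflexive (sym (+-suc M a))) M+a≤l)
  M≤l : M ≤ suc l
  M≤l = ≤-trans (m≤m+n M a) M+a≤l′

-- Divided by (sM)^(2u) (sN)^n, both sides are of order e^(2uw/(sn)): on the left the
-- gain from overlaps with U, on the right the loss of edge density.
density-bound : ∀ s w u M L n N κ .{{_ : NonZero (s * N + u * w)}} → M + L ≡ n → 2 * N ≤ n * n →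
  u * (w * (s * M * (s * n * L + 2 * u * w) + w * (s * N + u * w)))
    ≤ κ * (s * M * (s * M) * (s * N + u * w)) →
  ((s * M + w) * (s * M + w)) ^ u * (s * N) ^ n
    ≤ 8 ^ κ * (s * M * (s * M)) ^ u * (s * N + u * w) ^ n
density-bound s w u M L n N κ M+L≡n 2N≤n² small =
  *-cancelʳ-≤ _ _ (X ^ u * (X + w) ^ (n * u)) {{m*n≢0 (X ^ u) ((X + w) ^ (n * u)) {{m^n≢0 X u}} {{m^n≢0 (X + w) (n * u) {{X+w≢0}}}}}} (begin
    (P * P) ^ u * A ^ n * (X ^ u * (X + w) ^ (n * u))
      ≡⟨ cong (λ z → (P * P) ^ u * A ^ n * (X ^ u * z)) (trans (cong ((X + w) ^_) (*-comm n u)) (sym (^-*-assoc (X + w) u n))) ⟩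
    (P * P) ^ u * A ^ n * (X ^ u * ((X + w) ^ u) ^ n)
      ≡⟨ rearrange ((P * P) ^ u) (A ^ n) (X ^ u) (((X + w) ^ u) ^ n) ⟩
    (P * P) ^ u * X ^ u * (((X + w) ^ u) ^ n * A ^ n)
      ≤⟨ *-mono-≤ PPX density ⟩
    8 ^ κ * α ^ u * (X ^ suc u) ^ n
      ≡⟨ cong (8 ^ κ * α ^ u *_) (trans (*-^ X (X ^ u) n) (cong (X ^ n *_) (trans (^-*-assoc X u n) (trans (cong (X ^_) (*-comm u n)) (sym (^-*-assoc X n u)))))) ⟩
    8 ^ κ * α ^ u * (X ^ n * (X ^ n) ^ u)
      ≡⟨ rearrange₂ (8 ^ κ) (α ^ u) (X ^ n) ((X ^ n) ^ u) ⟩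
    8 ^ κ * X ^ n * (α ^ u * (X ^ n) ^ u)
      ≡⟨ cong (8 ^ κ * X ^ n *_) (*-^ α (X ^ n) u) ⟨
    8 ^ κ * X ^ n * (α * X ^ n) ^ u
      ≤⟨ *-monoʳ-≤ (8 ^ κ * X ^ n) (^-monoˡ-≤ u step) ⟩
    8 ^ κ * X ^ n * (Q * Q * (X * (X + w) ^ n)) ^ u
      ≡⟨ cong (8 ^ κ * X ^ n *_) (trans (*-^ (Q * Q) _ u) (cong ((Q * Q) ^ u *_) (trans (*-^ X _ u) (cong (X ^ u *_) (^-*-assoc (X + w) n u))))) ⟩
    8 ^ κ * X ^ n * ((Q * Q) ^ u * (X ^ u * (X + w) ^ (n * u)))
      ≡⟨ rearrange₃ (8 ^ κ) (X ^ n) ((Q * Q) ^ u) (X ^ u * (X + w) ^ (n * u)) ⟩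
    8 ^ κ * (Q * Q) ^ u * X ^ n * (X ^ u * (X + w) ^ (n * u)) ∎)
  where
  A = s * N
  Q = s * M
  P = Q + w
  X = A + u * w
  -- For each edge of U the inequality wanted is (1 + w/Q)² ≤ 1 + nw/X. Multiplied by Q²X its right
  -- side is `α`, and `β` takes up the excess of the left side.
  α = Q * Q * (X + n * w)
  β = w * (Q * (s * n * L + 2 * u * w) + w * X)
  X+w≢0 : NonZero (X + w)
  X+w≢0 = >-nonZero (≤-trans (>-nonZero⁻¹ X) (m≤m+n X w))
  rearrange : ∀ p a x y → p * a * (x * y) ≡ p * x * (y * a)
  rearrange = solve-∀
  rearrange₂ : ∀ e a x y → e * a * (x * y) ≡ e * x * (a * y)
  rearrange₂ = solve-∀
  rearrange₃ : ∀ e x q y → e * x * (q * y) ≡ e * q * x * y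
  rearrange₃ = solve-∀
  -- This gives (X/A)^n ≥ (1 + w/X)^(un). Read as a u-th power, its base (1 + w/X)^n is at least 1 +
  -- nw/X by `step`.
  density : ((X + w) ^ u) ^ n * A ^ n ≤ (X ^ suc u) ^ n
  density = begin
    ((X + w) ^ u) ^ n * A ^ n ≡⟨ *-^ ((X + w) ^ u) A n ⟨
    ((X + w) ^ u * A) ^ n     ≤⟨ ^-monoˡ-≤ n (bernoulli-upper A w u) ⟩
    (X ^ suc u) ^ n           ∎
  -- The cross term 2wQX of P²X has to meet the term nwQ² of `α`. Since 2N ≤ n² and n = M + L, 2X
  -- exceeds nQ by at most snL + 2uw, which is of lower order.
  2X≤ : 2 * X ≤ n * Q + (s * n * L + 2 * u * w)
  2X≤ = begin
    2 * X                                     ≡⟨ i₁ s N u w ⟩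
    s * (2 * N) + 2 * u * w                   ≤⟨ +-monoˡ-≤ (2 * u * w) (*-monoʳ-≤ s 2N≤n²) ⟩
    s * (n * n) + 2 * u * w                   ≡⟨ cong (λ z → s * (n * z) + 2 * u * w) M+L≡n ⟨
    s * (n * (M + L)) + 2 * u * w             ≡⟨ i₂ s n M L u w ⟩
    n * Q + (s * n * L + 2 * u * w)           ∎
    where
    i₁ : ∀ s N u w → 2 * (s * N + u * w) ≡ s * (2 * N) + 2 * u * w
    i₁ = solve-∀
    i₂ : ∀ s n M L u w → s * (n * (M + L)) + 2 * u * w ≡ n * (s * M) + (s * n * L + 2 * u * w)
    i₂ = solve-∀
  PPX≤α+β : P * P * X ≤ α + β
  PPX≤α+β = begin
    P * P * X                                              ≡⟨ i₁ Q w X ⟩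
    Q * Q * X + w * w * X + w * Q * (2 * X)                ≤⟨ +-monoʳ-≤ (Q * Q * X + w * w * X) (*-monoʳ-≤ (w * Q) 2X≤) ⟩
    Q * Q * X + w * w * X + w * Q * (n * Q + (s * n * L + 2 * u * w)) ≡⟨ i₂ Q w X n (s * n * L + 2 * u * w) ⟩
    α + β                                                  ∎
    where
    i₁ : ∀ Q w X → (Q + w) * (Q + w) * X ≡ Q * Q * X + w * w * X + w * Q * (2 * X)
    i₁ = solve-∀
    i₂ : ∀ Q w X n z → Q * Q * X + w * w * X + w * Q * (n * Q + z) ≡ Q * Q * (X + n * w) + w * (Q * z + w * X)
    i₂ = solve-∀
  PPX : (P * P) ^ u * X ^ u ≤ 8 ^ κ * α ^ u
  PPX = begin
    (P * P) ^ u * X ^ u   ≡⟨ *-^ (P * P) X u ⟨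
    (P * P * X) ^ u       ≤⟨ ^-monoˡ-≤ u PPX≤α+β ⟩
    (α + β) ^ u           ≤⟨ exp-bound α β u κ (≤-trans small (*-monoʳ-≤ κ (*-monoʳ-≤ (Q * Q) (m≤m+n X (n * w))))) ⟩
    8 ^ κ * α ^ u         ∎
  step : α * X ^ n ≤ Q * Q * (X * (X + w) ^ n)
  step = begin
    Q * Q * (X + n * w) * X ^ n     ≡⟨ trans (*-assoc (Q * Q) (X + n * w) (X ^ n)) (cong (Q * Q *_) (*-comm (X + n * w) (X ^ n))) ⟩
    Q * Q * (X ^ n * (X + n * w))   ≤⟨ *-monoʳ-≤ (Q * Q) (bernoulli X w n) ⟩
    Q * Q * (X * (X + w) ^ n)       ∎

-- The range of the parameters

module Dense (n k D s u w : ℕ)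
              (1≤n : 1 ≤ n) (1≤D : 1 ≤ D) (1≤k : 1 ≤ k)
              (n²≤4N : n * n ≤ 4 * (s + u + w)) (2N≤n² : 2 * (s + u + w) ≤ n * n)
              (N≤Dm : s + u + w ≤ D * (s + u))
              (large : 4096 * (k * D * (k * D)) ≤ n)
              (u≤kn : u ≤ k * n) where

  -- `X` factors as m(s + w), so X/(sN) is the ratio of the unconditional edge density m/N to the
  -- conditional density s/(s + w). `L` is the number of prescribed arcs at which the estimate
  -- changes.
  m N L M X : ℕ
  m = s + u
  N = s + u + w
  L = 256 * (k * D)
  M = n ∸ L
  X = s * N + u * w

  instance
    n≢0 : NonZero n
    n≢0 = >-nonZero 1≤n
    kD≢0 : NonZero (k * D)
    kD≢0 = >-nonZero (*-mono-≤ 1≤k 1≤D)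

  kD-large : ∀ c → c ≤ 4096 → c * (k * D) ≤ n
  kD-large c c≤ = ≤-trans (*-mono-≤ c≤ (m≤m*n (k * D) (k * D))) large

  -- `m` is at least n²/(4D), and `n` is at least 16kD.
  4kn≤m : 4 * (k * n) ≤ m
  4kn≤m = *-cancelˡ-≤ (4 * D) {{>-nonZero (*-mono-≤ {1} {4} (s≤s z≤n) 1≤D)}} (begin
    4 * D * (4 * (k * n))     ≡⟨ i₁ D k n ⟩
    16 * (k * D) * n          ≤⟨ *-monoˡ-≤ n (kD-large 16 (≤ᵇ⇒≤ 16 4096 _)) ⟩
    n * n                     ≤⟨ n²≤4N ⟩
    4 * N                     ≤⟨ *-monoʳ-≤ 4 N≤Dm ⟩
    4 * (D * m)               ≡⟨ *-assoc 4 D m ⟨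
    4 * D * m                 ∎)
    where
    i₁ : ∀ D k n → 4 * D * (4 * (k * n)) ≡ 16 * (k * D) * n
    i₁ = solve-∀

  n≤kn : n ≤ k * n
  n≤kn = m≤n*m n k {{>-nonZero 1≤k}}

  2u+2n≤m : 2 * u + 2 * n ≤ m
  2u+2n≤m = begin
    2 * u + 2 * n               ≤⟨ +-mono-≤ (*-monoʳ-≤ 2 u≤kn) (*-monoʳ-≤ 2 n≤kn) ⟩
    2 * (k * n) + 2 * (k * n)   ≡⟨ i₁ (k * n) ⟩
    4 * (k * n)                 ≤⟨ 4kn≤m ⟩
    m                           ∎
    where
    i₁ : ∀ x → 2 * x + 2 * x ≡ 4 * x
    i₁ = solve-∀

  u≤s : u ≤ s
  u≤s = +-cancelʳ-≤ u u s (≤-trans (≤-reflexive (cong (u +_) (sym (+-identityʳ u)))) (m+n≤o⇒m≤o (2 * u) 2u+2n≤m))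

  n≤s : n ≤ s
  n≤s = +-cancelʳ-≤ u n s (≤-trans (+-mono-≤ (m≤n*m n 2) (m≤n*m u 2)) (≤-trans (≤-reflexive (+-comm (2 * n) (2 * u))) 2u+2n≤m))

  instance
    s≢0 : NonZero s
    s≢0 = >-nonZero (≤-trans 1≤n n≤s)
    N≢0 : NonZero N
    N≢0 = >-nonZero (≤-trans (>-nonZero⁻¹ s) (≤-trans (m≤m+n s u) (m≤m+n m w)))
    sN≢0 : NonZero (s * N)
    sN≢0 = m*n≢0 s N
    X≢0 : NonZero X
    X≢0 = >-nonZero (≤-trans (>-nonZero⁻¹ (s * N)) (m≤m+n _ _))

  m≤2s : m ≤ 2 * s
  m≤2s = ≤-trans (+-monoʳ-≤ s u≤s) (≤-reflexive (cong (s +_) (sym (+-identityʳ s))))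

  N≤2Ds : N ≤ 2 * D * s
  N≤2Ds = ≤-trans N≤Dm (≤-trans (*-monoʳ-≤ D m≤2s) (≤-reflexive (i₁ D s)))
    where
    i₁ : ∀ D s → D * (2 * s) ≡ 2 * D * s
    i₁ = solve-∀

  w≤2Ds : w ≤ 2 * D * s
  w≤2Ds = ≤-trans (m≤n+m w m) N≤2Ds

  s+w≤2Ds : s + w ≤ 2 * D * s
  s+w≤2Ds = ≤-trans (+-monoˡ-≤ w (m≤m+n s u)) N≤2Ds

  L≤n : L ≤ n
  L≤n = kD-large 256 (≤ᵇ⇒≤ 256 4096 _)

  M+L≡n : M + L ≡ n
  M+L≡n = m∸n+n≡m L≤n

  n≤2M : n ≤ 2 * M
  n≤2M = +-cancelʳ-≤ n n (2 * M) (begin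
    n + n               ≡⟨ cong (λ z → z + z) M+L≡n ⟨
    M + L + (M + L)     ≡⟨ i₁ M (k * D) ⟩
    2 * M + 512 * (k * D) ≤⟨ +-monoʳ-≤ (2 * M) (kD-large 512 (≤ᵇ⇒≤ 512 4096 _)) ⟩
    2 * M + n           ∎)
    where
    i₁ : ∀ M x → M + 256 * x + (M + 256 * x) ≡ 2 * M + 512 * x
    i₁ = solve-∀

  instance
    M≢0 : NonZero M
    M≢0 = m*n≢0⇒n≢0 2 {{>-nonZero (≤-trans 1≤n n≤2M)}}

  Q : ℕ
  Q = s * M

  sn≤2Q : s * n ≤ 2 * Q
  sn≤2Q = ≤-trans (*-monoʳ-≤ s n≤2M) (≤-reflexive (i₁ s M))
    where
    i₁ : ∀ s M → s * (2 * M) ≡ 2 * (s * M)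
    i₁ = solve-∀

  sn²≤4X : s * (n * n) ≤ 4 * X
  sn²≤4X = begin
    s * (n * n)     ≤⟨ *-monoʳ-≤ s n²≤4N ⟩
    s * (4 * N)     ≡⟨ i₁ s N ⟩
    4 * (s * N)     ≤⟨ *-monoʳ-≤ 4 (m≤m+n (s * N) (u * w)) ⟩
    4 * X           ∎
    where
    i₁ : ∀ s N → s * (4 * N) ≡ 4 * (s * N)
    i₁ = solve-∀

  QQX-large : s * s * (n * n * n) * Q ≤ 8 * (Q * Q * X)
  QQX-large = begin
    s * s * (n * n * n) * Q        ≡⟨ i₁ s n Q ⟩
    Q * (s * n * (s * (n * n)))    ≤⟨ *-monoʳ-≤ Q (*-mono-≤ sn≤2Q sn²≤4X) ⟩
    Q * (2 * Q * (4 * X))          ≡⟨ i₂ Q X ⟩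
    8 * (Q * Q * X)                ∎
    where
    i₁ : ∀ s n Q → s * s * (n * n * n) * Q ≡ Q * (s * n * (s * (n * n)))
    i₁ = solve-∀
    i₂ : ∀ Q X → Q * (2 * Q * (4 * X)) ≡ 8 * (Q * Q * X)
    i₂ = solve-∀

  uw≤ : u * w ≤ 2 * (k * D) * (s * n)
  uw≤ = ≤-trans (*-mono-≤ u≤kn w≤2Ds) (≤-reflexive (i₁ k n D s))
    where
    i₁ : ∀ k n D s → k * n * (2 * D * s) ≡ 2 * (k * D) * (s * n)
    i₁ = solve-∀

  -- By `QQX-large`, Q²X is at least s²n³Q/8, so a quantity of this kind has relative size at most
  -- 8c(kD)²/n. The 4096 in `large` is 8 · 512, where 512 is the constant of `error₁`.
  below-QQX : ∀ c x → c ≤ 512 → x ≤ c * (k * D * (k * D)) * (s * s * (n * n)) * Q → x ≤ Q * Q * X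
  below-QQX c x c≤512 x≤ = *-cancelˡ-≤ 8 (begin
    8 * x                                              ≤⟨ *-monoʳ-≤ 8 x≤ ⟩
    8 * (c * (k * D * (k * D)) * (s * s * (n * n)) * Q) ≤⟨ *-monoʳ-≤ 8 (*-monoˡ-≤ Q (*-monoˡ-≤ (s * s * (n * n)) (*-monoˡ-≤ (k * D * (k * D)) c≤512))) ⟩
    8 * (512 * (k * D * (k * D)) * (s * s * (n * n)) * Q) ≡⟨ i₁ (k * D * (k * D)) (s * s) n Q ⟩
    4096 * (k * D * (k * D)) * (s * s * (n * n) * Q)  ≤⟨ *-monoˡ-≤ (s * s * (n * n) * Q) large ⟩
    n * (s * s * (n * n) * Q)                         ≡⟨ i₂ n (s * s) Q ⟩
    s * s * (n * n * n) * Q                            ≤⟨ QQX-large ⟩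
    8 * (Q * Q * X)                                    ∎)
    where
    i₁ : ∀ x s n Q → 8 * (512 * x * (s * (n * n)) * Q) ≡ 4096 * x * (s * (n * n) * Q)
    i₁ = solve-∀
    i₂ : ∀ n s Q → n * (s * (n * n) * Q) ≡ s * (n * n * n) * Q
    i₂ = solve-∀

  error₁ : u * w * (Q * (s * n * L)) ≤ Q * Q * X
  error₁ = below-QQX 512 _ ≤-refl
    (≤-trans (*-monoˡ-≤ (Q * (s * n * L)) uw≤) (≤-reflexive (i₁ (k * D) s n Q)))
    where
    i₁ : ∀ x s n Q → 2 * x * (s * n) * (Q * (s * n * (256 * x))) ≡ 512 * (x * x) * (s * s * (n * n)) * Q
    i₁ = solve-∀

  error₂ : u * w * (Q * (2 * u * w)) ≤ Q * Q * X
  error₂ = below-QQX 8 _ (≤ᵇ⇒≤ 8 512 _) (begin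
    u * w * (Q * (2 * u * w))   ≡⟨ i₁ u w Q ⟩
    2 * Q * (u * w * (u * w))   ≤⟨ *-monoʳ-≤ (2 * Q) (*-mono-≤ uw≤ uw≤) ⟩
    2 * Q * (2 * (k * D) * (s * n) * (2 * (k * D) * (s * n))) ≡⟨ i₂ (k * D) s n Q ⟩
    8 * (k * D * (k * D)) * (s * s * (n * n)) * Q  ∎)
    where
    i₁ : ∀ u w Q → u * w * (Q * (2 * u * w)) ≡ 2 * Q * (u * w * (u * w))
    i₁ = solve-∀
    i₂ : ∀ x s n Q → 2 * Q * (2 * x * (s * n) * (2 * x * (s * n))) ≡ 8 * (x * x) * (s * s * (n * n)) * Q
    i₂ = solve-∀

  error₃ : u * w * (w * X) ≤ Q * Q * X
  error₃ = begin
    u * w * (w * X)        ≡⟨ *-assoc (u * w) w X ⟨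
    u * w * w * X          ≤⟨ *-monoˡ-≤ X uww≤QQ ⟩
    Q * Q * X              ∎
    where
    i₁ : ∀ k D s n → 4 * (2 * (k * D) * (s * n) * (2 * D * s)) ≡ 16 * (k * D * D) * (s * s * n)
    i₁ = solve-∀
    i₂ : ∀ s n → n * (s * s * n) ≡ s * n * (s * n)
    i₂ = solve-∀
    i₃ : ∀ Q → 2 * Q * (2 * Q) ≡ 4 * (Q * Q)
    i₃ = solve-∀
    kDD≤ : k * D * D ≤ k * D * (k * D)
    kDD≤ = *-monoʳ-≤ (k * D) (m≤n*m D k {{>-nonZero 1≤k}})
    uww≤QQ : u * w * w ≤ Q * Q
    uww≤QQ = *-cancelˡ-≤ 4 (begin
      4 * (u * w * w)                      ≤⟨ *-monoʳ-≤ 4 (*-mono-≤ uw≤ w≤2Ds) ⟩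
      4 * (2 * (k * D) * (s * n) * (2 * D * s)) ≡⟨ i₁ k D s n ⟩
      16 * (k * D * D) * (s * s * n)       ≤⟨ *-monoˡ-≤ (s * s * n) (≤-trans (*-mono-≤ (≤ᵇ⇒≤ 16 4096 _) kDD≤) large) ⟩
      n * (s * s * n)                      ≡⟨ i₂ s n ⟩
      s * n * (s * n)                      ≤⟨ *-mono-≤ sn≤2Q sn≤2Q ⟩
      2 * Q * (2 * Q)                      ≡⟨ i₃ Q ⟩
      4 * (Q * Q)                          ∎)

  error-bound : u * (w * (Q * (s * n * L + 2 * u * w) + w * X)) ≤ 3 * (Q * Q * X)
  error-bound = begin
    u * (w * (Q * (s * n * L + 2 * u * w) + w * X))   ≡⟨ i₁ u w Q (s * n * L) (2 * u * w) (w * X) ⟩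
    u * w * (Q * (s * n * L)) + (u * w * (Q * (2 * u * w)) + u * w * (w * X)) ≤⟨ +-mono-≤ error₁ (+-mono-≤ error₂ error₃) ⟩
    Q * Q * X + (Q * Q * X + Q * Q * X)               ≡⟨ i₂ (Q * Q * X) ⟩
    3 * (Q * Q * X)                                   ∎
    where
    i₁ : ∀ u w Q x y z → u * (w * (Q * (x + y) + z)) ≡ u * w * (Q * x) + (u * w * (Q * y) + u * w * z)
    i₁ = solve-∀
    i₂ : ∀ x → x + (x + x) ≡ 3 * x
    i₂ = solve-∀

  -- The 8^3 has one factor for each of the three errors. `density-bound` treats exactly 2u factors;
  -- the `d` missing ones are supplied by Q ≤ P.
  main-term : ∀ q → q ≤ 2 * u → (s * M + w) ^ q * (s * N) ^ n ≤ 8 ^ 3 * (s * M) ^ q * X ^ n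
  main-term q q≤2u = *-cancelʳ-≤ _ _ (Q ^ d) {{m^n≢0 Q d {{m*n≢0 s M}}}} (begin
    P ^ q * A * Q ^ d       ≤⟨ *-monoʳ-≤ (P ^ q * A) (^-monoˡ-≤ d (m≤m+n Q w)) ⟩
    P ^ q * A * P ^ d       ≡⟨ i₁ (P ^ q) A (P ^ d) ⟩
    P ^ q * P ^ d * A       ≡⟨ cong (_* A) (square-^ P) ⟩
    (P * P) ^ u * A         ≤⟨ density-bound s w u M L n N 3 M+L≡n 2N≤n² error-bound ⟩
    8 ^ 3 * (Q * Q) ^ u * X ^ n        ≡⟨ cong (λ z → 8 ^ 3 * z * X ^ n) (square-^ Q) ⟨
    8 ^ 3 * (Q ^ q * Q ^ d) * X ^ n    ≡⟨ i₂ (8 ^ 3) (Q ^ q) (Q ^ d) (X ^ n) ⟩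
    8 ^ 3 * Q ^ q * X ^ n * Q ^ d      ∎)
    where
    d = 2 * u ∸ q
    P = s * M + w
    A = (s * N) ^ n
    square-^ : ∀ Y → Y ^ q * Y ^ d ≡ (Y * Y) ^ u
    square-^ Y = begin-equality
      Y ^ q * Y ^ d   ≡⟨ ^-distribˡ-+-* Y q d ⟨
      Y ^ (q + d)     ≡⟨ cong (Y ^_) (m+[n∸m]≡n q≤2u) ⟩
      Y ^ (2 * u)     ≡⟨ ^-*-assoc Y 2 u ⟨
      (Y ^ 2) ^ u     ≡⟨ cong (λ z → (Y * z) ^ u) (*-identityʳ Y) ⟩
      (Y * Y) ^ u     ∎
    i₁ : ∀ p a d → p * a * d ≡ p * d * a
    i₁ = solve-∀
    i₂ : ∀ e q d x → e * (q * d) * x ≡ e * q * x * d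
    i₂ = solve-∀

  -- The exponent q · 64w/(sn) is at most 256kD, and this is how `L` was chosen: the 8^(-L) that
  -- accompanies the tail cancels the bound.
  tail-term : ∀ q → q ≤ 2 * u → (s * n + 64 * w) ^ q ≤ 8 ^ L * (s * n) ^ q
  tail-term q q≤2u = exp-bound (s * n) (64 * w) q L (begin
    q * (64 * w)                   ≤⟨ *-monoˡ-≤ (64 * w) q≤2u ⟩
    2 * u * (64 * w)               ≡⟨ i₁ u w ⟩
    128 * (u * w)                  ≤⟨ *-monoʳ-≤ 128 uw≤ ⟩
    128 * (2 * (k * D) * (s * n))  ≡⟨ i₂ (k * D) (s * n) ⟩
    L * (s * n)                    ∎)
    where
    i₁ : ∀ u w → 2 * u * (64 * w) ≡ 128 * (u * w)
    i₁ = solve-∀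
    i₂ : ∀ x y → 128 * (2 * x * y) ≡ 256 * x * y
    i₂ = solve-∀

  -- Cleared of denominators, the hypothesis bounds F/(f s^q) by (1 + w/(sM))^q + 8^(-L) (1 +
  -- 64w/(sn))^q. Relative to (X/(sN))^n the first term is at most 512 and the second at most 1; 513
  -- is rounded up to 1024.
  combine : ∀ F f q → q ≤ 2 * u →
    F * (M ^ q * n ^ q * 8 ^ L) ≤ f * (8 ^ L * n ^ q * (s * M + w) ^ q + M ^ q * (s * n + 64 * w) ^ q) →
    F * (s * N) ^ n ≤ 1024 * (f * s ^ q * X ^ n)
  combine F f q q≤2u hyp = *-cancelʳ-≤ _ _ (M ^ q * n ^ q * 8 ^ L)
    {{m*n≢0 _ _ {{m*n≢0 _ _ {{m^n≢0 M q}} {{m^n≢0 n q}}}} {{m^n≢0 8 L}}}} (begin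
    F * A * (M ^ q * n ^ q * 8 ^ L)     ≡⟨ i₁ F A _ ⟩
    F * (M ^ q * n ^ q * 8 ^ L) * A     ≤⟨ *-monoˡ-≤ A hyp ⟩
    f * (8 ^ L * n ^ q * (s * M + w) ^ q + M ^ q * (s * n + 64 * w) ^ q) * A
      ≡⟨ i₂ f (8 ^ L) (n ^ q) ((s * M + w) ^ q) (M ^ q) ((s * n + 64 * w) ^ q) A ⟩
    f * (8 ^ L * n ^ q * ((s * M + w) ^ q * A) + M ^ q * ((s * n + 64 * w) ^ q * A))
      ≤⟨ *-monoʳ-≤ f (+-mono-≤ (*-monoʳ-≤ (8 ^ L * n ^ q) (main-term q q≤2u))
                              (*-monoʳ-≤ (M ^ q) (*-mono-≤ (tail-term q q≤2u) (^-monoˡ-≤ n (m≤m+n (s * N) (u * w)))))) ⟩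
    f * (8 ^ L * n ^ q * (8 ^ 3 * (s * M) ^ q * X ^ n) + M ^ q * (8 ^ L * (s * n) ^ q * X ^ n))
      ≡⟨ cong₂ (λ y z → f * (8 ^ L * n ^ q * (8 ^ 3 * y * X ^ n) + M ^ q * (8 ^ L * z * X ^ n))) (*-^ s M q) (*-^ s n q) ⟩
    f * (8 ^ L * n ^ q * (512 * (s ^ q * M ^ q) * X ^ n) + M ^ q * (8 ^ L * (s ^ q * n ^ q) * X ^ n))
      ≡⟨ i₃ f (8 ^ L) (n ^ q) (s ^ q) (M ^ q) (X ^ n) ⟩
    513 * (f * s ^ q * X ^ n) * (M ^ q * n ^ q * 8 ^ L)
      ≤⟨ *-monoˡ-≤ (M ^ q * n ^ q * 8 ^ L) (*-monoˡ-≤ (f * s ^ q * X ^ n) (≤ᵇ⇒≤ 513 1024 _)) ⟩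
    1024 * (f * s ^ q * X ^ n) * (M ^ q * n ^ q * 8 ^ L) ∎)
    where
    A = (s * N) ^ n
    i₁ : ∀ F A x → F * A * x ≡ F * x * A
    i₁ = solve-∀
    i₂ : ∀ f e v p M r A → f * (e * v * p + M * r) * A ≡ f * (e * v * (p * A) + M * (r * A))
    i₂ = solve-∀
    i₃ : ∀ f e v s M X → f * (e * v * (512 * (s * M) * X) + M * (e * (s * v) * X)) ≡ 513 * (f * s * X) * (M * v * e)
    i₃ = solve-∀

  -- Since `m` is of order at least n², (1 + n/(m - n))^n stays bounded. This is the price for
  -- comparing m(m - 1)⋯(m - n + 1) with m^n in the unconditional mean.
  m^n≤ : m ^ n ≤ 8 ^ (8 * D) * (m ∸ n) ^ n
  m^n≤ = begin
    m ^ n             ≡⟨ cong (_^ n) (m∸n+n≡m n≤m) ⟨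
    (m ∸ n + n) ^ n   ≤⟨ exp-bound (m ∸ n) n n (8 * D) n²≤ ⟩
    8 ^ (8 * D) * (m ∸ n) ^ n ∎
    where
    n≤m : n ≤ m
    n≤m = ≤-trans n≤s (m≤m+n s u)
    m≤2[m-n] : m ≤ 2 * (m ∸ n)
    m≤2[m-n] = +-cancelʳ-≤ (2 * n) m (2 * (m ∸ n)) (begin
      m + 2 * n               ≤⟨ +-monoʳ-≤ m (m+n≤o⇒n≤o (2 * u) 2u+2n≤m) ⟩
      m + m                   ≡⟨ cong (m +_) (+-identityʳ m) ⟨
      2 * m                   ≡⟨ cong (2 *_) (m∸n+n≡m n≤m) ⟨
      2 * (m ∸ n + n)         ≡⟨ *-distribˡ-+ 2 (m ∸ n) n ⟩
      2 * (m ∸ n) + 2 * n     ∎)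
    i₁ : ∀ D x → 4 * (D * (2 * x)) ≡ 8 * D * x
    i₁ = solve-∀
    n²≤ : n * n ≤ 8 * D * (m ∸ n)
    n²≤ = begin
      n * n                    ≤⟨ n²≤4N ⟩
      4 * N                    ≤⟨ *-monoʳ-≤ 4 N≤Dm ⟩
      4 * (D * m)              ≤⟨ *-monoʳ-≤ 4 (*-monoʳ-≤ D m≤2[m-n]) ⟩
      4 * (D * (2 * (m ∸ n)))  ≡⟨ i₁ D (m ∸ n) ⟩
      8 * D * (m ∸ n)          ∎

-- Subsets and binomial coefficients

nC0≡1 : ∀ n → n C 0 ≡ 1
nC0≡1 n = trans (nCk≡nC[n∸k] {0} {n} z≤n) (nCn≡1 n)

C-absorption : ∀ n k → suc k * (suc n C suc k) ≡ suc n * (n C k)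
C-absorption n zero = begin-equality
  1 * (suc n C 1)     ≡⟨ *-identityˡ _ ⟩
  suc n C 1           ≡⟨ nC1≡n (suc n) ⟩
  suc n               ≡⟨ *-identityʳ (suc n) ⟨
  suc n * 1           ≡⟨ cong (suc n *_) (nC0≡1 n) ⟨
  suc n * (n C 0)     ∎
C-absorption zero (suc k) = trans (cong (suc (suc k) *_) (k>n⇒nCk≡0 {1} {suc (suc k)} (s≤s (s≤s z≤n))))
  (trans (*-zeroʳ (suc (suc k))) (sym (trans (*-identityˡ _) (k>n⇒nCk≡0 {0} {suc k} (s≤s z≤n)))))
C-absorption (suc n) (suc k) = begin-equality
  suc (suc k) * (suc (suc n) C suc (suc k))    ≡⟨ cong (suc (suc k) *_) (nCk+nC[k+1]≡[n+1]C[k+1] (suc n) (suc k)) ⟨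
  suc (suc k) * (c + d)                        ≡⟨ i₁ (suc k) c d ⟩
  c + (suc k * c + suc (suc k) * d)            ≡⟨ cong (c +_) (cong₂ _+_ (C-absorption n k) (C-absorption n (suc k))) ⟩
  c + (suc n * (n C k) + suc n * (n C suc k))  ≡⟨ cong (c +_) (*-distribˡ-+ (suc n) (n C k) (n C suc k)) ⟨
  c + suc n * (n C k + n C suc k)              ≡⟨ cong (λ z → c + suc n * z) (nCk+nC[k+1]≡[n+1]C[k+1] n k) ⟩
  suc (suc n) * c                              ∎
  where
  c = suc n C suc k
  d = suc n C suc (suc k)
  i₁ : ∀ k c d → suc k * (c + d) ≡ c + (k * c + suc k * d)
  i₁ = solve-∀

∣p∣≡∑ : ∀ {N} (p : Subset N) → ∣ p ∣ ≡ ∑[ e ← allFin N ] ⟦ e ∈? p ⟧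
∣p∣≡∑ [] = refl
∣p∣≡∑ {suc N} (inside ∷ p)  = trans (cong suc (∣p∣≡∑ p)) (sym (∑-allFin λ e → ⟦ e ∈? inside ∷ p ⟧))
∣p∣≡∑ {suc N} (outside ∷ p) = trans (∣p∣≡∑ p) (sym (∑-allFin λ e → ⟦ e ∈? outside ∷ p ⟧))

∣p∪q∣≡∣p∣+∣q─p∣ : ∀ {N} (p q : Subset N) → ∣ p ∪ q ∣ ≡ ∣ p ∣ + ∣ q ─ p ∣
∣p∪q∣≡∣p∣+∣q─p∣ []            []            = refl
∣p∪q∣≡∣p∣+∣q─p∣ (inside  ∷ p) (inside  ∷ q) = cong suc (∣p∪q∣≡∣p∣+∣q─p∣ p q)
∣p∪q∣≡∣p∣+∣q─p∣ (inside  ∷ p) (outside ∷ q) = cong suc (∣p∪q∣≡∣p∣+∣q─p∣ p q)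
∣p∪q∣≡∣p∣+∣q─p∣ (outside ∷ p) (inside  ∷ q) = trans (cong suc (∣p∪q∣≡∣p∣+∣q─p∣ p q)) (sym (+-suc ∣ p ∣ _))
∣p∪q∣≡∣p∣+∣q─p∣ (outside ∷ p) (outside ∷ q) = ∣p∪q∣≡∣p∣+∣q─p∣ p q

∣p∣≡∣p─q∣+∣p∩q∣ : ∀ {N} (p q : Subset N) → ∣ p ∣ ≡ ∣ p ─ q ∣ + ∣ p ∩ q ∣
∣p∣≡∣p─q∣+∣p∩q∣ []            []            = refl
∣p∣≡∣p─q∣+∣p∩q∣ (inside  ∷ p) (inside  ∷ q) = trans (cong suc (∣p∣≡∣p─q∣+∣p∩q∣ p q)) (sym (+-suc ∣ p ─ q ∣ _))
∣p∣≡∣p─q∣+∣p∩q∣ (inside  ∷ p) (outside ∷ q) = cong suc (∣p∣≡∣p─q∣+∣p∩q∣ p q)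
∣p∣≡∣p─q∣+∣p∩q∣ (outside ∷ p) (inside  ∷ q) = ∣p∣≡∣p─q∣+∣p∩q∣ p q
∣p∣≡∣p─q∣+∣p∩q∣ (outside ∷ p) (outside ∷ q) = ∣p∣≡∣p─q∣+∣p∩q∣ p q

p∪q⊆r⁺ : ∀ {N} {p q r : Subset N} → p ⊆ r → q ⊆ r → p ∪ q ⊆ r
p∪q⊆r⁺ p⊆r q⊆r x∈ = [ p⊆r , q⊆r ]′ (x∈p∪q⁻ _ _ x∈)

⟦∪⊆⟧ : ∀ {N} (p q r : Subset N) → ⟦ p ∪ q ⊆? r ⟧ ≡ ⟦ p ⊆? r ⟧ * ⟦ q ⊆? r ⟧
⟦∪⊆⟧ p q r with p ⊆? r | q ⊆? r
... | yes p⊆r | yes q⊆r = ⟦⟧-yes (p ∪ q ⊆? r) (p∪q⊆r⁺ p⊆r q⊆r)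
... | yes _   | no q⊈r  = ⟦⟧-no (p ∪ q ⊆? r) λ ⊆r → q⊈r (⊆-trans (q⊆p∪q p q) ⊆r)
... | no p⊈r  | _       = ⟦⟧-no (p ∪ q ⊆? r) λ ⊆r → p⊈r (⊆-trans (p⊆p∪q q) ⊆r)

∈-subsets : ∀ {N} (p : Subset N) → p ∈ˡ subsets N
∈-subsets []            = here refl
∈-subsets {suc N} (outside ∷ p) = ∈-++⁺ˡ (∈-map⁺ (outside ∷_) (∈-subsets p))
∈-subsets {suc N} (inside ∷ p)  = ∈-++⁺ʳ (map (outside ∷_) (subsets N)) (∈-map⁺ (inside ∷_) (∈-subsets p))

subsets-unique : ∀ N → Uniqueˡ (subsets N)
subsets-unique zero    = [] ∷ []
subsets-unique (suc N) = ++⁺ (map⁺ ∷-injectiveʳ (subsets-unique N)) (map⁺ ∷-injectiveʳ (subsets-unique N)) disjoint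
  where
  disjoint : ∀ {p} → ¬ (p ∈ˡ map (outside ∷_) (subsets N) × p ∈ˡ map (inside ∷_) (subsets N))
  disjoint (p∈out , p∈in) with ∈-map⁻ (outside ∷_) p∈out | ∈-map⁻ (inside ∷_) p∈in
  ... | _ , _ , refl | _ , _ , ()

-- With the size written as `∣ V ∣ + j`, induction on the ground set becomes Pascal's rule at each
-- coordinate outside `V` and leaves `j` unchanged at each coordinate inside.
supersets : ∀ {N} (V : Subset N) j →
  ∑[ G ← subsets N ] (⟦ ∣ G ∣ ≟ ∣ V ∣ + j ⟧ * ⟦ V ⊆? G ⟧) ≡ (N ∸ ∣ V ∣) C j
supersets [] zero    = refl
supersets [] (suc j) = sym (k>n⇒nCk≡0 {0} {suc j} (s≤s z≤n))
supersets {suc N} (inside ∷ V) j = begin-equality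
  ∑ (subsets (suc N)) f    ≡⟨ ∑-++ (map (outside ∷_) (subsets N)) _ ⟩
  ∑ (map (outside ∷_) (subsets N)) f + ∑ (map (inside ∷_) (subsets N)) f
    ≡⟨ cong₂ _+_ (∑-map (outside ∷_) (subsets N)) (∑-map (inside ∷_) (subsets N)) ⟩
  ∑ (subsets N) (f ∘ (outside ∷_)) + ∑ (subsets N) (f ∘ (inside ∷_))
    ≡⟨ cong₂ _+_ (trans (∑-cong (subsets N) out) (∑-zero (subsets N))) refl ⟩
  ∑[ G ← subsets N ] (⟦ ∣ G ∣ ≟ ∣ V ∣ + j ⟧ * ⟦ V ⊆? G ⟧) ≡⟨ supersets V j ⟩
  (N ∸ ∣ V ∣) C j          ∎
  where
  f : Subset (suc N) → ℕ
  f G = ⟦ ∣ G ∣ ≟ suc ∣ V ∣ + j ⟧ * ⟦ inside ∷ V ⊆? G ⟧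
  out : ∀ G → f (outside ∷ G) ≡ 0
  out G = *-zeroʳ ⟦ ∣ G ∣ ≟ suc ∣ V ∣ + j ⟧
supersets {suc N} (outside ∷ V) j = begin-equality
  ∑ (subsets (suc N)) (f j)    ≡⟨ ∑-++ (map (outside ∷_) (subsets N)) _ ⟩
  ∑ (map (outside ∷_) (subsets N)) (f j) + ∑ (map (inside ∷_) (subsets N)) (f j)
    ≡⟨ cong₂ _+_ (∑-map (outside ∷_) (subsets N)) (∑-map (inside ∷_) (subsets N)) ⟩
  ∑ (subsets N) (f j ∘ (outside ∷_)) + ∑ (subsets N) (f j ∘ (inside ∷_))
    ≡⟨ cong₂ _+_ (supersets V j) refl ⟩
  (N ∸ ∣ V ∣) C j + ∑ (subsets N) (f j ∘ (inside ∷_)) ≡⟨ rest j ⟩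
  suc (N ∸ ∣ V ∣) C j          ≡⟨ cong (_C j) (+-∸-assoc 1 (∣p∣≤n V)) ⟨
  (suc N ∸ ∣ V ∣) C j          ∎
  where
  f : ℕ → Subset (suc N) → ℕ
  f j G = ⟦ ∣ G ∣ ≟ ∣ V ∣ + j ⟧ * ⟦ outside ∷ V ⊆? G ⟧
  in-zero : ∀ G → f 0 (inside ∷ G) ≡ 0
  in-zero G with V ⊆? G
  ... | yes V⊆G = cong (_* _) (⟦⟧-no (suc ∣ G ∣ ≟ ∣ V ∣ + 0) λ eq → <⇒≱ (≤-reflexive (trans eq (+-identityʳ ∣ V ∣))) (p⊆q⇒∣p∣≤∣q∣ V⊆G))
  ... | no  _   = *-zeroʳ ⟦ suc ∣ G ∣ ≟ ∣ V ∣ + 0 ⟧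
  in-suc : ∀ j G → f (suc j) (inside ∷ G) ≡ ⟦ ∣ G ∣ ≟ ∣ V ∣ + j ⟧ * ⟦ V ⊆? G ⟧
  in-suc j G = cong (λ z → ⟦ suc ∣ G ∣ ≟ z ⟧ * ⟦ V ⊆? G ⟧) (+-suc ∣ V ∣ j)
  rest : ∀ j → (N ∸ ∣ V ∣) C j + ∑ (subsets N) (f j ∘ (inside ∷_)) ≡ suc (N ∸ ∣ V ∣) C j
  rest zero    = trans (cong₂ _+_ (nC0≡1 (N ∸ ∣ V ∣)) (trans (∑-cong (subsets N) in-zero) (∑-zero (subsets N)))) (sym (nC0≡1 (suc (N ∸ ∣ V ∣))))
  rest (suc j) = trans (cong ((N ∸ ∣ V ∣) C suc j +_) (trans (∑-cong (subsets N) (in-suc j)) (supersets V j)))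
    (trans (+-comm ((N ∸ ∣ V ∣) C suc j) _) (nCk+nC[k+1]≡[n+1]C[k+1] (N ∸ ∣ V ∣) j))

-- Paths through prescribed arcs

module _ {n : ℕ} where
  open DecMembership (Finₚ._≟_ {n}) using () renaming (_∈?_ to _∈ˡ?_)

  vecs : ∀ k → List (Vec (Fin n) k)
  vecs zero    = [] ∷ []
  vecs (suc k) = cartesianProductWith _∷_ (allFin n) (vecs k)

  ∈-vecs : ∀ {k} (τ : Vec (Fin n) k) → τ ∈ˡ vecs k
  ∈-vecs []      = here refl
  ∈-vecs (y ∷ τ) = ∈-cartesianProductWith⁺ _∷_ (∈-allFin y) (∈-vecs τ)

  vecs-unique : ∀ k → Uniqueˡ (vecs k)
  vecs-unique zero    = [] ∷ []
  vecs-unique (suc k) = cartesianProductWith⁺ _∷_ ∷-injective (allFin⁺ n) (vecs-unique k)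

  ∑-vecs : ∀ {k} (f : Vec (Fin n) (suc k) → ℕ) →
           ∑ (vecs (suc k)) f ≡ ∑[ y ← allFin n ] ∑[ τ ← vecs k ] f (y ∷ τ)
  ∑-vecs {k} f = go (allFin n)
    where
    go : ∀ ys → ∑ (cartesianProductWith _∷_ ys (vecs k)) f ≡ ∑[ y ← ys ] ∑[ τ ← vecs k ] f (y ∷ τ)
    go []       = refl
    go (y ∷ ys) = trans (∑-++ (map (y ∷_) (vecs k)) _) (cong₂ _+_ (∑-map (y ∷_) (vecs k)) (go ys))

  ∑-≟ : ∀ t → ∑[ y ← allFin n ] ⟦ y Finₚ.≟ t ⟧ ≡ 1
  ∑-≟ t = ∑-unique≡1 (Finₚ._≟ t) (allFin⁺ n) (λ x≡t y≡t → trans x≡t (sym y≡t)) (∈-allFin t) refl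

  ∑-1 : ∑[ y ← allFin n ] 1 ≡ n
  ∑-1 = trans (∑-const 1 (allFin n)) (trans (*-identityʳ _) (length-tabulate id))

  occurrences : Fin n → List (Fin n) → ℕ
  occurrences y ts = ∑[ t ← ts ] ⟦ y Finₚ.≟ t ⟧

  ∑-occurrences : ∀ ts → ∑[ y ← allFin n ] occurrences y ts ≡ length ts
  ∑-occurrences ts = begin-equality
    ∑[ y ← allFin n ] occurrences y ts                ≡⟨ ∑-swap (allFin n) ts ⟩
    ∑[ t ← ts ] ∑[ y ← allFin n ] ⟦ y Finₚ.≟ t ⟧      ≡⟨ ∑-cong ts ∑-≟ ⟩
    ∑[ t ← ts ] 1                                     ≡⟨ trans (∑-const 1 ts) (*-identityʳ _) ⟩
    length ts                                         ∎

  -- Distinctness relative to the vertices already visited. Being read from front to back, it lets a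
  -- sum over `vecs` be peeled off one vertex at a time.
  Fresh : ∀ {k} → List (Fin n) → Vec (Fin n) k → Set
  Fresh seen []      = ⊤
  Fresh seen (y ∷ τ) = y ∉ˡ seen × Fresh (y ∷ seen) τ

  fresh? : ∀ {k} seen (τ : Vec (Fin n) k) → Dec (Fresh seen τ)
  fresh? seen []      = yes tt
  fresh? seen (y ∷ τ) = ¬? (y ∈ˡ? seen) ×-dec fresh? (y ∷ seen) τ

  fresh⇒unique : ∀ {k} seen (τ : Vec (Fin n) k) → Fresh seen τ → Allᵛ.All (_∉ˡ seen) τ × Unique τ
  fresh⇒unique seen []      _           = Allᵛ.[] , []
  fresh⇒unique seen (y ∷ τ) (y∉ , rest) with fresh⇒unique (y ∷ seen) τ rest
  ... | τ∉ , uniq = y∉ Allᵛ.∷ Allᵛ.map (_∘ there) τ∉ , Allᵛ.map (λ x∉ y≡x → x∉ (here (sym y≡x))) τ∉ ∷ uniq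

  unique⇒fresh : ∀ {k} seen (τ : Vec (Fin n) k) → Allᵛ.All (_∉ˡ seen) τ → Unique τ → Fresh seen τ
  unique⇒fresh seen []      _            _           = tt
  unique⇒fresh seen (y ∷ τ) (y∉ Allᵛ.∷ τ∉) (y≢ ∷ uniq) =
    y∉ , unique⇒fresh (y ∷ seen) τ
      (Allᵛ.map (λ { (y≢x , x∉) (here x≡y) → y≢x (sym x≡y) ; (y≢x , x∉) (there x∈) → x∉ x∈ }) (Allᵛ.zip (y≢ , τ∉))) uniq

  fresh⇒unique-∷ : ∀ {k} v (τ : Vec (Fin n) k) → Fresh (v ∷ []) τ → Unique (v ∷ τ)
  fresh⇒unique-∷ v τ fresh with fresh⇒unique (v ∷ []) τ fresh
  ... | τ∉ , uniq = Allᵛ.map (λ x∉ v≡x → x∉ (here (sym v≡x))) τ∉ ∷ uniq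

  unique-∷⇒fresh : ∀ {k} v (τ : Vec (Fin n) k) → Unique (v ∷ τ) → Fresh (v ∷ []) τ
  unique-∷⇒fresh v τ (v≢ ∷ uniq) = unique⇒fresh (v ∷ []) τ (Allᵛ.map (λ { v≢x (here x≡v) → v≢x (sym x≡v) }) v≢) uniq

  -- Every vertex is unseen or occurs in `seen`, so at least `n` minus the length of `seen` vertices
  -- are free for the next position.
  ∑-fresh-≥ : ∀ k seen → length seen + k ≤ n → k ! ≤ ∑[ τ ← vecs k ] ⟦ fresh? seen τ ⟧
  ∑-fresh-≥ zero    seen _ = ≤-refl
  ∑-fresh-≥ (suc k) seen |seen|+k≤n = begin
    suc k * k !                                        ≤⟨ *-monoˡ-≤ (k !) choices ⟩
    ∑[ y ← allFin n ] ⟦ ¬? (y ∈ˡ? seen) ⟧ * k !         ≡⟨ ∑-*ʳ (k !) (allFin n) ⟨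
    ∑[ y ← allFin n ] (⟦ ¬? (y ∈ˡ? seen) ⟧ * k !)
      ≤⟨ ∑-mono (allFin n) (λ y → *-monoʳ-≤ ⟦ ¬? (y ∈ˡ? seen) ⟧ (∑-fresh-≥ k (y ∷ seen) (≤-trans (≤-reflexive (sym (+-suc (length seen) k))) |seen|+k≤n))) ⟩
    ∑[ y ← allFin n ] (⟦ ¬? (y ∈ˡ? seen) ⟧ * ∑[ τ ← vecs k ] ⟦ fresh? (y ∷ seen) τ ⟧)
      ≡⟨ ∑-cong (allFin n) (λ y → trans (sym (∑-*ˡ ⟦ ¬? (y ∈ˡ? seen) ⟧ (vecs k))) (∑-cong (vecs k) λ τ → sym (⟦⟧-× (¬? (y ∈ˡ? seen)) (fresh? (y ∷ seen) τ)))) ⟩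
    ∑[ y ← allFin n ] ∑[ τ ← vecs k ] ⟦ fresh? seen (y ∷ τ) ⟧
      ≡⟨ ∑-vecs (λ τ → ⟦ fresh? seen τ ⟧) ⟨
    ∑[ τ ← vecs (suc k) ] ⟦ fresh? seen τ ⟧             ∎
    where
    covered : ∀ y → 1 ≤ ⟦ ¬? (y ∈ˡ? seen) ⟧ + occurrences y seen
    covered y with y ∈ˡ? seen
    ... | yes y∈ = ≤-trans (≤-reflexive (sym (⟦⟧-yes (y Finₚ.≟ y) refl))) (∑-member y∈)
    ... | no _   = s≤s z≤n
    choices : suc k ≤ ∑[ y ← allFin n ] ⟦ ¬? (y ∈ˡ? seen) ⟧
    choices = +-cancelʳ-≤ (length seen) (suc k) _ (begin
      suc k + length seen                                     ≡⟨ +-comm (suc k) (length seen) ⟩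
      length seen + suc k                                     ≤⟨ |seen|+k≤n ⟩
      n                                                       ≡⟨ ∑-1 ⟨
      ∑[ y ← allFin n ] 1                                     ≤⟨ ∑-mono (allFin n) covered ⟩
      ∑[ y ← allFin n ] (⟦ ¬? (y ∈ˡ? seen) ⟧ + occurrences y seen) ≡⟨ trans (∑-+ (allFin n)) (cong (∑[ y ← allFin n ] ⟦ ¬? (y ∈ˡ? seen) ⟧ +_) (∑-occurrences seen)) ⟩
      ∑[ y ← allFin n ] ⟦ ¬? (y ∈ˡ? seen) ⟧ + length seen     ∎)

  Arc : Set
  Arc = Fin n × Fin n

  infix 4 _onPath_ _onPath?_

  _onPath_ : ∀ {k} → Arc → Vec (Fin n) (suc k) → Set
  _onPath_ {k} (x , t) σ = ∃[ i ] (lookup σ (inject₁ i) ≡ x × lookup σ (suc i) ≡ t)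

  _onPath?_ : ∀ {k} e (σ : Vec (Fin n) (suc k)) → Dec (e onPath σ)
  (x , t) onPath? σ = Finₚ.any? λ i → (lookup σ (inject₁ i) Finₚ.≟ x) ×-dec (lookup σ (suc i) Finₚ.≟ t)

  module _ (O : List Arc) where

    -- The local trace of a path without repetitions that contains every arc of `O`: a step leaves
    -- the source of an arc exactly when it enters its target. Unlike `_onPath_` this can be tested
    -- along the path, step by step.
    Link : Fin n → Fin n → Set
    Link l y = All (λ (x , t) → (l ≡ x → y ≡ t) × (y ≡ t → l ≡ x)) O

    link? : ∀ l y → Dec (Link l y)
    link? l y = All.all? (λ (x , t) → ((l Finₚ.≟ x) →-dec (y Finₚ.≟ t)) ×-dec ((y Finₚ.≟ t) →-dec (l Finₚ.≟ x))) O

    Chain : ∀ {k} → Fin n → Vec (Fin n) k → Set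
    Chain l []      = ⊤
    Chain l (y ∷ τ) = Link l y × Chain y τ

    chain? : ∀ {k} l (τ : Vec (Fin n) k) → Dec (Chain l τ)
    chain? l []      = yes tt
    chain? l (y ∷ τ) = link? l y ×-dec chain? y τ

    links⇒chain : ∀ {k} l (τ : Vec (Fin n) k) →
      (∀ i → Link (lookup (l ∷ τ) (inject₁ i)) (lookup (l ∷ τ) (suc i))) → Chain l τ
    links⇒chain l []      links = tt
    links⇒chain l (y ∷ τ) links = links zero , links⇒chain y τ (links ∘ suc)

    arcs⇒chain : ∀ {k} l (τ : Vec (Fin n) k) → Unique (l ∷ τ) → All (_onPath (l ∷ τ)) O → Chain l τ
    arcs⇒chain l τ uniq arcs = links⇒chain l τ λ i → All.map (λ (j , at-x , at-t) →
      (λ at-x′ → trans (cong (lookup τ) (Finₚ.inject₁-injective (lookup-injective uniq (inject₁ i) (inject₁ j) (trans at-x′ (sym at-x))))) at-t) ,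
      (λ at-t′ → trans (cong (lookup (l ∷ τ) ∘ inject₁) (Finₚ.suc-injective (lookup-injective uniq (suc i) (suc j) (trans at-t′ (sym at-t))))) at-x)) arcs

    targets : List (Fin n)
    targets = map proj₂ O

    -- A path through all of `O` is a sequence of blocks held together by these arcs. The vertices
    -- outside `targets` are the possible first vertices of blocks, and `heads` counts the unvisited
    -- ones.
    head? : ∀ seen y → Dec (y ∉ˡ seen × y ∉ˡ targets)
    head? seen y = ¬? (y ∈ˡ? seen) ×-dec ¬? (y ∈ˡ? targets)

    heads : List (Fin n) → ℕ
    heads seen = ∑[ y ← allFin n ] ⟦ head? seen y ⟧

    heads-∷ : ∀ y seen → heads (y ∷ seen) ≤ heads seen
    heads-∷ y seen = ∑-mono (allFin n) λ z → ⟦⟧-mono (head? (y ∷ seen) z) (head? seen z)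
      λ (z∉ , z∉targets) → z∉ ∘ there , z∉targets

    heads-head : ∀ y seen → y ∉ˡ seen × y ∉ˡ targets → suc (heads (y ∷ seen)) ≤ heads seen
    heads-head y seen y-head = begin
      1 + heads (y ∷ seen)                                      ≡⟨ cong (_+ heads (y ∷ seen)) (∑-≟ y) ⟨
      ∑[ z ← allFin n ] ⟦ z Finₚ.≟ y ⟧ + heads (y ∷ seen)        ≡⟨ ∑-+ (allFin n) ⟨
      ∑[ z ← allFin n ] (⟦ z Finₚ.≟ y ⟧ + ⟦ head? (y ∷ seen) z ⟧) ≤⟨ ∑-mono (allFin n) split ⟩
      heads seen                                                ∎
      where
      split : ∀ z → ⟦ z Finₚ.≟ y ⟧ + ⟦ head? (y ∷ seen) z ⟧ ≤ ⟦ head? seen z ⟧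
      split z with z Finₚ.≟ y
      ... | yes refl = ≤-reflexive (sym (⟦⟧-yes (head? seen y) y-head))
      ... | no _     = ≤-refl

    -- A vertex that is the source of an arc of O leaves no choice for its successor;
    -- otherwise the successor must be a fresh vertex which is not a target.
    chains-≤ : ∀ k seen l → ∑[ τ ← vecs k ] (⟦ fresh? seen τ ⟧ * ⟦ chain? l τ ⟧) ≤ heads seen !
    chains-≤ zero    seen l = n!≥1 (heads seen)
      where
      n!≥1 : ∀ m → 1 ≤ m !
      n!≥1 m = >-nonZero⁻¹ (m !) {{m !≢0}}
    chains-≤ (suc k) seen l = begin
      ∑[ τ ← vecs (suc k) ] (⟦ fresh? seen τ ⟧ * ⟦ chain? l τ ⟧)
        ≡⟨ ∑-vecs (λ τ → ⟦ fresh? seen τ ⟧ * ⟦ chain? l τ ⟧) ⟩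
      ∑[ y ← allFin n ] ∑[ τ ← vecs k ] (⟦ fresh? seen (y ∷ τ) ⟧ * ⟦ chain? l (y ∷ τ) ⟧)
        ≡⟨ ∑-cong (allFin n) (λ y → trans (∑-cong (vecs k) (factor y)) (∑-*ˡ (⟦ ¬? (y ∈ˡ? seen) ⟧ * ⟦ link? l y ⟧) (vecs k))) ⟩
      ∑[ y ← allFin n ] (⟦ ¬? (y ∈ˡ? seen) ⟧ * ⟦ link? l y ⟧ * ∑[ τ ← vecs k ] (⟦ fresh? (y ∷ seen) τ ⟧ * ⟦ chain? y τ ⟧))
        ≤⟨ ∑-mono (allFin n) (λ y → *-monoʳ-≤ (⟦ ¬? (y ∈ˡ? seen) ⟧ * ⟦ link? l y ⟧) (chains-≤ k (y ∷ seen) y)) ⟩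
      ∑[ y ← allFin n ] (⟦ ¬? (y ∈ˡ? seen) ⟧ * ⟦ link? l y ⟧ * heads (y ∷ seen) !)
        ≤⟨ next-vertex (l ∈ˡ? map proj₁ O) ⟩
      heads seen ! ∎
      where
      !-mono-≤ : ∀ {a b} → a ≤ b → a ! ≤ b !
      !-mono-≤ {b = b} a≤b = ∣⇒≤ {{b !≢0}} (m≤n⇒m!∣n! a≤b)
      factor : ∀ y τ → ⟦ fresh? seen (y ∷ τ) ⟧ * ⟦ chain? l (y ∷ τ) ⟧ ≡
        ⟦ ¬? (y ∈ˡ? seen) ⟧ * ⟦ link? l y ⟧ * (⟦ fresh? (y ∷ seen) τ ⟧ * ⟦ chain? y τ ⟧)
      factor y τ = trans (cong₂ _*_ (⟦⟧-× (¬? (y ∈ˡ? seen)) (fresh? (y ∷ seen) τ)) (⟦⟧-× (link? l y) (chain? y τ)))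
        (identity ⟦ ¬? (y ∈ˡ? seen) ⟧ ⟦ fresh? (y ∷ seen) τ ⟧ ⟦ link? l y ⟧ ⟦ chain? y τ ⟧)
        where
        identity : ∀ a b c d → a * b * (c * d) ≡ a * c * (b * d)
        identity = solve-∀
      next-vertex : Dec (l ∈ˡ map proj₁ O) →
        ∑[ y ← allFin n ] (⟦ ¬? (y ∈ˡ? seen) ⟧ * ⟦ link? l y ⟧ * heads (y ∷ seen) !) ≤ heads seen !
      next-vertex (yes l∈) with ∈-map⁻ proj₁ l∈
      ... | (_ , t) , e∈O , refl = begin
        ∑[ y ← allFin n ] (⟦ ¬? (y ∈ˡ? seen) ⟧ * ⟦ link? l y ⟧ * heads (y ∷ seen) !)
          ≤⟨ ∑-mono (allFin n) (λ y → *-mono-≤ (≤-trans (*-monoˡ-≤ ⟦ link? l y ⟧ (⟦⟧≤1 (¬? (y ∈ˡ? seen)))) (≤-trans (≤-reflexive (+-identityʳ ⟦ link? l y ⟧))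
               (⟦⟧-mono (link? l y) (y Finₚ.≟ t) λ link → proj₁ (All.lookup link e∈O) refl))) (!-mono-≤ (heads-∷ y seen))) ⟩
        ∑[ y ← allFin n ] (⟦ y Finₚ.≟ t ⟧ * heads seen !)   ≡⟨ ∑-*ʳ (heads seen !) (allFin n) ⟩
        ∑[ y ← allFin n ] ⟦ y Finₚ.≟ t ⟧ * heads seen !     ≡⟨ cong (_* heads seen !) (∑-≟ t) ⟩
        1 * heads seen !                                    ≡⟨ *-identityˡ _ ⟩
        heads seen !                                        ∎
      next-vertex (no l∉) = begin
        ∑[ y ← allFin n ] (⟦ ¬? (y ∈ˡ? seen) ⟧ * ⟦ link? l y ⟧ * heads (y ∷ seen) !)
          ≤⟨ ∑-mono (allFin n) term ⟩
        ∑[ y ← allFin n ] (⟦ head? seen y ⟧ * pred (heads seen) !) ≡⟨ ∑-*ʳ (pred (heads seen) !) (allFin n) ⟩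
        heads seen * pred (heads seen) !                           ≤⟨ m*pred! (heads seen) ⟩
        heads seen !                                               ∎
        where
        -- Without heads the left side is 0, so the value of `pred` at 0 does not matter.
        m*pred! : ∀ m → m * pred m ! ≤ m !
        m*pred! zero    = z≤n
        m*pred! (suc m) = ≤-refl
        target-free : ∀ {y} → Link l y → y ∉ˡ targets
        target-free link y∈ with ∈-map⁻ proj₂ y∈
        ... | (x , _) , e∈O , refl = l∉ (subst (_∈ˡ map proj₁ O) (sym (proj₂ (All.lookup link e∈O) refl)) (∈-map⁺ proj₁ e∈O))
        term : ∀ y → ⟦ ¬? (y ∈ˡ? seen) ⟧ * ⟦ link? l y ⟧ * heads (y ∷ seen) ! ≤ ⟦ head? seen y ⟧ * pred (heads seen) !
        term y with y ∈ˡ? seen | link? l y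
        ... | yes _ | _        = z≤n
        ... | no _  | no _     = z≤n
        ... | no y∉ | yes link = begin
          1 * heads (y ∷ seen) !                                ≤⟨ *-monoʳ-≤ 1 (!-mono-≤ (pred-mono-≤ (heads-head y seen (y∉ , target-free link)))) ⟩
          1 * pred (heads seen) !                               ≡⟨ cong (_* pred (heads seen) !) (⟦⟧-yes (¬? (y ∈ˡ? targets)) (target-free link)) ⟨
          ⟦ ¬? (y ∈ˡ? targets) ⟧ * pred (heads seen) !          ∎

    -- On a path without repetitions a vertex has at most one predecessor and the first vertex has
    -- none.
    targets-unique : ∀ {k} (σ : Vec (Fin n) (suc k)) → Unique σ → Uniqueˡ O → All (_onPath σ) O →
                     Uniqueˡ (head σ ∷ targets)
    targets-unique (v ∷ τ) uniq uniqO arcs = All-map⁺ (All.map not-start arcs) ∷ distinct O uniqO arcs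
      where
      not-start : ∀ {e} → e onPath (v ∷ τ) → v ≢ proj₂ e
      not-start (i , _ , at-t) v≡t with lookup-injective uniq zero (suc i) (trans v≡t (sym at-t))
      ... | ()
      distinct : ∀ O → Uniqueˡ O → All (_onPath (v ∷ τ)) O → Uniqueˡ (map proj₂ O)
      distinct []      _              _                            = []
      distinct (e ∷ O) (e≢ ∷ uniqO) ((i , at-x , at-t) ∷ arcs) =
        All-map⁺ (All.zipWith (λ { (e≢e′ , j , at-x′ , at-t′) t≡t′ → e≢e′ (cong₂ _,_
          (trans (sym at-x) (trans (cong (lookup (v ∷ τ) ∘ inject₁) (Finₚ.suc-injective (lookup-injective uniq (suc i) (suc j) (trans at-t (trans t≡t′ (sym at-t′)))))) at-x′)) t≡t′) })
          (e≢ , arcs)) ∷ distinct O uniqO arcs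

    -- No vertex is two of the following: the start, the target of an arc, a head. With `a` arcs
    -- this leaves at most n - 1 - a heads, whence the factorial (n - 1 - a)!.
    heads-count : ∀ v → Uniqueˡ (v ∷ targets) → suc (length O) + heads (v ∷ []) ≤ n
    heads-count v uniq = begin
      suc (length O) + heads (v ∷ [])             ≡⟨ cong (λ z → suc z + heads (v ∷ [])) (length-map proj₂ O) ⟨
      length (v ∷ targets) + heads (v ∷ [])       ≡⟨ cong (_+ heads (v ∷ [])) (∑-occurrences (v ∷ targets)) ⟨
      ∑[ y ← allFin n ] occurrences y (v ∷ targets) + heads (v ∷ [])  ≡⟨ ∑-+ (allFin n) ⟨
      ∑[ y ← allFin n ] (occurrences y (v ∷ targets) + ⟦ head? (v ∷ []) y ⟧)  ≤⟨ ∑-mono (allFin n) once ⟩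
      ∑[ y ← allFin n ] 1                         ≡⟨ ∑-1 ⟩
      n                                           ∎
      where
      once : ∀ y → occurrences y (v ∷ targets) + ⟦ head? (v ∷ []) y ⟧ ≤ 1
      once y with y ∈ˡ? (v ∷ targets)
      ... | yes y∈ = begin
        occurrences y (v ∷ targets) + ⟦ head? (v ∷ []) y ⟧ ≡⟨ cong (occurrences y (v ∷ targets) +_) (⟦⟧-no (head? (v ∷ []) y) (not-head y∈)) ⟩
        occurrences y (v ∷ targets) + 0                   ≡⟨ +-identityʳ _ ⟩
        occurrences y (v ∷ targets)                       ≤⟨ ∑-unique≤1 (y Finₚ.≟_) uniq (λ y≡a y≡b → trans (sym y≡a) y≡b) ⟩
        1                                                 ∎
        where
        not-head : ∀ {y} → y ∈ˡ v ∷ targets → ¬ (y ∉ˡ (v ∷ []) × y ∉ˡ targets)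
        not-head (here y≡v) (y∉ , _) = y∉ (here y≡v)
        not-head (there y∈) (_ , y∉) = y∉ y∈
      ... | no y∉ = begin
        occurrences y (v ∷ targets) + ⟦ head? (v ∷ []) y ⟧ ≡⟨ cong (_+ ⟦ head? (v ∷ []) y ⟧) (∑-none (y Finₚ.≟_) (¬Any⇒All¬ (v ∷ targets) y∉)) ⟩
        ⟦ head? (v ∷ []) y ⟧                               ≤⟨ ⟦⟧≤1 (head? (v ∷ []) y) ⟩
        1                                                 ∎

module _ {l : ℕ} (v : Fin (suc l)) where

  paths : (Vec (Fin (suc l)) l → ℕ) → ℕ
  paths f = ∑[ τ ← vecs l ] (⟦ fresh? (v ∷ []) τ ⟧ * f τ)

  paths-cong : ∀ {f g} → (∀ τ → f τ ≡ g τ) → paths f ≡ paths g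
  paths-cong f≡g = ∑-cong (vecs l) λ τ → cong (⟦ fresh? (v ∷ []) τ ⟧ *_) (f≡g τ)

  arcs? : ∀ O (τ : Vec (Fin (suc l)) l) → Dec (All (_onPath (v ∷ τ)) O)
  arcs? O τ = All.all? (_onPath? (v ∷ τ)) O

  paths-through : List Arc → ℕ
  paths-through O = paths λ τ → ⟦ arcs? O τ ⟧

  -- A single path through `O` forces the targets to be distinct and different from `v`, which
  -- bounds the number of heads. An `O` that lies on no path may violate this, but then its count is
  -- 0.
  paths-through-≤ : ∀ O → Uniqueˡ O → paths-through O ≢ 0 →
                    length O ≤ l × paths-through O ≤ (l ∸ length O) !
  paths-through-≤ O uniqO ≢0 with ∑-nonzero (vecs l) ≢0
  ... | τ , term≢0 = length≤l , (begin
      paths-through O                                                   ≤⟨ ∑-mono (vecs l) chain ⟩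
      ∑[ τ ← vecs l ] (⟦ fresh? (v ∷ []) τ ⟧ * ⟦ chain? O v τ ⟧)         ≤⟨ chains-≤ O l (v ∷ []) v ⟩
      heads O (v ∷ []) !                                                ≤⟨ ∣⇒≤ {{(l ∸ length O) !≢0}} (m≤n⇒m!∣n! heads≤) ⟩
      (l ∸ length O) !                                                  ∎)
    where
    fresh : Fresh (v ∷ []) τ
    fresh = ⟦⟧-holds (fresh? (v ∷ []) τ) λ eq → term≢0 (cong (_* ⟦ arcs? O τ ⟧) eq)
    arcs : All (_onPath (v ∷ τ)) O
    arcs = ⟦⟧-holds (arcs? O τ) λ eq → term≢0 (trans (cong (⟦ fresh? (v ∷ []) τ ⟧ *_) eq) (*-zeroʳ ⟦ fresh? (v ∷ []) τ ⟧))
    count : length O + heads O (v ∷ []) ≤ l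
    count = s≤s⁻¹ (heads-count O v (targets-unique O (v ∷ τ) (fresh⇒unique-∷ v τ fresh) uniqO arcs))
    length≤l : length O ≤ l
    length≤l = m+n≤o⇒m≤o (length O) count
    heads≤ : heads O (v ∷ []) ≤ l ∸ length O
    heads≤ = m+n≤o⇒m≤o∸n (heads O (v ∷ [])) (≤-trans (≤-reflexive (+-comm (heads O (v ∷ [])) (length O))) count)
    chain : ∀ τ → ⟦ fresh? (v ∷ []) τ ⟧ * ⟦ arcs? O τ ⟧ ≤ ⟦ fresh? (v ∷ []) τ ⟧ * ⟦ chain? O v τ ⟧
    chain τ with fresh? (v ∷ []) τ
    ... | no _      = z≤n
    ... | yes fresh = *-monoʳ-≤ 1 (⟦⟧-mono (arcs? O τ) (chain? O v τ) (arcs⇒chain O v τ (fresh⇒unique-∷ v τ fresh)))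

  module _ (s w : ℕ) where

    -- With t arcs of `W` on the path this is s^∣W∣ (1 + w/s)^t, written without division.
    weight : List Arc → Vec (Fin (suc l)) l → ℕ
    weight []      τ = 1
    weight (e ∷ W) τ = (s + w * ⟦ e onPath? (v ∷ τ) ⟧) * weight W τ

    weighted : List Arc → List Arc → ℕ
    weighted O W = paths λ τ → ⟦ arcs? O τ ⟧ * weight W τ

    -- The expansion over sets of arcs, one factor at a time: either `s` is taken, or `w` is taken
    -- and `e` joins the prescribed arcs.
    weighted-∷ : ∀ O e W → weighted O (e ∷ W) ≡ s * weighted O W + w * weighted (e ∷ O) W
    weighted-∷ O e W = begin-equality
      weighted O (e ∷ W)
        ≡⟨ ∑-cong (vecs l) expand ⟩
      ∑[ τ ← vecs l ] (s * (⟦ fresh? (v ∷ []) τ ⟧ * (⟦ arcs? O τ ⟧ * weight W τ)) + w * (⟦ fresh? (v ∷ []) τ ⟧ * (⟦ arcs? (e ∷ O) τ ⟧ * weight W τ)))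
        ≡⟨ ∑-+ (vecs l) ⟩
      ∑[ τ ← vecs l ] (s * (⟦ fresh? (v ∷ []) τ ⟧ * (⟦ arcs? O τ ⟧ * weight W τ))) + ∑[ τ ← vecs l ] (w * (⟦ fresh? (v ∷ []) τ ⟧ * (⟦ arcs? (e ∷ O) τ ⟧ * weight W τ)))
        ≡⟨ cong₂ _+_ (∑-*ˡ s (vecs l)) (∑-*ˡ w (vecs l)) ⟩
      s * weighted O W + w * weighted (e ∷ O) W ∎
      where
      identity : ∀ f a x s w t → f * (a * ((s + w * x) * t)) ≡ s * (f * (a * t)) + w * (f * (x * a * t))
      identity = solve-∀
      expand : ∀ τ → ⟦ fresh? (v ∷ []) τ ⟧ * (⟦ arcs? O τ ⟧ * weight (e ∷ W) τ) ≡
        s * (⟦ fresh? (v ∷ []) τ ⟧ * (⟦ arcs? O τ ⟧ * weight W τ)) + w * (⟦ fresh? (v ∷ []) τ ⟧ * (⟦ arcs? (e ∷ O) τ ⟧ * weight W τ))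
      expand τ = trans (identity ⟦ fresh? (v ∷ []) τ ⟧ ⟦ arcs? O τ ⟧ ⟦ e onPath? (v ∷ τ) ⟧ s w (weight W τ))
        (cong (λ z → s * (⟦ fresh? (v ∷ []) τ ⟧ * (⟦ arcs? O τ ⟧ * weight W τ)) + w * (⟦ fresh? (v ∷ []) τ ⟧ * (z * weight W τ)))
          (sym (⟦⟧-× (e onPath? (v ∷ τ)) (arcs? O τ))))

    module _ (M L : ℕ) (M+L≡n : M + L ≡ suc l) where

      -- (l ∸ a)! / l! is at most 1/M^a for a ≤ L, and at most (64/(l + 1))^a / 8^L for a > L.
      weighted-base : ∀ O → Uniqueˡ O → let a = length O in
        paths-through O * (M ^ a * suc l ^ a * 8 ^ L) ≤ l ! * (8 ^ L * suc l ^ a + M ^ a * 64 ^ a)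
      weighted-base O uniqO with paths-through O ≟ 0
      ... | yes ≡0 = ≤-trans (≤-reflexive (cong (_* (M ^ length O * suc l ^ length O * 8 ^ L)) ≡0)) z≤n
      ... | no ≢0 = cases (≤-total a L)
        where
        a = length O
        a≤l = proj₁ (paths-through-≤ O uniqO ≢0)
        bound = proj₂ (paths-through-≤ O uniqO ≢0)
        i₁ : ∀ f x y z → f * (x * y * z) ≡ x * f * (z * y)
        i₁ = solve-∀
        i₂ : ∀ f x y z → f * (x * y * z) ≡ y * f * (x * z)
        i₂ = solve-∀
        i₃ : ∀ e f m → e * f * (m * e) ≡ f * (m * (e * e))
        i₃ = solve-∀
        cases : a ≤ L ⊎ L ≤ a → paths-through O * (M ^ a * suc l ^ a * 8 ^ L) ≤ l ! * (8 ^ L * suc l ^ a + M ^ a * 64 ^ a)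
        cases (inj₁ a≤L) = begin
          paths-through O * (M ^ a * suc l ^ a * 8 ^ L)     ≤⟨ *-monoˡ-≤ (M ^ a * suc l ^ a * 8 ^ L) bound ⟩
          (l ∸ a) ! * (M ^ a * suc l ^ a * 8 ^ L)           ≡⟨ i₁ ((l ∸ a) !) (M ^ a) (suc l ^ a) (8 ^ L) ⟩
          M ^ a * (l ∸ a) ! * (8 ^ L * suc l ^ a)           ≤⟨ *-mono-≤ (^-falling-shallow M l a a≤l (≤-trans (+-monoʳ-≤ M a≤L) (≤-reflexive M+L≡n))) (m≤m+n (8 ^ L * suc l ^ a) (M ^ a * 64 ^ a)) ⟩
          l ! * (8 ^ L * suc l ^ a + M ^ a * 64 ^ a)        ∎
        -- Here 8^L is at most 8^a; together with the 8^a lost in `^-falling` this makes the 64^a.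
        cases (inj₂ L≤a) = begin
          paths-through O * (M ^ a * suc l ^ a * 8 ^ L)     ≤⟨ *-mono-≤ bound (*-monoʳ-≤ (M ^ a * suc l ^ a) (^-monoʳ-≤ 8 L≤a)) ⟩
          (l ∸ a) ! * (M ^ a * suc l ^ a * 8 ^ a)           ≡⟨ i₂ ((l ∸ a) !) (M ^ a) (suc l ^ a) (8 ^ a) ⟩
          suc l ^ a * (l ∸ a) ! * (M ^ a * 8 ^ a)           ≤⟨ *-monoˡ-≤ (M ^ a * 8 ^ a) (^-falling l a a≤l) ⟩
          8 ^ a * l ! * (M ^ a * 8 ^ a)                 ≡⟨ i₃ (8 ^ a) (l !) (M ^ a) ⟩
          l ! * (M ^ a * (8 ^ a * 8 ^ a))               ≡⟨ cong (λ z → l ! * (M ^ a * z)) (*-^ 8 8 a) ⟨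
          l ! * (M ^ a * 64 ^ a)                        ≤⟨ *-monoʳ-≤ (l !) (m≤n+m _ (8 ^ L * suc l ^ a)) ⟩
          l ! * (8 ^ L * suc l ^ a + M ^ a * 64 ^ a)        ∎

      -- Both terms of `weighted-base` are geometric in the number of prescribed arcs, so summing
      -- over all choices from `W` closes up into two q-th powers. The prescribed `O` is kept
      -- general for the induction through `weighted-∷`.
      weighted-≤ : ∀ W O → Uniqueˡ W → Uniqueˡ O → All (_∉ˡ O) W →
        let a = length O ; q = length W in
        weighted O W * (M ^ (a + q) * suc l ^ (a + q) * 8 ^ L) ≤
          l ! * (8 ^ L * suc l ^ (a + q) * (s * M + w) ^ q + M ^ (a + q) * 64 ^ a * (s * suc l + 64 * w) ^ q)
      weighted-≤ [] O _ uniqO _ rewrite +-identityʳ (length O) = begin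
        weighted O [] * (M ^ a * suc l ^ a * 8 ^ L)         ≡⟨ cong (_* (M ^ a * suc l ^ a * 8 ^ L)) (paths-cong λ τ → *-identityʳ ⟦ arcs? O τ ⟧) ⟩
        paths-through O * (M ^ a * suc l ^ a * 8 ^ L)       ≤⟨ weighted-base O uniqO ⟩
        l ! * (8 ^ L * suc l ^ a + M ^ a * 64 ^ a)          ≡⟨ cong (l ! *_) (cong₂ _+_ (*-identityʳ (8 ^ L * suc l ^ a)) (*-identityʳ (M ^ a * 64 ^ a))) ⟨
        l ! * (8 ^ L * suc l ^ a * 1 + M ^ a * 64 ^ a * 1)  ∎
        where a = length O
      weighted-≤ (e ∷ W) O (e≢W ∷ uniqW) uniqO (e∉O ∷ W∉O) = begin
        weighted O (e ∷ W) * (M ^ (a + suc q) * suc l ^ (a + suc q) * 8 ^ L)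
          ≡⟨ cong₂ _*_ (weighted-∷ O e W) (cong (λ z → M ^ z * suc l ^ z * 8 ^ L) (+-suc a q)) ⟩
        (s * weighted O W + w * weighted (e ∷ O) W) * (M * M′ * (suc l * n′) * 8 ^ L)
          ≡⟨ i₁ s w (weighted O W) (weighted (e ∷ O) W) M M′ (suc l) n′ (8 ^ L) ⟩
        s * M * suc l * (weighted O W * (M′ * n′ * 8 ^ L)) + w * (weighted (e ∷ O) W * (M * M′ * (suc l * n′) * 8 ^ L))
          ≤⟨ +-mono-≤ (*-monoʳ-≤ (s * M * suc l) (weighted-≤ W O uniqW uniqO W∉O))
                      (*-monoʳ-≤ w (weighted-≤ W (e ∷ O) uniqW (¬Any⇒All¬ O e∉O ∷ uniqO) fresh-W)) ⟩
        s * M * suc l * (l ! * (8 ^ L * n′ * p + M′ * 64 ^ a * r)) + w * (l ! * (8 ^ L * (suc l * n′) * p + M * M′ * (64 * 64 ^ a) * r))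
          ≡⟨ i₂ s w M M′ (suc l) n′ (l !) (8 ^ L) p r (64 ^ a) ⟩
        l ! * (8 ^ L * (suc l * n′) * ((s * M + w) * p) + M * M′ * 64 ^ a * ((s * suc l + 64 * w) * r))
          ≡⟨ cong (λ z → l ! * (8 ^ L * suc l ^ z * ((s * M + w) * p) + M ^ z * 64 ^ a * ((s * suc l + 64 * w) * r))) (+-suc a q) ⟨
        l ! * (8 ^ L * suc l ^ (a + suc q) * (s * M + w) ^ suc q + M ^ (a + suc q) * 64 ^ a * (s * suc l + 64 * w) ^ suc q) ∎
        where
        a = length O
        q = length W
        M′ = M ^ (a + q)
        n′ = suc l ^ (a + q)
        p = (s * M + w) ^ q
        r = (s * suc l + 64 * w) ^ q
        fresh-W : All (_∉ˡ e ∷ O) W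
        fresh-W = All.zipWith (λ { (e≢x , x∉O) (here x≡e) → e≢x (sym x≡e) ; (e≢x , x∉O) (there x∈O) → x∉O x∈O }) (e≢W , W∉O)
        i₁ : ∀ s w F G M M′ n n′ e → (s * F + w * G) * (M * M′ * (n * n′) * e) ≡ s * M * n * (F * (M′ * n′ * e)) + w * (G * (M * M′ * (n * n′) * e))
        i₁ = solve-∀
        i₂ : ∀ s w M M′ n n′ f e p r b → s * M * n * (f * (e * n′ * p + M′ * b * r)) + w * (f * (e * (n * n′) * p + M * M′ * (64 * b) * r)) ≡
          f * (e * (n * n′) * ((s * M + w) * p) + M * M′ * b * ((s * n + 64 * w) * r))
        i₂ = solve-∀

-- Edges as unordered pairs

lookup-unique : ∀ {A : Set} {xs : List A} → Uniqueˡ xs → ∀ i j → List.lookup xs i ≡ List.lookup xs j → i ≡ j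
lookup-unique (x≢ ∷ uniq) zero    zero    _  = refl
lookup-unique (x≢ ∷ uniq) zero    (suc j) eq = contradiction eq (All.lookup x≢ (∈-lookup j))
lookup-unique (x≢ ∷ uniq) (suc i) zero    eq = contradiction (sym eq) (All.lookup x≢ (∈-lookup i))
lookup-unique (x≢ ∷ uniq) (suc i) (suc j) eq = cong suc (lookup-unique uniq i j eq)

length-pairs : ∀ n → length (pairs n) ≡ n C 2
length-pairs n = trans (length-filter _ (cartesianProduct (allFin n) (allFin n)))
  (trans (∑-cartesianProduct (allFin n) (allFin n)) (count n))
  where
  count : ∀ n → ∑[ x ← allFin n ] ∑[ y ← allFin n ] ⟦ x Fin.<? y ⟧ ≡ n C 2
  count zero    = refl
  count (suc n) = begin-equality
    ∑[ x ← allFin (suc n) ] ∑[ y ← allFin (suc n) ] ⟦ x Fin.<? y ⟧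
      ≡⟨ ∑-allFin {n} (λ x → ∑[ y ← allFin (suc n) ] ⟦ x Fin.<? y ⟧) ⟩
    ∑[ y ← allFin (suc n) ] ⟦ zero {n} Fin.<? y ⟧ + ∑[ x ← allFin n ] ∑[ y ← allFin (suc n) ] ⟦ suc x Fin.<? y ⟧
      ≡⟨ cong₂ _+_ (∑-allFin {n} (λ y → ⟦ zero {n} Fin.<? y ⟧)) (∑-cong (allFin n) λ x → ∑-allFin {n} (λ y → ⟦ suc x Fin.<? y ⟧)) ⟩
    ∑[ y ← allFin n ] 1 + ∑[ x ← allFin n ] ∑[ y ← allFin n ] ⟦ x Fin.<? y ⟧
      ≡⟨ cong₂ _+_ (trans (∑-1 {n}) (sym (nC1≡n n))) (count n) ⟩
    n C 1 + n C 2    ≡⟨ nCk+nC[k+1]≡[n+1]C[k+1] n 1 ⟩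
    suc n C 2        ∎

2*nC2 : ∀ n → 2 * (suc n C 2) ≡ suc n * n
2*nC2 n = trans (C-absorption n 1) (cong (suc n *_) (nC1≡n n))

vertexPairs : ∀ n → List (Fin n × Fin n)
vertexPairs n = cartesianProduct (allFin n) (allFin n)

vertexPairs-unique : ∀ n → Uniqueˡ (vertexPairs n)
vertexPairs-unique n = cartesianProduct⁺ (allFin⁺ n) (allFin⁺ n)

edges : ∀ n → List (EdgeIndex n)
edges n = allFin (length (pairs n))

module _ {n : ℕ} where

  ∈-vertexPairs : ∀ a b → (a , b) ∈ˡ vertexPairs n
  ∈-vertexPairs a b = ∈-cartesianProduct⁺ (∈-allFin a) (∈-allFin b)

  increasing? : (e : Fin n × Fin n) → Dec (proj₁ e Fin.< proj₂ e)
  increasing? e = proj₁ e Fin.<? proj₂ e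

  endpoints-increasing : ∀ e → proj₁ (endpoints n e) Fin.< proj₂ (endpoints n e)
  endpoints-increasing e = proj₂ (∈-filter⁻ increasing? {xs = vertexPairs n} (∈-lookup e))

  endpoints-injective : ∀ {e f} → endpoints n e ≡ endpoints n f → e ≡ f
  endpoints-injective = lookup-unique (filter⁺ increasing? (vertexPairs-unique n)) _ _

  edge-between : ∀ {a b} → a Fin.< b → ∃[ e ] endpoints n e ≡ (a , b)
  edge-between {a} {b} a<b = index ab∈ , sym (lookup-index ab∈)
    where
    ab∈ : (a , b) ∈ˡ pairs n
    ab∈ = ∈-filter⁺ increasing? (∈-vertexPairs a b) a<b

  Joins-exists : ∀ {a b} → a ≢ b → ∃[ e ] Joins n e a b
  Joins-exists {a} {b} a≢b with Finₚ.<-cmp a b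
  ... | tri< a<b _ _ = let e , eq = edge-between a<b in e , inj₁ eq
  ... | tri≈ _ a≡b _ = contradiction a≡b a≢b
  ... | tri> _ _ b<a = let e , eq = edge-between b<a in e , inj₂ eq

  Joins-unique : ∀ {a b} e f → Joins n e a b → Joins n f a b → e ≡ f
  Joins-unique e f (inj₁ p) (inj₁ q) = endpoints-injective (trans p (sym q))
  Joins-unique e f (inj₂ p) (inj₂ q) = endpoints-injective (trans p (sym q))
  Joins-unique e f (inj₁ p) (inj₂ q) = contradiction
    (subst (λ (x , y) → x Fin.< y) p (endpoints-increasing e)) (Finₚ.<-asym (subst (λ (x , y) → x Fin.< y) q (endpoints-increasing f)))
  Joins-unique e f (inj₂ p) (inj₁ q) = contradiction
    (subst (λ (x , y) → x Fin.< y) p (endpoints-increasing e)) (Finₚ.<-asym (subst (λ (x , y) → x Fin.< y) q (endpoints-increasing f)))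

  Joins-ends : ∀ {a b c d} e → Joins n e a b → Joins n e c d → (a ≡ c × b ≡ d) ⊎ (a ≡ d × b ≡ c)
  Joins-ends e (inj₁ p) (inj₁ q) = inj₁ (,-injective (trans (sym p) q))
  Joins-ends e (inj₁ p) (inj₂ q) = inj₂ (,-injective (trans (sym p) q))
  Joins-ends e (inj₂ p) (inj₁ q) = let b≡c , a≡d = ,-injective (trans (sym p) q) in inj₂ (a≡d , b≡c)
  Joins-ends e (inj₂ p) (inj₂ q) = let b≡d , a≡c = ,-injective (trans (sym p) q) in inj₁ (a≡c , b≡d)

  ∑-joins-≤1 : ∀ a b → ∑[ e ← edges n ] ⟦ joins? n e a b ⟧ ≤ 1
  ∑-joins-≤1 a b = ∑-unique≤1 (λ e → joins? n e a b) (allFin⁺ _) (Joins-unique _ _)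

  ∑-joins : ∀ {a b} → a ≢ b → ∑[ e ← edges n ] ⟦ joins? n e a b ⟧ ≡ 1
  ∑-joins {a} {b} a≢b = let e , joins = Joins-exists a≢b in
    ∑-unique≡1 (λ e → joins? n e a b) (allFin⁺ _) (Joins-unique _ _) (∈-allFin e) joins

  ∑-ends : ∀ e → ∑[ ab ← vertexPairs n ] ⟦ joins? n e (proj₁ ab) (proj₂ ab) ⟧ ≤ 2
  ∑-ends e = begin
    ∑[ ab ← vertexPairs n ] ⟦ joins? n e (proj₁ ab) (proj₂ ab) ⟧
      ≤⟨ ∑-mono (vertexPairs n) split ⟩
    ∑[ ab ← vertexPairs n ] (⟦ forward? ab ⟧ + ⟦ backward? ab ⟧)
      ≡⟨ ∑-+ (vertexPairs n) ⟩
    ∑[ ab ← vertexPairs n ] ⟦ forward? ab ⟧ + ∑[ ab ← vertexPairs n ] ⟦ backward? ab ⟧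
      ≤⟨ +-mono-≤ (∑-unique≤1 forward? (vertexPairs-unique n) λ p q → trans (sym p) q)
                  (∑-unique≤1 backward? (vertexPairs-unique n) λ p q → swap-injective (trans (sym p) q)) ⟩
    2 ∎
    where
    _≟ₑ_ = ≡-dec (Finₚ._≟_ {n}) (Finₚ._≟_ {n})
    forward? : ∀ ab → Dec (endpoints n e ≡ ab)
    forward? ab = endpoints n e ≟ₑ ab
    backward? : ∀ ab → Dec (endpoints n e ≡ (proj₂ ab , proj₁ ab))
    backward? (a , b) = endpoints n e ≟ₑ (b , a)
    swap-injective : ∀ {x y : Fin n × Fin n} → (proj₂ x , proj₁ x) ≡ (proj₂ y , proj₁ y) → x ≡ y
    swap-injective refl = refl
    split : ∀ ab → ⟦ joins? n e (proj₁ ab) (proj₂ ab) ⟧ ≤ ⟦ forward? ab ⟧ + ⟦ backward? ab ⟧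
    split ab = ⟦⟧-⊎ (joins? n e (proj₁ ab) (proj₂ ab)) (forward? ab) (backward? ab) id

-- Cyclic arrangements

-- Pigeonhole: if `y` were missed, punching it out would give an injection into a smaller set.
injective⇒hits : ∀ {n} (f : Fin n → Fin n) → (∀ {i j} → f i ≡ f j → i ≡ j) → ∀ y → ∃[ x ] f x ≡ y
injective⇒hits {suc _} f inj y with Finₚ.any? (λ x → f x Finₚ.≟ y)
... | yes hit = hit
... | no  miss = contradiction (Finₚ.injective⇒≤ {f = λ x → punchOut (y≢f x)}
        λ {i} {j} → inj ∘ Finₚ.punchOut-injective (y≢f i) (y≢f j)) 1+n≰n
  where
  y≢f : ∀ x → y ≢ f x
  y≢f x y≡fx = miss (x , sym y≡fx)

∑-allFin-last : ∀ {l} (f : Fin (suc l) → ℕ) → ∑ (allFin (suc l)) f ≡ ∑ (allFin l) (f ∘ inject₁) + f (top l)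
∑-allFin-last {zero}  f = +-identityʳ (f zero)
∑-allFin-last {suc l} f = begin-equality
  ∑ (allFin (suc (suc l))) f                                      ≡⟨ ∑-allFin f ⟩
  f zero + ∑ (allFin (suc l)) (f ∘ suc)                           ≡⟨ cong (f zero +_) (∑-allFin-last (f ∘ suc)) ⟩
  f zero + (∑ (allFin l) (f ∘ suc ∘ inject₁) + f (top (suc l)))   ≡⟨ +-assoc (f zero) _ _ ⟨
  f zero + ∑ (allFin l) (f ∘ suc ∘ inject₁) + f (top (suc l))     ≡⟨ cong (_+ f (top (suc l))) (∑-allFin (f ∘ inject₁)) ⟨
  ∑ (allFin (suc l)) (f ∘ inject₁) + f (top (suc l))              ∎

toℕ-next : ∀ {l} (i : Fin (suc l)) → toℕ (next i) ≡ suc (toℕ i) % suc l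
toℕ-next i = Finₚ.toℕ-fromℕ< _

next-inject₁ : ∀ {l} (j : Fin l) → next (inject₁ j) ≡ suc j
next-inject₁ {l} j = Finₚ.toℕ-injective (trans (toℕ-next (inject₁ j))
  (trans (cong (λ z → suc z % suc l) (Finₚ.toℕ-inject₁ j)) (m<n⇒m%n≡m (s≤s (Finₚ.toℕ<n j)))))

next-top : ∀ l → next (top l) ≡ zero
next-top l = Finₚ.toℕ-injective (trans (toℕ-next (top l)) (trans (cong (λ z → suc z % suc l) (Finₚ.toℕ-fromℕ l)) (n%n≡0 (suc l))))

next-injective : ∀ {l} {i j : Fin (suc l)} → next i ≡ next j → i ≡ j
next-injective {l} {i} {j} eq with view i | view j
... | ‵fromℕ     | ‵fromℕ     = refl
... | ‵fromℕ     | ‵inject₁ b = contradiction (trans (sym (next-top l)) (trans eq (next-inject₁ b))) λ ()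
... | ‵inject₁ a | ‵fromℕ     = contradiction (trans (sym (next-top l)) (trans (sym eq) (next-inject₁ a))) λ ()
... | ‵inject₁ a | ‵inject₁ b = cong inject₁ (Finₚ.suc-injective (trans (sym (next-inject₁ a)) (trans eq (next-inject₁ b))))

next-zero⁻ : ∀ {l} {i : Fin (suc l)} → next i ≡ zero → i ≡ top l
next-zero⁻ {l} eq = next-injective (trans eq (sym (next-top l)))

module _ {l : ℕ} where

  next^ : ℕ → Fin (suc l) → Fin (suc l)
  next^ zero    i = i
  next^ (suc c) i = next (next^ c i)

  next^-next : ∀ c i → next^ c (next i) ≡ next (next^ c i)
  next^-next zero    i = refl
  next^-next (suc c) i = cong next (next^-next c i)

  next^-injective : ∀ c {i j} → next^ c i ≡ next^ c j → i ≡ j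
  next^-injective zero    eq = eq
  next^-injective (suc c) eq = next^-injective c (next-injective eq)

  toℕ-next^ : ∀ c → c ≤ l → toℕ (next^ c zero) ≡ c
  toℕ-next^ zero    _   = refl
  toℕ-next^ (suc c) c<l = trans (toℕ-next (next^ c zero))
    (trans (cong (λ z → suc z % suc l) (toℕ-next^ c (<⇒≤ c<l))) (m<n⇒m%n≡m (s≤s c<l)))

  next^-reaches : ∀ i → next^ (toℕ i) zero ≡ i
  next^-reaches i = Finₚ.toℕ-injective (toℕ-next^ (toℕ i) (Finₚ.toℕ≤pred[n] i))

module _ {l : ℕ} (2≤l : 2 ≤ l) where

  next≢ : (i : Fin (suc l)) → next i ≢ i
  next≢ i = subst (λ i → next i ≢ i) (next^-reaches i) λ eq →
    contradiction (trans (sym (toℕ-next^ {l} 1 (<⇒≤ 2≤l))) (cong toℕ (next^-injective (toℕ i) (trans (next^-next (toℕ i) zero) eq)))) λ ()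

  -- Here n ≥ 3 matters: on two vertices the step out and the step back would be the same edge.
  -- Undoing the rotation that carries 0 to `i` leaves a comparison at 0.
  next²≢ : (i : Fin (suc l)) → next (next i) ≢ i
  next²≢ i = subst (λ i → next (next i) ≢ i) (next^-reaches i) λ eq →
    contradiction (trans (sym (toℕ-next^ {l} 2 2≤l)) (cong toℕ (next^-injective (toℕ i)
      (trans (next^-next (toℕ i) (next zero)) (trans (cong next (next^-next (toℕ i) zero)) eq))))) λ ()

  next-zero≢top : next zero ≢ top l
  next-zero≢top eq = next²≢ zero (trans (cong next eq) (next-top l))

  module _ (σ : Vec (Fin (suc l)) (suc l)) (uniq : Unique σ) where

    private
      σ-injective : ∀ {i j} → lookup σ i ≡ lookup σ j → i ≡ j
      σ-injective = lookup-injective uniq _ _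

    joinsAt? : ∀ e i → Dec (Joins (suc l) e (lookup σ i) (lookup σ (next i)))
    joinsAt? e i = joins? (suc l) e (lookup σ i) (lookup σ (next i))

    adjacent-distinct : ∀ i → lookup σ i ≢ lookup σ (next i)
    adjacent-distinct i eq = next≢ i (sym (σ-injective eq))

    -- An edge met at two positions in opposite directions would force `next (next i) ≡ i`.
    position-unique : ∀ e {i j} → Joins (suc l) e (lookup σ i) (lookup σ (next i)) →
                      Joins (suc l) e (lookup σ j) (lookup σ (next j)) → i ≡ j
    position-unique e {i} p q with Joins-ends e p q
    ... | inj₁ (σi≡σj , _)         = σ-injective σi≡σj
    ... | inj₂ (σi≡σj⁺ , σi⁺≡σj) =
      contradiction (trans (cong next (σ-injective σi⁺≡σj)) (sym (σ-injective σi≡σj⁺))) (next²≢ i)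

    edge-at : ∀ {a b} → a ≢ b → (∀ e → Joins (suc l) e a b → OnCycle (suc l) σ e) →
      ∃[ j ] ((a ≡ lookup σ j × b ≡ lookup σ (next j)) ⊎ (a ≡ lookup σ (next j) × b ≡ lookup σ j))
    edge-at a≢b on with Joins-exists a≢b
    ... | e , joins with on e joins
    ...   | j , joins′ = j , Joins-ends e joins joins′

    ∑-joinsAt : ∀ e → ∑[ i ← allFin (suc l) ] ⟦ joinsAt? e i ⟧ ≡ ⟦ onCycle? (suc l) σ e ⟧
    ∑-joinsAt e = at (onCycle? (suc l) σ e)
      where
      at : (d : Dec (OnCycle (suc l) σ e)) → ∑[ i ← allFin (suc l) ] ⟦ joinsAt? e i ⟧ ≡ ⟦ d ⟧
      at (yes (i , p)) = ∑-unique≡1 (joinsAt? e) (allFin⁺ (suc l)) (position-unique e) (∈-allFin i) p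
      at (no ¬on)      = trans (∑-cong (allFin (suc l)) λ i → ⟦⟧-no (joinsAt? e i) λ p → ¬on (i , p)) (∑-zero (allFin (suc l)))

  EdgesOf : Vec (Fin (suc l)) (suc l) → Graph (suc l) → Set
  EdgesOf σ H = ∀ e → e ∈ H ⇔ OnCycle (suc l) σ e

  edgesOf? : ∀ σ H → Dec (EdgesOf σ H)
  edgesOf? σ H = Finₚ.all? λ e → (e ∈? H) ⇔? onCycle? (suc l) σ e

  cycle-size : ∀ σ H → Unique σ → EdgesOf σ H → ∣ H ∣ ≡ suc l
  cycle-size σ H uniq edgesOf = begin-equality
    ∣ H ∣                                                       ≡⟨ ∣p∣≡∑ H ⟩
    ∑[ e ← edges (suc l) ] ⟦ e ∈? H ⟧
      ≡⟨ ∑-cong (edges (suc l)) (λ e → trans (⟦⟧-cong (e ∈? H) (onCycle? (suc l) σ e) (Equivalence.to (edgesOf e)) (Equivalence.from (edgesOf e))) (sym (∑-joinsAt σ uniq e))) ⟩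
    ∑[ e ← edges (suc l) ] ∑[ i ← allFin (suc l) ] ⟦ joinsAt? σ uniq e i ⟧    ≡⟨ ∑-swap (edges (suc l)) (allFin (suc l)) ⟩
    ∑[ i ← allFin (suc l) ] ∑[ e ← edges (suc l) ] ⟦ joinsAt? σ uniq e i ⟧    ≡⟨ ∑-cong (allFin (suc l)) (λ i → ∑-joins (adjacent-distinct σ uniq i)) ⟩
    ∑[ i ← allFin (suc l) ] 1                                         ≡⟨ ∑-1 ⟩
    suc l                                                           ∎

  rotate-to-zero : ∀ σ → Unique σ → ∃[ τ ] (Unique {n = suc l} (zero ∷ τ) × (∀ e → OnCycle (suc l) σ e ⇔ OnCycle (suc l) (zero ∷ τ) e))
  rotate-to-zero σ uniq with injective⇒hits (lookup σ) (lookup-injective uniq _ _) zero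
  ... | i₀ , σi₀≡0 = tail , subst Unique split uniqueᵣ , λ e → mk⇔ (to e) (from e)
    where
    c = toℕ i₀
    rot = next^ c
    σᵣ : Vec (Fin (suc l)) (suc l)
    σᵣ = tabulate (lookup σ ∘ rot)
    at : ∀ i → lookup σᵣ i ≡ lookup σ (rot i)
    at = lookup∘tabulate (lookup σ ∘ rot)
    tail : Vec (Fin (suc l)) (l)
    tail = tabulate (lookup σ ∘ rot ∘ suc)
    split : σᵣ ≡ zero ∷ tail
    split = cong (_∷ tail) (trans (cong (lookup σ) (next^-reaches i₀)) σi₀≡0)
    uniqueᵣ : Unique σᵣ
    uniqueᵣ = tabulate⁺ λ eq → next^-injective c (lookup-injective uniq _ _ eq)
    joinsᵣ : ∀ e i → Joins (suc l) e (lookup σᵣ i) (lookup σᵣ (next i)) ≡ Joins (suc l) e (lookup σ (rot i)) (lookup σ (next (rot i)))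
    joinsᵣ e i = cong₂ (Joins (suc l) e) (at i) (trans (at (next i)) (cong (lookup σ) (next^-next c i)))
    to : ∀ e → OnCycle (suc l) σ e → OnCycle (suc l) (zero ∷ tail) e
    to e (j , joins) with injective⇒hits rot (next^-injective c) j
    ... | i , refl = subst (λ σ′ → OnCycle (suc l) σ′ e) split (i , subst id (sym (joinsᵣ e i)) joins)
    from : ∀ e → OnCycle (suc l) (zero ∷ tail) e → OnCycle (suc l) σ e
    from e on with subst (λ σ′ → OnCycle (suc l) σ′ e) (sym split) on
    ... | i , joins = rot i , subst id (joinsᵣ e i) joins

  -- The edge of σ′ leaving position b joins consecutive vertices of σ, and in σ it
  -- cannot lead back from b to the previous vertex.
  arrangement-unique : ∀ σ σ′ → Unique σ → Unique σ′ → (∀ e → OnCycle (suc l) σ′ e → OnCycle (suc l) σ e) →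
    lookup σ zero ≡ lookup σ′ zero → lookup σ (next zero) ≡ lookup σ′ (next zero) → σ ≡ σ′
  arrangement-unique σ σ′ uniq uniq′ on start second =
    trans (sym (tabulate∘lookup σ)) (trans (tabulate-cong (λ i → subst (λ i → lookup σ i ≡ lookup σ′ i) (next^-reaches i) (proj₁ (agree (toℕ i))))) (tabulate∘lookup σ′))
    where
    agree : ∀ c → lookup σ (next^ c zero) ≡ lookup σ′ (next^ c zero) × lookup σ (next^ (suc c) zero) ≡ lookup σ′ (next^ (suc c) zero)
    agree zero    = start , second
    agree (suc c) with agree c
    ... | at-a , at-b = at-b , at-c
      where
      a = next^ c zero
      b = next a
      at-c : lookup σ (next b) ≡ lookup σ′ (next b)
      at-c with edge-at σ uniq (adjacent-distinct σ′ uniq′ b) (λ e joins → on e (b , joins))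
      ... | j , inj₁ (σ′b≡ , σ′c≡) = sym (trans σ′c≡ (cong (lookup σ ∘ next) (lookup-injective uniq j b (trans (sym σ′b≡) (sym at-b)))))
      ... | j , inj₂ (σ′b≡ , σ′c≡) = contradiction
        (lookup-injective uniq′ (next b) a (trans σ′c≡ (trans (cong (lookup σ) (next-injective (lookup-injective uniq (next j) b (trans (sym σ′b≡) (sym at-b))))) at-a)))
        (next²≢ a)

  -- Comparing the two neighbours of vertex 0 singles out one of the two directions in which a cycle
  -- can be traversed.
  ascending? : (τ : Vec (Fin (suc l)) (l)) → Dec (lookup (zero ∷ τ) (next zero) Fin.< lookup (zero ∷ τ) (top l))
  ascending? τ = lookup (zero ∷ τ) (next zero) Fin.<? lookup (zero ∷ τ) (top l)

  Ascending : Vec (Fin (suc l)) (l) → Set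
  Ascending τ = lookup (zero ∷ τ) (next zero) Fin.< lookup (zero ∷ τ) (top l)

  -- As `τ′` uses edges of `τ`, its two neighbours of 0 are those of `τ`, possibly exchanged; an
  -- exchange would reverse the comparison. The first two vertices therefore agree and
  -- `arrangement-unique` applies.
  same-direction : ∀ (τ τ′ : Vec (Fin (suc l)) (l)) → Unique (zero ∷ τ) → Unique (zero ∷ τ′) → (∀ e → OnCycle (suc l) (zero ∷ τ′) e → OnCycle (suc l) (zero ∷ τ) e) →
    (Ascending τ → Ascending τ′) → (Ascending τ′ → Ascending τ) → τ ≡ τ′
  same-direction τ τ′ uniq uniq′ on asc asc′ = ∷-injectiveʳ (arrangement-unique σ σ′ uniq uniq′ on refl second)
    where
    σ σ′ : Vec (Fin (suc l)) (suc l)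
    σ = zero ∷ τ
    σ′ = zero ∷ τ′
    x y x′ y′ : Fin (suc l)
    x = lookup σ (next zero)
    y = lookup σ (top l)
    x′ = lookup σ′ (next zero)
    y′ = lookup σ′ (top l)
    x′∈ : x′ ≡ x ⊎ x′ ≡ y
    x′∈ with edge-at σ uniq (adjacent-distinct σ′ uniq′ zero) (λ e joins → on e (zero , joins))
    ... | j , inj₁ (0≡σj , x′≡)  = inj₁ (trans x′≡ (cong (lookup σ ∘ next) (lookup-injective uniq j zero (sym 0≡σj))))
    ... | j , inj₂ (0≡σj⁺ , x′≡) = inj₂ (trans x′≡ (cong (lookup σ) (next-zero⁻ (lookup-injective uniq (next j) zero (sym 0≡σj⁺)))))
    y′∈ : y′ ≡ x ⊎ y′ ≡ y
    y′∈ with edge-at σ uniq (adjacent-distinct σ′ uniq′ (top l)) (λ e joins → on e ((top l) , joins))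
    ... | j , inj₁ (y′≡ , 0≡σj⁺) = inj₂ (trans y′≡ (cong (lookup σ) (next-zero⁻ (lookup-injective uniq (next j) zero (trans (sym 0≡σj⁺) at-zero)))))
      where at-zero = cong (lookup σ′) (next-top (l))
    ... | j , inj₂ (y′≡ , 0≡σj)  = inj₁ (trans y′≡ (cong (lookup σ ∘ next) (lookup-injective uniq j zero (trans (sym 0≡σj) at-zero))))
      where at-zero = cong (lookup σ′) (next-top (l))
    second : x ≡ x′
    second with x′∈ | y′∈
    ... | inj₁ x′≡x | _         = sym x′≡x
    ... | inj₂ x′≡y | inj₂ y′≡y = contradiction (lookup-injective uniq′ (next zero) (top l) (trans x′≡y (sym y′≡y))) next-zero≢top
    ... | inj₂ x′≡y | inj₁ y′≡x = contradiction (Finₚ.≤-antisym (≮⇒≥ y≮x) (≮⇒≥ x≮y)) λ x≡y → next-zero≢top (lookup-injective uniq (next zero) (top l) x≡y)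
      where
      x≮y : ¬ x Fin.< y
      x≮y x<y = Finₚ.<-asym x<y (subst₂ Fin._<_ x′≡y y′≡x (asc x<y))
      y≮x : ¬ y Fin.< x
      y≮x y<x = Finₚ.<-asym y<x (asc′ (subst₂ Fin._<_ (sym x′≡y) (sym y′≡x) y<x))

-- Cycles overlapping a fixed graph

does-true : {P : Set} (p? : Dec P) → does p? ≡ true → P
does-true (yes p) _ = p

weight-power : ∀ {l} (v : Fin (suc l)) s w W τ → let t = ∑[ e ← W ] ⟦ e onPath? (v ∷ τ) ⟧ in
  weight v s w W τ * s ^ t ≡ s ^ length W * (s + w) ^ t
weight-power v s w []      τ = refl
weight-power v s w (e ∷ W) τ with e onPath? (v ∷ τ) | weight-power v s w W τ
... | yes _ | ih = trans (identity₁ s w (weight v s w W τ) _) (trans (cong (s * (s + w) *_) ih) (identity₂ s (s + w) _ _))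
  where
  identity₁ : ∀ s w x p → (s + w * 1) * x * (s * p) ≡ s * (s + w) * (x * p)
  identity₁ = solve-∀
  identity₂ : ∀ s y p q → s * y * (p * q) ≡ s * p * (y * q)
  identity₂ = solve-∀
... | no _  | ih = trans (identity₁ s w (weight v s w W τ) _) (trans (cong (s *_) ih) (sym (*-assoc s _ _)))
  where
  identity₁ : ∀ s w x p → (s + w * 0) * x * p ≡ s * (x * p)
  identity₁ = solve-∀

module _ (n : ℕ) (U : Graph n) where

  Adjacent : Fin n → Fin n → Set
  Adjacent a b = ∃[ e ] (Joins n e a b × e ∈ U)

  adjacent? : ∀ a b → Dec (Adjacent a b)
  adjacent? a b = Finₚ.any? λ e → joins? n e a b ×-dec (e ∈? U)

  -- Every edge of `U` occurs in both orientations, because a traversal may use it either way; this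
  -- is the origin of the exponent 2u.
  arcsOf : List (Fin n × Fin n)
  arcsOf = filter (λ ab → adjacent? (proj₁ ab) (proj₂ ab)) (vertexPairs n)

  arcsOf-unique : Uniqueˡ arcsOf
  arcsOf-unique = filter⁺ (λ ab → adjacent? (proj₁ ab) (proj₂ ab)) (vertexPairs-unique n)

  adjacent-≤ : ∀ a b → ⟦ adjacent? a b ⟧ ≤ ∑[ e ← edges n ] (⟦ e ∈? U ⟧ * ⟦ joins? n e a b ⟧)
  adjacent-≤ a b = at (adjacent? a b)
    where
    at : (d : Dec (Adjacent a b)) → ⟦ d ⟧ ≤ ∑[ e ← edges n ] (⟦ e ∈? U ⟧ * ⟦ joins? n e a b ⟧)
    at (no _) = z≤n
    at (yes (e , joins , e∈U)) = ≤-trans (≤-reflexive (sym (cong₂ _*_ (⟦⟧-yes (e ∈? U) e∈U) (⟦⟧-yes (joins? n e a b) joins))))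
      (∑-member (∈-allFin e))

  length-arcsOf : length arcsOf ≤ 2 * ∣ U ∣
  length-arcsOf = begin
    length arcsOf                                                        ≡⟨ length-filter _ (vertexPairs n) ⟩
    ∑[ ab ← vertexPairs n ] ⟦ adjacent? (proj₁ ab) (proj₂ ab) ⟧            ≤⟨ ∑-mono (vertexPairs n) (λ ab → adjacent-≤ (proj₁ ab) (proj₂ ab)) ⟩
    ∑[ ab ← vertexPairs n ] ∑[ e ← edges n ] (⟦ e ∈? U ⟧ * ⟦ joins? n e (proj₁ ab) (proj₂ ab) ⟧)
      ≡⟨ ∑-swap (vertexPairs n) (edges n) ⟩
    ∑[ e ← edges n ] ∑[ ab ← vertexPairs n ] (⟦ e ∈? U ⟧ * ⟦ joins? n e (proj₁ ab) (proj₂ ab) ⟧)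
      ≡⟨ ∑-cong (edges n) (λ e → ∑-*ˡ ⟦ e ∈? U ⟧ (vertexPairs n)) ⟩
    ∑[ e ← edges n ] (⟦ e ∈? U ⟧ * ∑[ ab ← vertexPairs n ] ⟦ joins? n e (proj₁ ab) (proj₂ ab) ⟧)
      ≤⟨ ∑-mono (edges n) (λ e → *-monoʳ-≤ ⟦ e ∈? U ⟧ (∑-ends {n} e)) ⟩
    ∑[ e ← edges n ] (⟦ e ∈? U ⟧ * 2)        ≡⟨ ∑-*ʳ 2 (edges n) ⟩
    ∑[ e ← edges n ] ⟦ e ∈? U ⟧ * 2          ≡⟨ cong (_* 2) (∣p∣≡∑ U) ⟨
    ∣ U ∣ * 2                                ≡⟨ *-comm ∣ U ∣ 2 ⟩
    2 * ∣ U ∣                                ∎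

module _ {l : ℕ} (U : Graph (suc l)) (σ : Vec (Fin (suc l)) (suc l)) (uniq : Unique σ) where

  private
    step? : ∀ ab i → Dec (lookup σ (inject₁ i) ≡ proj₁ ab × lookup σ (suc i) ≡ proj₂ ab)
    step? ab i = (lookup σ (inject₁ i) Finₚ.≟ proj₁ ab) ×-dec (lookup σ (suc i) Finₚ.≟ proj₂ ab)

    step-adjacent? : ∀ i → Dec (Adjacent (suc l) U (lookup σ (inject₁ i)) (lookup σ (suc i)))
    step-adjacent? i = adjacent? (suc l) U (lookup σ (inject₁ i)) (lookup σ (suc i))

  steps-≤ : ∑[ i ← allFin l ] ⟦ step-adjacent? i ⟧ ≤ ∑[ ab ← arcsOf (suc l) U ] ⟦ ab onPath? σ ⟧
  steps-≤ = begin
    ∑[ i ← allFin l ] ⟦ step-adjacent? i ⟧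
      ≤⟨ ∑-mono (allFin l) at-step ⟩
    ∑[ i ← allFin l ] ∑[ ab ← vertexPairs (suc l) ] (⟦ adjacent? (suc l) U (proj₁ ab) (proj₂ ab) ⟧ * ⟦ step? ab i ⟧)
      ≡⟨ ∑-swap (allFin l) (vertexPairs (suc l)) ⟩
    ∑[ ab ← vertexPairs (suc l) ] ∑[ i ← allFin l ] (⟦ adjacent? (suc l) U (proj₁ ab) (proj₂ ab) ⟧ * ⟦ step? ab i ⟧)
      ≡⟨ ∑-cong (vertexPairs (suc l)) (λ ab → ∑-*ˡ ⟦ adjacent? (suc l) U (proj₁ ab) (proj₂ ab) ⟧ (allFin l)) ⟩
    ∑[ ab ← vertexPairs (suc l) ] (⟦ adjacent? (suc l) U (proj₁ ab) (proj₂ ab) ⟧ * ∑[ i ← allFin l ] ⟦ step? ab i ⟧)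
      ≤⟨ ∑-mono (vertexPairs (suc l)) (λ ab → *-monoʳ-≤ ⟦ adjacent? (suc l) U (proj₁ ab) (proj₂ ab) ⟧ (on-path ab)) ⟩
    ∑[ ab ← vertexPairs (suc l) ] (⟦ adjacent? (suc l) U (proj₁ ab) (proj₂ ab) ⟧ * ⟦ ab onPath? σ ⟧)
      ≡⟨ ∑-filter (λ ab → adjacent? (suc l) U (proj₁ ab) (proj₂ ab)) (vertexPairs (suc l)) ⟨
    ∑[ ab ← arcsOf (suc l) U ] ⟦ ab onPath? σ ⟧ ∎
    where
    at-step : ∀ i → ⟦ step-adjacent? i ⟧ ≤ ∑[ ab ← vertexPairs (suc l) ] (⟦ adjacent? (suc l) U (proj₁ ab) (proj₂ ab) ⟧ * ⟦ step? ab i ⟧)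
    at-step i = ≤-trans
      (≤-reflexive (trans (sym (*-identityʳ ⟦ step-adjacent? i ⟧)) (cong (⟦ step-adjacent? i ⟧ *_) (sym (⟦⟧-yes (step? here-ab i) (refl , refl))))))
      (∑-member {f = λ ab → ⟦ adjacent? (suc l) U (proj₁ ab) (proj₂ ab) ⟧ * ⟦ step? ab i ⟧} (∈-vertexPairs (proj₁ here-ab) (proj₂ here-ab)))
      where here-ab = lookup σ (inject₁ i) , lookup σ (suc i)
    on-path : ∀ ab → ∑[ i ← allFin l ] ⟦ step? ab i ⟧ ≤ ⟦ ab onPath? σ ⟧
    on-path ab = ∑-bound (allFin l) λ i ≢0 → ≤-trans
      (∑-unique≤1 (step? ab) (allFin⁺ l) λ (_ , p) (_ , q) → Finₚ.suc-injective (lookup-injective uniq _ _ (trans p (sym q))))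
      (≤-reflexive (sym (⟦⟧-yes (ab onPath? σ) (i , ⟦⟧-holds (step? ab i) ≢0))))

  incident-≤ : ∀ a b → ∑[ e ← edges (suc l) ] (⟦ e ∈? U ⟧ * ⟦ joins? (suc l) e a b ⟧) ≤ ⟦ adjacent? (suc l) U a b ⟧
  incident-≤ a b = ∑-bound (edges (suc l)) λ e ≢0 → begin
    ∑[ e ← edges (suc l) ] (⟦ e ∈? U ⟧ * ⟦ joins? (suc l) e a b ⟧)
      ≤⟨ ∑-mono (edges (suc l)) (λ e → ≤-trans (*-monoˡ-≤ ⟦ joins? (suc l) e a b ⟧ (⟦⟧≤1 (e ∈? U))) (≤-reflexive (*-identityˡ ⟦ joins? (suc l) e a b ⟧))) ⟩
    ∑[ e ← edges (suc l) ] ⟦ joins? (suc l) e a b ⟧   ≤⟨ ∑-joins-≤1 {suc l} a b ⟩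
    1                                                 ≡⟨ ⟦⟧-yes (adjacent? (suc l) U a b) (e ,
      ⟦⟧-holds (joins? (suc l) e a b) (λ eq → ≢0 (trans (cong (⟦ e ∈? U ⟧ *_) eq) (*-zeroʳ ⟦ e ∈? U ⟧))) ,
      ⟦⟧-holds (e ∈? U) (λ eq → ≢0 (cong (_* ⟦ joins? (suc l) e a b ⟧) eq))) ⟨
    ⟦ adjacent? (suc l) U a b ⟧                               ∎

  -- The closing edge of the cycle accounts for the successor.
  overlap-≤ : (2≤l : 2 ≤ l) → ∀ H → EdgesOf 2≤l σ H → ∣ H ∩ U ∣ ≤ suc (∑[ ab ← arcsOf (suc l) U ] ⟦ ab onPath? σ ⟧)
  overlap-≤ 2≤l H edgesOf = begin
    ∣ H ∩ U ∣                                                  ≡⟨ ∣p∣≡∑ (H ∩ U) ⟩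
    ∑[ e ← edges (suc l) ] ⟦ e ∈? H ∩ U ⟧                      ≡⟨ ∑-cong (edges (suc l)) at-edge ⟩
    ∑[ e ← edges (suc l) ] ∑[ i ← allFin (suc l) ] at e i      ≡⟨ ∑-swap (edges (suc l)) (allFin (suc l)) ⟩
    ∑[ i ← allFin (suc l) ] ∑[ e ← edges (suc l) ] at e i      ≤⟨ ∑-mono (allFin (suc l)) (λ i → incident-≤ (lookup σ i) (lookup σ (next i))) ⟩
    ∑[ i ← allFin (suc l) ] near i                             ≡⟨ ∑-allFin-last near ⟩
    ∑[ i ← allFin l ] near (inject₁ i) + near (top l)
      ≤⟨ +-mono-≤ (≤-reflexive (∑-cong (allFin l) λ i → cong (λ j → ⟦ adjacent? (suc l) U (lookup σ (inject₁ i)) (lookup σ j) ⟧) (next-inject₁ i)))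
                  (⟦⟧≤1 (adjacent? (suc l) U (lookup σ (top l)) (lookup σ (next (top l))))) ⟩
    ∑[ i ← allFin l ] ⟦ step-adjacent? i ⟧ + 1                 ≤⟨ +-monoˡ-≤ 1 steps-≤ ⟩
    ∑[ ab ← arcsOf (suc l) U ] ⟦ ab onPath? σ ⟧ + 1                    ≡⟨ +-comm _ 1 ⟩
    suc (∑[ ab ← arcsOf (suc l) U ] ⟦ ab onPath? σ ⟧)                  ∎
    where
    near : Fin (suc l) → ℕ
    near i = ⟦ adjacent? (suc l) U (lookup σ i) (lookup σ (next i)) ⟧
    at : EdgeIndex (suc l) → Fin (suc l) → ℕ
    at e i = ⟦ e ∈? U ⟧ * ⟦ joinsAt? 2≤l σ uniq e i ⟧
    at-edge : ∀ e → ⟦ e ∈? H ∩ U ⟧ ≡ ∑[ i ← allFin (suc l) ] at e i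
    at-edge e = begin-equality
      ⟦ e ∈? H ∩ U ⟧
        ≡⟨ ⟦⟧-cong (e ∈? H ∩ U) (e ∈? U ×-dec onCycle? (suc l) σ e)
             (λ e∈ → let e∈H , e∈U = x∈p∩q⁻ H U e∈ in e∈U , Equivalence.to (edgesOf e) e∈H)
             (λ (e∈U , on) → x∈p∩q⁺ (Equivalence.from (edgesOf e) on , e∈U)) ⟩
      ⟦ e ∈? U ×-dec onCycle? (suc l) σ e ⟧                          ≡⟨ ⟦⟧-× (e ∈? U) (onCycle? (suc l) σ e) ⟩
      ⟦ e ∈? U ⟧ * ⟦ onCycle? (suc l) σ e ⟧                          ≡⟨ cong (⟦ e ∈? U ⟧ *_) (∑-joinsAt 2≤l σ uniq e) ⟨
      ⟦ e ∈? U ⟧ * ∑[ i ← allFin (suc l) ] ⟦ joinsAt? 2≤l σ uniq e i ⟧ ≡⟨ ∑-*ˡ ⟦ e ∈? U ⟧ (allFin (suc l)) ⟨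
      ∑[ i ← allFin (suc l) ] at e i                                 ∎

-- Hamilton cycles of the complete graph and their traversals from vertex 0

module _ {l : ℕ} (2≤l : 2 ≤ l) where

  -- The path from 0 omits the closing edge of the cycle, and this edge may lie in `U`; hence the
  -- extra factor (s + w)/s. If the overlap is smaller than the arc count plus 1, the `d` missing
  -- factors are supplied by s ≤ s + w.
  cycle-weight-≤ : ∀ s w .{{_ : NonZero s}} (U H : Graph (suc l)) τ → Unique {n = suc l} (zero ∷ τ) → EdgesOf 2≤l (zero ∷ τ) H →
    s ^ ∣ H ─ U ∣ * (s + w) ^ ∣ H ∩ U ∣ * s ^ suc (length (arcsOf (suc l) U)) ≤ s ^ suc l * (s + w) * weight zero s w (arcsOf (suc l) U) τ
  cycle-weight-≤ s w U H τ uniq edgesOf = *-cancelʳ-≤ _ _ (s ^ c) {{m^n≢0 s c}} (begin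
    s ^ a * (s + w) ^ b * s ^ suc q * s ^ c               ≡⟨ i₁ (s ^ a) ((s + w) ^ b) s (s ^ q) (s ^ c) ⟩
    s ^ q * (s ^ a * (s + w) ^ b * s ^ suc c)             ≡⟨ cong (λ z → s ^ q * (s ^ a * (s + w) ^ b * s ^ z)) (sym (m+[n∸m]≡n b≤)) ⟩
    s ^ q * (s ^ a * (s + w) ^ b * s ^ (b + d))           ≡⟨ cong (λ z → s ^ q * (s ^ a * (s + w) ^ b * z)) (^-distribˡ-+-* s b d) ⟩
    s ^ q * (s ^ a * (s + w) ^ b * (s ^ b * s ^ d))       ≤⟨ *-monoʳ-≤ (s ^ q) (*-monoʳ-≤ (s ^ a * (s + w) ^ b) (*-monoʳ-≤ (s ^ b) (^-monoˡ-≤ d (m≤m+n s w)))) ⟩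
    s ^ q * (s ^ a * (s + w) ^ b * (s ^ b * (s + w) ^ d)) ≡⟨ i₂ (s ^ q) (s ^ a) ((s + w) ^ b) (s ^ b) ((s + w) ^ d) ⟩
    s ^ a * s ^ b * (s ^ q * ((s + w) ^ b * (s + w) ^ d)) ≡⟨ cong₂ (λ y z → y * (s ^ q * z)) (^-distribˡ-+-* s a b) (^-distribˡ-+-* (s + w) b d) ⟨
    s ^ (a + b) * (s ^ q * (s + w) ^ (b + d))             ≡⟨ cong₂ (λ y z → s ^ y * (s ^ q * (s + w) ^ z)) size (m+[n∸m]≡n b≤) ⟩
    s ^ suc l * (s ^ q * (s + w) ^ suc c)                 ≡⟨ i₃ (s ^ suc l) (s ^ q) (s + w) ((s + w) ^ c) ⟩
    s ^ suc l * (s + w) * (s ^ q * (s + w) ^ c)           ≡⟨ cong (s ^ suc l * (s + w) *_) (weight-power zero s w (arcsOf (suc l) U) τ) ⟨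
    s ^ suc l * (s + w) * (weight zero s w (arcsOf (suc l) U) τ * s ^ c) ≡⟨ *-assoc (s ^ suc l * (s + w)) _ (s ^ c) ⟨
    s ^ suc l * (s + w) * weight zero s w (arcsOf (suc l) U) τ * s ^ c   ∎)
    where
    a = ∣ H ─ U ∣
    b = ∣ H ∩ U ∣
    c = ∑[ ab ← arcsOf (suc l) U ] ⟦ ab onPath? (zero ∷ τ) ⟧
    q = length (arcsOf (suc l) U)
    d = suc c ∸ b
    b≤ : b ≤ suc c
    b≤ = overlap-≤ U (zero ∷ τ) uniq 2≤l H edgesOf
    size : a + b ≡ suc l
    size = trans (sym (∣p∣≡∣p─q∣+∣p∩q∣ H U)) (cycle-size 2≤l (zero ∷ τ) H uniq edgesOf)
    i₁ : ∀ a b s q c → a * b * (s * q) * c ≡ q * (a * b * (s * c))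
    i₁ = solve-∀
    i₂ : ∀ q a b x d → q * (a * b * (x * d)) ≡ a * x * (q * (b * d))
    i₂ = solve-∀
    i₃ : ∀ n q y p → n * (q * (y * p)) ≡ n * y * (q * p)
    i₃ = solve-∀

  hams : List (Graph (suc l))
  hams = filter (isHamiltonCycle? (suc l)) (subsets (length (pairs (suc l))))

  hams-unique : Uniqueˡ hams
  hams-unique = filter⁺ (isHamiltonCycle? (suc l)) (subsets-unique _)

  rooted : ∀ {H} → IsHamiltonCycle (suc l) H → ∃[ τ ] (Unique {n = suc l} (zero ∷ τ) × EdgesOf 2≤l (zero ∷ τ) H)
  rooted (_ , σ , uniq , edgesOf) with rotate-to-zero 2≤l σ uniq
  ... | τ , uniqτ , same = τ , uniqτ , λ e →
    mk⇔ (Equivalence.to (same e) ∘ Equivalence.to (edgesOf e)) (Equivalence.from (edgesOf e) ∘ Equivalence.from (same e))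

  EdgesOf-unique : ∀ {σ H H′} → EdgesOf 2≤l σ H → EdgesOf 2≤l σ H′ → H ≡ H′
  EdgesOf-unique p q = ⊆-antisym (λ {e} → Equivalence.from (q e) ∘ Equivalence.to (p e)) (λ {e} → Equivalence.from (p e) ∘ Equivalence.to (q e))

  -- Each Hamilton cycle is charged to a traversal from 0, and since a traversal determines its
  -- cycle, no path is charged twice.
  ∑-hams-≤ : (f : Graph (suc l) → ℕ) (g : Vec (Fin (suc l)) l → ℕ) →
    (∀ H τ → Unique {n = suc l} (zero ∷ τ) → EdgesOf 2≤l (zero ∷ τ) H → f H ≤ g τ) → ∑ hams f ≤ paths zero g
  ∑-hams-≤ f g f≤g = begin
    ∑ hams f
      ≤⟨ ∑-mono-∈ hams (λ {H} H∈ → represented H (proj₂ (∈-filter⁻ (isHamiltonCycle? (suc l)) {xs = subsets (length (pairs (suc l)))} H∈))) ⟩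
    ∑[ H ← hams ] ∑[ τ ← vecs l ] (⟦ fresh? (zero ∷ []) τ ⟧ * g τ * ⟦ edgesOf? 2≤l (zero ∷ τ) H ⟧)
      ≡⟨ ∑-swap hams (vecs l) ⟩
    ∑[ τ ← vecs l ] ∑[ H ← hams ] (⟦ fresh? (zero ∷ []) τ ⟧ * g τ * ⟦ edgesOf? 2≤l (zero ∷ τ) H ⟧)
      ≡⟨ ∑-cong (vecs l) (λ τ → ∑-*ˡ (⟦ fresh? (zero ∷ []) τ ⟧ * g τ) hams) ⟩
    ∑[ τ ← vecs l ] (⟦ fresh? (zero ∷ []) τ ⟧ * g τ * ∑[ H ← hams ] ⟦ edgesOf? 2≤l (zero ∷ τ) H ⟧)
      ≤⟨ ∑-mono (vecs l) (λ τ → *-monoʳ-≤ (⟦ fresh? (zero ∷ []) τ ⟧ * g τ) (∑-unique≤1 (edgesOf? 2≤l (zero ∷ τ)) hams-unique (EdgesOf-unique {zero ∷ τ}))) ⟩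
    ∑[ τ ← vecs l ] (⟦ fresh? (zero ∷ []) τ ⟧ * g τ * 1)
      ≡⟨ ∑-cong (vecs l) (λ τ → *-identityʳ (⟦ fresh? (zero ∷ []) τ ⟧ * g τ)) ⟩
    paths zero g ∎
    where
    represented : ∀ H → IsHamiltonCycle (suc l) H → f H ≤ ∑[ τ ← vecs l ] (⟦ fresh? (zero ∷ []) τ ⟧ * g τ * ⟦ edgesOf? 2≤l (zero ∷ τ) H ⟧)
    represented H ham with rooted ham
    ... | τ , uniq , edgesOf = begin
      f H          ≤⟨ f≤g H τ uniq edgesOf ⟩
      g τ          ≡⟨ trans (*-identityʳ (1 * g τ)) (*-identityˡ (g τ)) ⟨
      1 * g τ * 1  ≡⟨ cong₂ (λ x y → x * g τ * y) (⟦⟧-yes (fresh? (zero ∷ []) τ) (unique-∷⇒fresh zero τ uniq)) (⟦⟧-yes (edgesOf? 2≤l (zero ∷ τ) H) edgesOf) ⟨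
      ⟦ fresh? (zero ∷ []) τ ⟧ * g τ * ⟦ edgesOf? 2≤l (zero ∷ τ) H ⟧ ≤⟨ ∑-member (∈-vecs τ) ⟩
      ∑[ τ ← vecs l ] (⟦ fresh? (zero ∷ []) τ ⟧ * g τ * ⟦ edgesOf? 2≤l (zero ∷ τ) H ⟧) ∎

  cycleOf : Vec (Fin (suc l)) (suc l) → Graph (suc l)
  cycleOf σ = tabulate λ e → does (onCycle? (suc l) σ e)

  cycleOf-edges : ∀ σ → EdgesOf 2≤l σ (cycleOf σ)
  cycleOf-edges σ e = mk⇔ to from
    where
    at : lookup (cycleOf σ) e ≡ does (onCycle? (suc l) σ e)
    at = lookup∘tabulate _ e
    to : e ∈ cycleOf σ → OnCycle (suc l) σ e
    to e∈ = does-true (onCycle? (suc l) σ e) (trans (sym at) ([]=⇒lookup e∈))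
    from : OnCycle (suc l) σ e → e ∈ cycleOf σ
    from on = lookup⇒[]= e (cycleOf σ) (trans at (dec-true (onCycle? (suc l) σ e) on))

  cycleOf-ham : ∀ τ → Unique {n = suc l} (zero ∷ τ) → cycleOf (zero ∷ τ) ∈ˡ hams
  cycleOf-ham τ uniq = ∈-filter⁺ (isHamiltonCycle? (suc l)) (∈-subsets _) (s≤s 2≤l , zero ∷ τ , uniq , cycleOf-edges (zero ∷ τ))

  -- A Hamilton cycle is traversed from vertex 0 in at most two ways.
  !≤2*hams : l ! ≤ 2 * length hams
  !≤2*hams = begin
    l !                                          ≤⟨ ∑-fresh-≥ l (zero ∷ []) ≤-refl ⟩
    ∑[ τ ← vecs l ] ⟦ fresh? (zero ∷ []) τ ⟧     ≤⟨ ∑-mono (vecs l) has-cycle ⟩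
    ∑[ τ ← vecs l ] ∑[ H ← hams ] ⟦ traversal? H τ ⟧   ≡⟨ ∑-swap (vecs l) hams ⟩
    ∑[ H ← hams ] ∑[ τ ← vecs l ] ⟦ traversal? H τ ⟧   ≤⟨ ∑-mono hams two ⟩
    ∑[ H ← hams ] 2                              ≡⟨ ∑-const 2 hams ⟩
    length hams * 2                              ≡⟨ *-comm (length hams) 2 ⟩
    2 * length hams                              ∎
    where
    Traversal : Graph (suc l) → Vec (Fin (suc l)) l → Set
    Traversal H τ = Fresh (zero ∷ []) τ × EdgesOf 2≤l (zero ∷ τ) H
    traversal? : ∀ H τ → Dec (Traversal H τ)
    traversal? H τ = fresh? (zero ∷ []) τ ×-dec edgesOf? 2≤l (zero ∷ τ) H
    has-cycle : ∀ τ → ⟦ fresh? (zero ∷ []) τ ⟧ ≤ ∑[ H ← hams ] ⟦ traversal? H τ ⟧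
    has-cycle τ = at (fresh? (zero ∷ []) τ)
      where
      at : (d : Dec (Fresh (zero ∷ []) τ)) → ⟦ d ⟧ ≤ ∑[ H ← hams ] ⟦ traversal? H τ ⟧
      at (no _)  = z≤n
      at (yes p) = ≤-trans (≤-reflexive (sym (⟦⟧-yes (traversal? (cycleOf (zero ∷ τ)) τ) (p , cycleOf-edges (zero ∷ τ)))))
        (∑-member (cycleOf-ham τ (fresh⇒unique-∷ zero τ p)))
    unique-given : ∀ H {τ τ′} → Traversal H τ → Traversal H τ′ → (Ascending 2≤l τ → Ascending 2≤l τ′) → (Ascending 2≤l τ′ → Ascending 2≤l τ) → τ ≡ τ′
    unique-given H {τ} {τ′} (p , edgesOf) (p′ , edgesOf′) = same-direction 2≤l τ τ′ (fresh⇒unique-∷ zero τ p) (fresh⇒unique-∷ zero τ′ p′)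
      λ e → Equivalence.to (edgesOf e) ∘ Equivalence.from (edgesOf′ e)
    two : ∀ H → ∑[ τ ← vecs l ] ⟦ traversal? H τ ⟧ ≤ 2
    two H = begin
      ∑[ τ ← vecs l ] ⟦ traversal? H τ ⟧
        ≤⟨ ∑-mono (vecs l) (λ τ → ⟦⟧-⊎ (traversal? H τ) (up? τ) (down? τ) (λ t → split t (ascending? 2≤l τ))) ⟩
      ∑[ τ ← vecs l ] (⟦ up? τ ⟧ + ⟦ down? τ ⟧)                  ≡⟨ ∑-+ (vecs l) ⟩
      ∑[ τ ← vecs l ] ⟦ up? τ ⟧ + ∑[ τ ← vecs l ] ⟦ down? τ ⟧
        ≤⟨ +-mono-≤ (∑-unique≤1 up? (vecs-unique l) λ (t , a) (t′ , a′) → unique-given H t t′ (λ _ → a′) (λ _ → a))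
                    (∑-unique≤1 down? (vecs-unique l) λ (t , ¬a) (t′ , ¬a′) → unique-given H t t′ (λ a → contradiction a ¬a) (λ a′ → contradiction a′ ¬a′)) ⟩
      2 ∎
      where
      up? : ∀ τ → Dec (Traversal H τ × Ascending 2≤l τ)
      up? τ = traversal? H τ ×-dec ascending? 2≤l τ
      down? : ∀ τ → Dec (Traversal H τ × ¬ Ascending 2≤l τ)
      down? τ = traversal? H τ ×-dec ¬? (ascending? 2≤l τ)
      split : ∀ {τ} → Traversal H τ → Dec (Ascending 2≤l τ) → (Traversal H τ × Ascending 2≤l τ) ⊎ (Traversal H τ × ¬ Ascending 2≤l τ)
      split t (yes a) = inj₁ (t , a)
      split t (no ¬a) = inj₂ (t , ¬a)

-- Conditional expectations and moments

C-step : ∀ t s x → x < s → s ≤ t →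
  ((t ∸ x) C (s ∸ x)) * (s ∸ x) ≡ ((t ∸ suc x) C (s ∸ suc x)) * (t ∸ x)
C-step (suc t) (suc s) zero    _         _         = trans (*-comm _ (suc s)) (trans (C-absorption t s) (*-comm (suc t) _))
C-step (suc t) (suc s) (suc x) (s≤s x<s) (s≤s s≤t) = C-step t s x x<s s≤t

-- The quotient of the binomial coefficients is the product of (s - i)/(t - i) over i < x, and s ≤ t
-- makes each factor at most s/t.
C-ratio-≤ : ∀ t s x → x ≤ s → s ≤ t → ((t ∸ x) C (s ∸ x)) * t ^ x ≤ (t C s) * s ^ x
C-ratio-≤ t s zero    _   _   = ≤-refl
C-ratio-≤ t s (suc x) x<s s≤t = begin
  c′ * (t * t ^ x)    ≡⟨ *-assoc c′ t (t ^ x) ⟨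
  c′ * t * t ^ x      ≤⟨ *-monoˡ-≤ (t ^ x) step ⟩
  c * s * t ^ x       ≡⟨ i₁ c s (t ^ x) ⟩
  c * t ^ x * s       ≤⟨ *-monoˡ-≤ s (C-ratio-≤ t s x (<⇒≤ x<s) s≤t) ⟩
  (t C s) * s ^ x * s ≡⟨ i₂ (t C s) (s ^ x) s ⟩
  (t C s) * (s * s ^ x) ∎
  where
  c c′ : ℕ
  c = (t ∸ x) C (s ∸ x)
  c′ = (t ∸ suc x) C (s ∸ suc x)
  i₁ : ∀ c s p → c * s * p ≡ c * p * s
  i₁ = solve-∀
  i₂ : ∀ c p s → c * p * s ≡ c * (s * p)
  i₂ = solve-∀
  x≤s = <⇒≤ x<s
  x≤t = ≤-trans x≤s s≤t
  i₃ : ∀ a x b → a * (b + x) ≡ a * b + a * x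
  i₃ = solve-∀
  i₄ : ∀ a x b → a * b + b * x ≡ (a + x) * b
  i₄ = solve-∀
  cross : (s ∸ x) * t ≤ s * (t ∸ x)
  cross = begin
    (s ∸ x) * t                           ≡⟨ cong ((s ∸ x) *_) (m∸n+n≡m x≤t) ⟨
    (s ∸ x) * (t ∸ x + x)                 ≡⟨ i₃ (s ∸ x) x (t ∸ x) ⟩
    (s ∸ x) * (t ∸ x) + (s ∸ x) * x       ≤⟨ +-monoʳ-≤ _ (*-monoˡ-≤ x (∸-monoˡ-≤ x s≤t)) ⟩
    (s ∸ x) * (t ∸ x) + (t ∸ x) * x       ≡⟨ i₄ (s ∸ x) x (t ∸ x) ⟩
    (s ∸ x + x) * (t ∸ x)                 ≡⟨ cong (_* (t ∸ x)) (m∸n+n≡m x≤s) ⟩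
    s * (t ∸ x)                           ∎
  i₅ : ∀ c t d → c * t * d ≡ c * d * t
  i₅ = solve-∀
  step : c′ * t ≤ c * s
  step = *-cancelʳ-≤ _ _ (t ∸ x) {{>-nonZero (m<n⇒0<n∸m (<-≤-trans x<s s≤t))}} (begin
    c′ * t * (t ∸ x)       ≡⟨ i₅ c′ t (t ∸ x) ⟩
    c′ * (t ∸ x) * t       ≡⟨ cong (_* t) (C-step t s x x<s s≤t) ⟨
    c * (s ∸ x) * t        ≡⟨ *-assoc c (s ∸ x) t ⟩
    c * ((s ∸ x) * t)      ≤⟨ *-monoʳ-≤ c cross ⟩
    c * (s * (t ∸ x))      ≡⟨ *-assoc c s (t ∸ x) ⟨
    c * s * (t ∸ x)        ∎)

-- In the same product every numerator is at least s - y and every denominator at most t.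
C-ratio-≥ : ∀ t s y x → x ≤ y → y ≤ s → s ≤ t → (t C s) * (s ∸ y) ^ x ≤ ((t ∸ x) C (s ∸ x)) * t ^ x
C-ratio-≥ t s y zero    _   _   _   = ≤-refl
C-ratio-≥ t s y (suc x) x<y y≤s s≤t = begin
  (t C s) * ((s ∸ y) * (s ∸ y) ^ x)     ≡⟨ i₁ (t C s) (s ∸ y) ((s ∸ y) ^ x) ⟩
  (t C s) * (s ∸ y) ^ x * (s ∸ y)       ≤⟨ *-monoˡ-≤ (s ∸ y) (C-ratio-≥ t s y x (<⇒≤ x<y) y≤s s≤t) ⟩
  c * t ^ x * (s ∸ y)                   ≤⟨ *-monoʳ-≤ (c * t ^ x) (∸-monoʳ-≤ s (<⇒≤ x<y)) ⟩
  c * t ^ x * (s ∸ x)                   ≡⟨ i₂ c (t ^ x) (s ∸ x) ⟩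
  c * (s ∸ x) * t ^ x                   ≡⟨ cong (_* t ^ x) (C-step t s x (<-≤-trans x<y y≤s) s≤t) ⟩
  c′ * (t ∸ x) * t ^ x                  ≤⟨ *-monoˡ-≤ (t ^ x) (*-monoʳ-≤ c′ (m∸n≤m t x)) ⟩
  c′ * t * t ^ x                        ≡⟨ *-assoc c′ t (t ^ x) ⟩
  c′ * (t * t ^ x)                      ∎
  where
  c c′ : ℕ
  c = (t ∸ x) C (s ∸ x)
  c′ = (t ∸ suc x) C (s ∸ suc x)
  i₁ : ∀ c d p → c * (d * p) ≡ c * p * d
  i₁ = solve-∀
  i₂ : ∀ c p d → c * p * d ≡ c * d * p
  i₂ = solve-∀

-- The 4096 D is the product of 1024 from `combine`, 2 for the two traversals of a cycle, and 2D for
-- the factor (s + w)/s of the closing edge. The power of 8 comes from `m^n≤`.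
constant : ℕ → ℕ
constant D = 4096 * D * 8 ^ (8 * D)

module _ {l : ℕ} (2≤l : 2 ≤ l) (m : ℕ) where

  private
    size : ℕ
    size = length (pairs (suc l))

  extensions : Graph (suc l) → ℕ
  extensions V = ∑[ G ← graphs (suc l) m ] ⟦ V ⊆? G ⟧

  extensions-C : ∀ V → ∣ V ∣ ≤ m → extensions V ≡ (size ∸ ∣ V ∣) C (m ∸ ∣ V ∣)
  extensions-C V |V|≤m = begin-equality
    extensions V                                                                 ≡⟨ ∑-filter (λ G → ∣ G ∣ ≟ m) (subsets size) ⟩
    ∑[ G ← subsets size ] (⟦ ∣ G ∣ ≟ m ⟧ * ⟦ V ⊆? G ⟧)                           ≡⟨ cong (λ z → ∑[ G ← subsets size ] (⟦ ∣ G ∣ ≟ z ⟧ * ⟦ V ⊆? G ⟧)) (m+[n∸m]≡n |V|≤m) ⟨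
    ∑[ G ← subsets size ] (⟦ ∣ G ∣ ≟ ∣ V ∣ + (m ∸ ∣ V ∣) ⟧ * ⟦ V ⊆? G ⟧)         ≡⟨ supersets V (m ∸ ∣ V ∣) ⟩
    (size ∸ ∣ V ∣) C (m ∸ ∣ V ∣)                                                 ∎

  private
    X : Graph (suc l) → ℕ
    X = hamiltonCycles (suc l)

  hamiltonCycles-∑ : ∀ G → X G ≡ ∑[ H ← hams 2≤l ] ⟦ H ⊆? G ⟧
  hamiltonCycles-∑ G = begin-equality
    X G                                                                       ≡⟨ length-filter _ (subsets size) ⟩
    ∑[ H ← subsets size ] ⟦ (H ⊆? G) ×-dec isHamiltonCycle? (suc l) H ⟧       ≡⟨ ∑-cong (subsets size) (λ H → trans (⟦⟧-× (H ⊆? G) (isHamiltonCycle? (suc l) H)) (*-comm ⟦ H ⊆? G ⟧ _)) ⟩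
    ∑[ H ← subsets size ] (⟦ isHamiltonCycle? (suc l) H ⟧ * ⟦ H ⊆? G ⟧)       ≡⟨ ∑-filter (isHamiltonCycle? (suc l)) (subsets size) ⟨
    ∑[ H ← hams 2≤l ] ⟦ H ⊆? G ⟧                                              ∎

  ham-size : ∀ {H} → H ∈ˡ hams 2≤l → ∣ H ∣ ≡ suc l
  ham-size {H} H∈ = cycle-size 2≤l (zero ∷ proj₁ root) H (proj₁ (proj₂ root)) (proj₂ (proj₂ root))
    where
    root : ∃[ τ ] (Unique {n = suc l} (zero ∷ τ) × EdgesOf 2≤l (zero ∷ τ) H)
    root = rooted 2≤l (proj₂ (∈-filter⁻ (isHamiltonCycle? (suc l)) {xs = subsets size} H∈))

  -- Divided by `extensions U`, this is the conditional expectation of X^j given that `U` is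
  -- contained in G(n,m).
  moment : ℕ → Graph (suc l) → ℕ
  moment j U = ∑[ G ← graphs (suc l) m ] (⟦ U ⊆? G ⟧ * X G ^ j)

  moment-suc : ∀ j U → moment (suc j) U ≡ ∑[ H ← hams 2≤l ] moment j (U ∪ H)
  moment-suc j U = trans (∑-cong (graphs (suc l) m) expand) (∑-swap (graphs (suc l) m) (hams 2≤l))
    where
    i₁ : ∀ a x p → a * (x * p) ≡ a * p * x
    i₁ = solve-∀
    i₂ : ∀ a p h → a * p * h ≡ a * h * p
    i₂ = solve-∀
    expand : ∀ G → ⟦ U ⊆? G ⟧ * X G ^ suc j ≡ ∑[ H ← hams 2≤l ] (⟦ U ∪ H ⊆? G ⟧ * X G ^ j)
    expand G = begin-equality
      ⟦ U ⊆? G ⟧ * (X G * X G ^ j)                               ≡⟨ i₁ ⟦ U ⊆? G ⟧ (X G) (X G ^ j) ⟩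
      ⟦ U ⊆? G ⟧ * X G ^ j * X G                                 ≡⟨ cong (⟦ U ⊆? G ⟧ * X G ^ j *_) (hamiltonCycles-∑ G) ⟩
      ⟦ U ⊆? G ⟧ * X G ^ j * ∑[ H ← hams 2≤l ] ⟦ H ⊆? G ⟧        ≡⟨ ∑-*ˡ (⟦ U ⊆? G ⟧ * X G ^ j) (hams 2≤l) ⟨
      ∑[ H ← hams 2≤l ] (⟦ U ⊆? G ⟧ * X G ^ j * ⟦ H ⊆? G ⟧)      ≡⟨ ∑-cong (hams 2≤l) (λ H → trans (i₂ ⟦ U ⊆? G ⟧ (X G ^ j) ⟦ H ⊆? G ⟧) (cong (_* X G ^ j) (sym (⟦∪⊆⟧ U H G)))) ⟩
      ∑[ H ← hams 2≤l ] (⟦ U ∪ H ⊆? G ⟧ * X G ^ j)               ∎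

  moment-0 : ∀ U → moment 0 U ≡ extensions U
  moment-0 U = ∑-cong (graphs (suc l) m) λ G → *-identityʳ ⟦ U ⊆? G ⟧

  moment-1 : ∀ U → moment 1 U ≡ ∑[ H ← hams 2≤l ] extensions (U ∪ H)
  moment-1 U = trans (moment-suc 0 U) (∑-cong (hams 2≤l) λ H → moment-0 (U ∪ H))

  ⟦⊥⊆⟧ : ∀ (G : Graph (suc l)) → ⟦ ⊥ ⊆? G ⟧ ≡ 1
  ⟦⊥⊆⟧ G = ⟦⟧-yes (⊥ ⊆? G) ⊥⊆

  moment-⊥ : ∀ j → moment j ⊥ ≡ ∑[ G ← graphs (suc l) m ] (X G ^ j)
  moment-⊥ j = ∑-cong (graphs (suc l) m) λ G → trans (cong (_* X G ^ j) (⟦⊥⊆⟧ G)) (*-identityˡ (X G ^ j))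

  extensions-⊥ : extensions ⊥ ≡ length (graphs (suc l) m)
  extensions-⊥ = trans (∑-cong (graphs (suc l) m) ⟦⊥⊆⟧) (trans (∑-const 1 (graphs (suc l) m)) (*-identityʳ _))

  -- `first` handles one factor of X under any condition of at most kn edges. Each Hamilton cycle
  -- added to the condition brings at most n new edges, so ∣U∣ + jn ≤ kn is preserved as `j` drops.
  moments-≤ : ∀ c k →
    (∀ U → ∣ U ∣ ≤ k * suc l → extensions ⊥ * moment 1 U ≤ c * moment 1 ⊥ * extensions U) →
    ∀ j U → ∣ U ∣ + j * suc l ≤ k * suc l → moment j U * extensions ⊥ ^ j ≤ (c * moment 1 ⊥) ^ j * extensions U
  moments-≤ c k first zero U _ = ≤-reflexive (trans (*-identityʳ _) (trans (moment-0 U) (sym (*-identityˡ _))))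
  moments-≤ c k first (suc j) U small = begin
    moment (suc j) U * (e * e ^ j)                        ≡⟨ cong (_* (e * e ^ j)) (moment-suc j U) ⟩
    ∑[ H ← hams 2≤l ] moment j (U ∪ H) * (e * e ^ j)      ≡⟨ i₁ (∑[ H ← hams 2≤l ] moment j (U ∪ H)) e (e ^ j) ⟩
    e * (∑[ H ← hams 2≤l ] moment j (U ∪ H) * e ^ j)      ≡⟨ cong (e *_) (∑-*ʳ (e ^ j) (hams 2≤l)) ⟨
    e * ∑[ H ← hams 2≤l ] (moment j (U ∪ H) * e ^ j)      ≤⟨ *-monoʳ-≤ e (∑-mono-∈ (hams 2≤l) λ {H} H∈ → moments-≤ c k first j (U ∪ H) (grown H∈)) ⟩
    e * ∑[ H ← hams 2≤l ] (b ^ j * extensions (U ∪ H))    ≡⟨ cong (e *_) (trans (∑-*ˡ (b ^ j) (hams 2≤l)) (cong (b ^ j *_) (sym (moment-1 U)))) ⟩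
    e * (b ^ j * moment 1 U)                              ≡⟨ i₂ e (b ^ j) (moment 1 U) ⟩
    b ^ j * (e * moment 1 U)                              ≤⟨ *-monoʳ-≤ (b ^ j) (first U (m+n≤o⇒m≤o ∣ U ∣ small)) ⟩
    b ^ j * (b * extensions U)                            ≡⟨ i₃ (b ^ j) b (extensions U) ⟩
    b * b ^ j * extensions U                              ∎
    where
    e = extensions ⊥
    b = c * moment 1 ⊥
    i₁ : ∀ x e p → x * (e * p) ≡ e * (x * p)
    i₁ = solve-∀
    i₂ : ∀ e p x → e * (p * x) ≡ p * (e * x)
    i₂ = solve-∀
    i₃ : ∀ p b x → p * (b * x) ≡ b * p * x
    i₃ = solve-∀
    grown : ∀ {H} → H ∈ˡ hams 2≤l → ∣ U ∪ H ∣ + j * suc l ≤ k * suc l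
    grown {H} H∈ = begin
      ∣ U ∪ H ∣ + j * suc l             ≡⟨ cong (_+ j * suc l) (∣p∪q∣≡∣p∣+∣q─p∣ U H) ⟩
      ∣ U ∣ + ∣ H ─ U ∣ + j * suc l     ≤⟨ +-monoˡ-≤ (j * suc l) (+-monoʳ-≤ ∣ U ∣ (≤-trans (m≤m+n ∣ H ─ U ∣ ∣ H ∩ U ∣) (≤-reflexive (trans (sym (∣p∣≡∣p─q∣+∣p∩q∣ H U)) (ham-size H∈))))) ⟩
      ∣ U ∣ + suc l + j * suc l         ≡⟨ +-assoc ∣ U ∣ (suc l) (j * suc l) ⟩
      ∣ U ∣ + suc j * suc l             ≤⟨ small ⟩
      k * suc l                         ∎

  module _ (k D : ℕ) (1≤k : 1 ≤ k) (1≤D : 1 ≤ D) (m≤N : m ≤ size) (N≤Dm : size ≤ D * m)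
           (large : 4096 * (k * D * (k * D)) ≤ suc l) where

    private
      2size≡ : 2 * size ≡ suc l * l
      2size≡ = trans (cong (2 *_) (length-pairs (suc l))) (2*nC2 l)
      2size≤n² : 2 * size ≤ suc l * suc l
      2size≤n² = ≤-trans (≤-reflexive 2size≡) (*-monoʳ-≤ (suc l) (n≤1+n l))
      n²≤4size : suc l * suc l ≤ 4 * size
      n²≤4size = begin
        suc l * suc l           ≤⟨ *-monoʳ-≤ (suc l) (+-mono-≤ {1} {l} (<⇒≤ 2≤l) (≤-refl {l})) ⟩
        suc l * (l + l)         ≡⟨ i₁ (suc l) l ⟩
        2 * (suc l * l)         ≡⟨ cong (2 *_) 2size≡ ⟨
        2 * (2 * size)          ≡⟨ *-assoc 2 2 size ⟨
        4 * size                ∎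
        where
        i₁ : ∀ n l → n * (l + l) ≡ 2 * (n * l)
        i₁ = solve-∀

    module _ (U : Graph (suc l)) (u≤kn : ∣ U ∣ ≤ k * suc l)
             (s w : ℕ) (m≡ : m ≡ s + ∣ U ∣) (N≡ : size ≡ s + ∣ U ∣ + w) where

      private
        u n q t : ℕ
        u = ∣ U ∣
        n = suc l
        q = length (arcsOf n U)
        t = s + w
        module R = Dense n k D s u w (s≤s z≤n) 1≤D 1≤k (subst (λ z → n * n ≤ 4 * z) N≡ n²≤4size) (subst (λ z → 2 * z ≤ n * n) N≡ 2size≤n²)
          (≤-trans (≤-reflexive (sym N≡)) (≤-trans N≤Dm (≤-reflexive (cong (D *_) m≡)))) large u≤kn
        h = length (hams 2≤l)
        f : Graph n → ℕ
        f H = s ^ ∣ H ─ U ∣ * t ^ ∣ H ∩ U ∣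
        F : ℕ
        F = weighted zero s w [] (arcsOf n U)
        instance
          s≢0 : NonZero s
          s≢0 = R.s≢0

      path-sum : F * (s * R.N) ^ n ≤ 1024 * (l ! * s ^ q * R.X ^ n)
      path-sum = R.combine F (l !) q (length-arcsOf n U)
        (≤-trans (weighted-≤ zero s w R.M R.L R.M+L≡n (arcsOf n U) [] (arcsOf-unique n U) [] (All.universal (λ _ ()) (arcsOf n U)))
          (≤-reflexive (cong (λ z → l ! * (8 ^ R.L * n ^ q * (s * R.M + w) ^ q + z * (s * n + 64 * w) ^ q)) (*-identityʳ (R.M ^ q)))))

      -- As X = mt, division by h N^n t^n shows what this means: the average of (s/t)^∣H ─ U∣ over
      -- all Hamilton cycles H is at most 4096 D (m/N)^n, so the unconditional density reappears.
      cycle-sum : ∑ (hams 2≤l) f * R.N ^ n ≤ 4096 * D * h * R.X ^ n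
      cycle-sum = *-cancelʳ-≤ _ _ (s ^ suc q * s ^ n) {{m*n≢0 _ _ {{m^n≢0 s (suc q)}} {{m^n≢0 s n}}}} (begin
        ∑ (hams 2≤l) f * R.N ^ n * (s ^ suc q * s ^ n)             ≡⟨ i₁ (∑ (hams 2≤l) f) (R.N ^ n) (s ^ suc q) (s ^ n) ⟩
        ∑ (hams 2≤l) f * s ^ suc q * (s ^ n * R.N ^ n)             ≡⟨ cong₂ _*_ (∑-*ʳ (s ^ suc q) (hams 2≤l)) (*-^ s R.N n) ⟨
        ∑[ H ← hams 2≤l ] (f H * s ^ suc q) * (s * R.N) ^ n        ≤⟨ *-monoˡ-≤ ((s * R.N) ^ n) (∑-hams-≤ 2≤l (λ H → f H * s ^ suc q) _ (cycle-weight-≤ 2≤l s w U)) ⟩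
        paths zero (λ τ → s ^ n * t * weight zero s w (arcsOf n U) τ) * (s * R.N) ^ n ≡⟨ cong (_* (s * R.N) ^ n) pull ⟩
        s ^ n * t * F * (s * R.N) ^ n                              ≡⟨ *-assoc (s ^ n * t) F _ ⟩
        s ^ n * t * (F * (s * R.N) ^ n)                            ≤⟨ *-mono-≤ (*-monoʳ-≤ (s ^ n) R.s+w≤2Ds) (≤-trans path-sum (*-monoʳ-≤ 1024 (*-monoˡ-≤ (R.X ^ n) (*-monoˡ-≤ (s ^ q) (!≤2*hams 2≤l))))) ⟩
        s ^ n * (2 * D * s) * (1024 * (2 * h * s ^ q * R.X ^ n))   ≡⟨ i₂ (s ^ n) D s h (s ^ q) (R.X ^ n) ⟩
        4096 * D * h * R.X ^ n * (s * s ^ q * s ^ n)               ∎)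
        where
        i₁ : ∀ f N x y → f * N * (x * y) ≡ f * x * (y * N)
        i₁ = solve-∀
        i₂ : ∀ p D s h q X → p * (2 * D * s) * (1024 * (2 * h * q * X)) ≡ 4096 * D * h * X * (s * q * p)
        i₂ = solve-∀
        i₃ : ∀ a c x → a * (c * x) ≡ c * (a * (1 * x))
        i₃ = solve-∀
        pull : paths zero (λ τ → s ^ n * t * weight zero s w (arcsOf n U) τ) ≡ s ^ n * t * F
        pull = trans (∑-cong (vecs l) λ τ → i₃ ⟦ fresh? (zero ∷ []) τ ⟧ (s ^ n * t) (weight zero s w (arcsOf n U) τ)) (∑-*ˡ (s ^ n * t) (vecs l))

      extensions-U : extensions U ≡ t C s
      extensions-U = trans (extensions-C U (≤-trans (m≤n+m u s) (≤-reflexive (sym m≡))))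
        (cong₂ _C_ (trans (cong (_∸ u) (trans N≡ (i₁ s u w))) (m+n∸n≡m t u)) (trans (cong (_∸ u) m≡) (m+n∸n≡m s u)))
        where
        i₁ : ∀ s u w → s + u + w ≡ s + w + u
        i₁ = solve-∀

      -- Given `U`, the other `s` edges are a uniform choice among `t` pairs, and `H` needs `x` of
      -- them. This has probability at most (s/t)^x, which is f H / t^n.
      extension-≤ : ∀ {H} → H ∈ˡ hams 2≤l → extensions (U ∪ H) * t ^ n ≤ extensions U * f H
      extension-≤ {H} H∈ = begin
        extensions (U ∪ H) * t ^ n            ≡⟨ cong₂ _*_ (trans (extensions-C (U ∪ H) within) (cong₂ _C_ N-step m-step)) (trans (cong (t ^_) (sym x+y≡n)) (^-distribˡ-+-* t x y)) ⟩
        ((t ∸ x) C (s ∸ x)) * (t ^ x * t ^ y) ≡⟨ *-assoc ((t ∸ x) C (s ∸ x)) (t ^ x) (t ^ y) ⟨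
        ((t ∸ x) C (s ∸ x)) * t ^ x * t ^ y   ≤⟨ *-monoˡ-≤ (t ^ y) (C-ratio-≤ t s x x≤s (m≤m+n s w)) ⟩
        (t C s) * s ^ x * t ^ y               ≡⟨ *-assoc (t C s) (s ^ x) (t ^ y) ⟩
        (t C s) * f H                         ≡⟨ cong (_* f H) extensions-U ⟨
        extensions U * f H                    ∎
        where
        x = ∣ H ─ U ∣
        y = ∣ H ∩ U ∣
        x+y≡n : x + y ≡ n
        x+y≡n = trans (sym (∣p∣≡∣p─q∣+∣p∩q∣ H U)) (ham-size H∈)
        x≤s : x ≤ s
        x≤s = ≤-trans (≤-trans (m≤m+n x y) (≤-reflexive x+y≡n)) R.n≤s
        |U∪H|≡ : ∣ U ∪ H ∣ ≡ u + x
        |U∪H|≡ = ∣p∪q∣≡∣p∣+∣q─p∣ U H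
        within : ∣ U ∪ H ∣ ≤ m
        within = begin
          ∣ U ∪ H ∣   ≡⟨ |U∪H|≡ ⟩
          u + x       ≤⟨ +-monoʳ-≤ u x≤s ⟩
          u + s       ≡⟨ +-comm u s ⟩
          s + u       ≡⟨ m≡ ⟨
          m           ∎
        drop-u : ∀ z → z + u ∸ (u + x) ≡ z ∸ x
        drop-u z = trans (sym (∸-+-assoc (z + u) u x)) (cong (_∸ x) (m+n∸n≡m z u))
        i₁ : ∀ s u w → s + u + w ≡ s + w + u
        i₁ = solve-∀
        N-step : size ∸ ∣ U ∪ H ∣ ≡ t ∸ x
        N-step = trans (cong₂ _∸_ (trans N≡ (i₁ s u w)) |U∪H|≡) (drop-u t)
        m-step : m ∸ ∣ U ∪ H ∣ ≡ s ∸ x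
        m-step = trans (cong₂ _∸_ m≡ |U∪H|≡) (drop-u s)

      mean : moment 1 ⊥ ≡ h * ((size ∸ n) C (m ∸ n))
      mean = begin-equality
        moment 1 ⊥                                      ≡⟨ moment-⊥ 1 ⟩
        ∑[ G ← graphs n m ] (X G * 1)                   ≡⟨ ∑-cong (graphs n m) (λ G → trans (*-identityʳ (X G)) (hamiltonCycles-∑ G)) ⟩
        ∑[ G ← graphs n m ] ∑[ H ← hams 2≤l ] ⟦ H ⊆? G ⟧  ≡⟨ ∑-swap (graphs n m) (hams 2≤l) ⟩
        ∑[ H ← hams 2≤l ] extensions H
          ≡⟨ ≤-antisym (∑-mono-∈ (hams 2≤l) λ H∈ → ≤-reflexive (at H∈)) (∑-mono-∈ (hams 2≤l) λ H∈ → ≤-reflexive (sym (at H∈))) ⟩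
        ∑[ H ← hams 2≤l ] ((size ∸ n) C (m ∸ n))        ≡⟨ ∑-const _ (hams 2≤l) ⟩
        h * ((size ∸ n) C (m ∸ n))                      ∎
        where
        n≤m : n ≤ m
        n≤m = ≤-trans R.n≤s (≤-trans (m≤m+n s u) (≤-reflexive (sym m≡)))
        at : ∀ {H} → H ∈ˡ hams 2≤l → extensions H ≡ (size ∸ n) C (m ∸ n)
        at {H} H∈ = trans (extensions-C H (≤-trans (≤-reflexive (ham-size H∈)) n≤m)) (cong (λ z → (size ∸ z) C (m ∸ z)) (ham-size H∈))

      -- Since n² is at most of order `m`, choosing the edges without replacement lowers the
      -- probability of a fixed cycle below (m/N)^n by no more than the factor 8^(8D).
      mean-≥ : extensions ⊥ * m ^ n ≤ 8 ^ (8 * D) * (((size ∸ n) C (m ∸ n)) * size ^ n)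
      mean-≥ = begin
        extensions ⊥ * m ^ n                              ≤⟨ *-monoʳ-≤ (extensions ⊥) (subst (λ z → z ^ n ≤ 8 ^ (8 * D) * (z ∸ n) ^ n) (sym m≡) R.m^n≤) ⟩
        extensions ⊥ * (8 ^ (8 * D) * (m ∸ n) ^ n)        ≡⟨ cong (_* (8 ^ (8 * D) * (m ∸ n) ^ n)) (trans (extensions-C ⊥ (subst (_≤ m) (sym (∣⊥∣≡0 size)) z≤n)) (cong (λ z → (size ∸ z) C (m ∸ z)) (∣⊥∣≡0 size))) ⟩
        (size C m) * (8 ^ (8 * D) * (m ∸ n) ^ n)          ≡⟨ i₁ (size C m) (8 ^ (8 * D)) ((m ∸ n) ^ n) ⟩
        8 ^ (8 * D) * ((size C m) * (m ∸ n) ^ n)          ≤⟨ *-monoʳ-≤ (8 ^ (8 * D)) (C-ratio-≥ size m n n ≤-refl n≤m m≤N) ⟩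
        8 ^ (8 * D) * (((size ∸ n) C (m ∸ n)) * size ^ n) ∎
        where
        n≤m : n ≤ m
        n≤m = ≤-trans R.n≤s (≤-trans (m≤m+n s u) (≤-reflexive (sym m≡)))
        i₁ : ∀ c e p → c * (e * p) ≡ e * (c * p)
        i₁ = solve-∀

      conditional-mean-≤′ : extensions ⊥ * moment 1 U ≤ constant D * moment 1 ⊥ * extensions U
      conditional-mean-≤′ = *-cancelʳ-≤ _ _ (t ^ n * R.N ^ n) {{m*n≢0 _ _ {{m^n≢0 t n {{t≢0}}}} {{m^n≢0 R.N n {{R.N≢0}}}}}} (begin
        e * moment 1 U * (t ^ n * R.N ^ n)                            ≡⟨ i₁ e (moment 1 U) (t ^ n) (R.N ^ n) ⟩
        e * R.N ^ n * (moment 1 U * t ^ n)                            ≡⟨ cong (e * R.N ^ n *_) (trans (cong (_* t ^ n) (moment-1 U)) (sym (∑-*ʳ (t ^ n) (hams 2≤l)))) ⟩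
        e * R.N ^ n * ∑[ H ← hams 2≤l ] (extensions (U ∪ H) * t ^ n)  ≤⟨ *-monoʳ-≤ (e * R.N ^ n) (∑-mono-∈ (hams 2≤l) extension-≤) ⟩
        e * R.N ^ n * ∑[ H ← hams 2≤l ] (extensions U * f H)          ≡⟨ cong (e * R.N ^ n *_) (∑-*ˡ (extensions U) (hams 2≤l)) ⟩
        e * R.N ^ n * (extensions U * ∑ (hams 2≤l) f)                 ≡⟨ i₂ e (R.N ^ n) (extensions U) (∑ (hams 2≤l) f) ⟩
        e * extensions U * (∑ (hams 2≤l) f * R.N ^ n)                 ≤⟨ *-monoʳ-≤ (e * extensions U) cycle-sum ⟩
        e * extensions U * (4096 * D * h * R.X ^ n)                   ≡⟨ cong (λ z → e * extensions U * (4096 * D * h * z)) (trans (cong (_^ n) X≡) (*-^ m t n)) ⟩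
        e * extensions U * (4096 * D * h * (m ^ n * t ^ n))           ≡⟨ i₃ e (extensions U) D h (m ^ n) (t ^ n) ⟩
        4096 * D * h * extensions U * t ^ n * (e * m ^ n)             ≤⟨ *-monoʳ-≤ (4096 * D * h * extensions U * t ^ n) mean-≥ ⟩
        4096 * D * h * extensions U * t ^ n * (8 ^ (8 * D) * (((size ∸ n) C (m ∸ n)) * size ^ n))
          ≡⟨ cong (λ z → 4096 * D * h * extensions U * t ^ n * (8 ^ (8 * D) * (((size ∸ n) C (m ∸ n)) * z ^ n))) N≡ ⟩
        4096 * D * h * extensions U * t ^ n * (8 ^ (8 * D) * (((size ∸ n) C (m ∸ n)) * R.N ^ n))
          ≡⟨ i₄ D h (extensions U) (t ^ n) (8 ^ (8 * D)) ((size ∸ n) C (m ∸ n)) (R.N ^ n) ⟩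
        4096 * D * 8 ^ (8 * D) * (h * ((size ∸ n) C (m ∸ n))) * extensions U * (t ^ n * R.N ^ n)
          ≡⟨ cong (λ z → constant D * z * extensions U * (t ^ n * R.N ^ n)) mean ⟨
        constant D * moment 1 ⊥ * extensions U * (t ^ n * R.N ^ n)    ∎)
        where
        e = extensions ⊥
        t≢0 : NonZero t
        t≢0 = >-nonZero (≤-trans (>-nonZero⁻¹ s) (m≤m+n s w))
        X≡ : R.X ≡ m * t
        X≡ = trans (i₀ s u w) (cong (_* t) (sym m≡))
          where
          i₀ : ∀ s u w → s * (s + u + w) + u * w ≡ (s + u) * (s + w)
          i₀ = solve-∀
        i₁ : ∀ e x p q → e * x * (p * q) ≡ e * q * (x * p)
        i₁ = solve-∀
        i₂ : ∀ e q x f → e * q * (x * f) ≡ e * x * (f * q)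
        i₂ = solve-∀
        i₃ : ∀ e x D h p q → e * x * (4096 * D * h * (p * q)) ≡ 4096 * D * h * x * q * (e * p)
        i₃ = solve-∀
        i₄ : ∀ D h x t c g N → 4096 * D * h * x * t * (c * (g * N)) ≡ 4096 * D * c * (h * g) * x * (t * N)
        i₄ = solve-∀

    conditional-mean-≤ : ∀ U → ∣ U ∣ ≤ k * suc l → extensions ⊥ * moment 1 U ≤ constant D * moment 1 ⊥ * extensions U
    conditional-mean-≤ U u≤kn = conditional-mean-≤′ U u≤kn (m ∸ ∣ U ∣) (size ∸ m) (sym (m∸n+n≡m u≤m))
      (sym (trans (cong (_+ (size ∸ m)) (m∸n+n≡m u≤m)) (m+[n∸m]≡n m≤N)))
      where
      N≡ : size ≡ m + 0 + (size ∸ m)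
      N≡ = sym (trans (cong (_+ (size ∸ m)) (+-identityʳ m)) (m+[n∸m]≡n m≤N))
      -- Writing m as s + ∣U∣ presupposes ∣U∣ ≤ m, so the range estimates are applied here with
      -- nothing prescribed, that is with u = 0.
      module R = Dense (suc l) k D m 0 (size ∸ m) (s≤s z≤n) 1≤D 1≤k
        (subst (λ z → suc l * suc l ≤ 4 * z) N≡ n²≤4size) (subst (λ z → 2 * z ≤ suc l * suc l) N≡ 2size≤n²)
        (subst (λ z → z ≤ D * (m + 0)) N≡ (subst (λ z → size ≤ D * z) (sym (+-identityʳ m)) N≤Dm)) large z≤n
      u≤m : ∣ U ∣ ≤ m
      u≤m = ≤-trans u≤kn (≤-trans (m≤n*m (k * suc l) 4) (subst (4 * (k * suc l) ≤_) (+-identityʳ m) R.4kn≤m))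

    moment-≤ : ∑[ G ← graphs (suc l) m ] (X G ^ k) * length (graphs (suc l) m) ^ k ≤
               (constant D * ∑[ G ← graphs (suc l) m ] X G) ^ k * length (graphs (suc l) m)
    moment-≤ = begin
      ∑[ G ← graphs (suc l) m ] (X G ^ k) * length (graphs (suc l) m) ^ k
        ≡⟨ cong₂ (λ x y → x * y ^ k) (moment-⊥ k) extensions-⊥ ⟨
      moment k ⊥ * extensions ⊥ ^ k
        ≤⟨ moments-≤ (constant D) k conditional-mean-≤ k ⊥ (≤-reflexive (cong (_+ k * suc l) (∣⊥∣≡0 size))) ⟩
      (constant D * moment 1 ⊥) ^ k * extensions ⊥
        ≡⟨ cong₂ (λ x y → (constant D * x) ^ k * y) (trans (moment-⊥ 1) (∑-cong (graphs (suc l) m) (λ G → *-identityʳ (X G)))) extensions-⊥ ⟩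
      (constant D * ∑[ G ← graphs (suc l) m ] X G) ^ k * length (graphs (suc l) m) ∎

-- The range of k and the choice of the constants

-- The fourth term of the exponential series gives (8k)⁴/4! ≤ n, and 8⁴ = 4096 exceeds 4! = 24.
log-power : ∀ k n → (8 * k) ≤log n → k ^ 4 ≤ n
log-power k n log = *-cancelˡ-≤ 24 (begin
  24 * k ^ 4           ≤⟨ *-monoˡ-≤ (k ^ 4) (≤ᵇ⇒≤ 24 4096 _) ⟩
  4096 * k ^ 4         ≡⟨ *-^ 8 k 4 ⟨
  (8 * k) ^ 4          ≤⟨ ^-≤log (8 * k) n 4 log ⟩
  n * 24               ≡⟨ *-comm n 24 ⟩
  24 * n               ∎)
  where open ≤-Reasoning

*-square-cancel : ∀ {x y} → x * x ≤ y * y → x ≤ y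
*-square-cancel x²≤y² = ≮⇒≥ λ y<x → <⇒≱ (*-mono-< y<x y<x) x²≤y²

lemma2p9 : (δ : ℝ) → lower δ 0ℚ → upper δ ½ →
    ∃[ K ] ∃[ n₀ ] ∀ (n m k : ℕ) → n₀ ≤ n →
    (δ · (n C 2) ≲ m) → (m ≲ (1- δ) · (n C 2)) →
    1 ≤ k → (8 * k) ≤log n →
    𝔼 n m (λ G → hamiltonCycles n G ^ k) ℚ.≤ (K ^ℚ k) ℚ.* (𝔼 n m (hamiltonCycles n) ^ℚ k)
lemma2p9 δ 0<δ _ = fromℕ (constant D) , threshold * threshold , bound
  where
  D : ℕ
  D = proj₁ (density-positive δ 0<δ)
  1≤D : 1 ≤ D
  1≤D = proj₁ (proj₂ (density-positive δ 0<δ))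
  dense : ∀ c m → δ · c ≲ m → c ≤ D * m
  dense = proj₂ (proj₂ (density-positive δ 0<δ))
  -- From n ≥ (4096 D²)² and n ≥ k⁴ follows n² ≥ (4096 k²D²)², the square of the requirement
  -- `large`.
  threshold : ℕ
  threshold = 4096 * (D * D)
  3≤threshold² : 3 ≤ threshold * threshold
  3≤threshold² = ≤-trans (≤ᵇ⇒≤ 3 (4096 * 4096) _) (*-mono-≤ 4096≤ 4096≤)
    where
    4096≤ : 4096 ≤ threshold
    4096≤ = ≤-trans (≤-reflexive (sym (*-identityʳ 4096))) (*-monoʳ-≤ 4096 (*-mono-≤ 1≤D 1≤D))
  bound : ∀ n m k → threshold * threshold ≤ n → (δ · (n C 2) ≲ m) → (m ≲ (1- δ) · (n C 2)) → 1 ≤ k → (8 * k) ≤log n →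
    𝔼 n m (λ G → hamiltonCycles n G ^ k) ℚ.≤ (fromℕ (constant D) ^ℚ k) ℚ.* (𝔼 n m (hamiltonCycles n) ^ℚ k)
  bound zero    m k n₀≤0 = contradiction (≤-trans 3≤threshold² n₀≤0) λ ()
  bound (suc l) m k n₀≤n δN≤m m≤[1-δ]N 1≤k log = average-^-≤ (hamiltonCycles (suc l)) (graphs (suc l) m) (constant D) k 1≤k
    (moment-≤ (s≤s⁻¹ (≤-trans 3≤threshold² n₀≤n)) m k D 1≤k 1≤D
      (subst (m ≤_) (sym (length-pairs (suc l))) (density-≤1 δ 0<δ (suc l C 2) m m≤[1-δ]N))
      (subst (_≤ D * m) (sym (length-pairs (suc l))) (dense (suc l C 2) m δN≤m))
      large)
    where
    open ≤-Reasoning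
    i₁ : ∀ c k D → c * (k * D * (k * D)) * (c * (k * D * (k * D))) ≡ c * (D * D) * (c * (D * D)) * (k * (k * (k * (k * 1))))
    i₁ = solve-∀
    large : 4096 * (k * D * (k * D)) ≤ suc l
    large = *-square-cancel (begin
      4096 * (k * D * (k * D)) * (4096 * (k * D * (k * D)))   ≡⟨ i₁ 4096 k D ⟩
      threshold * threshold * k ^ 4                           ≤⟨ *-mono-≤ n₀≤n (log-power k (suc l) log) ⟩
      suc l * suc l                                           ∎)
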